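{- Let $\theta_q:H_n(q)\to\mathbb Z[q^{1/2},q^{ -1/2}]$ be a $\mathbb Z[q^{1/2},q^{ -1/2}]$-linear function, let $J_1,\dotsc,J_m$ be nonempty subintervals of $[n]$, and let the star network $G=G_{J_1}\circ\cdots\circ G_{J_m}$ have weighted path matrix $B$. Then $$\theta_q\bigl(\widetilde C_{s_{J_1}}(q)\cdots\widetilde C_{s_{J_m}}(q)\bigr)=\sigma_B\bigl(\mathrm{Imm}_{\theta_q}(x)\bigr).$$
   Context: Hecke algebra. $H_n(q)$ is the algebra over $\mathbb Z[q^{1/2},q^{ -1/2}]$ with unit $T_e$ generated by $T_{s_1},\dotsc,T_{s_{n-1}}$ ($s_i$ the adjacent transpositions in $\mathfrak S_n$) with relations $T_{s_i}^2=(q-1)T_{s_i}+qT_e$, $T_{s_i}T_{s_j}T_{s_i}=T_{s_j}T_{s_i}T_{s_j}$ if $|i-j|=1$, $T_{s_i}T_{s_j}=T_{s_j}T_{s_i}$ if $|i-j|\ge 2$; it has natural basis $\{T_w\mid w\in\mathfrak S_n\}$, where $T_w=T_{s_{i_1}}\cdots T_{s_{i_\ell}}$ for a reduced expression $w=s_{i_1}\cdots s_{i_\ell}$. Permutations are written in one-line notation $w=w_1\cdots w_n$, with $s_j v$ obtained from $v$ by swapping the letters in positions $j,j+1$ (so $(uv)_i=v_{u_i}$); $\ell(w)$ is the length (number of inversions). For an interval $J=[a,b]\subseteq[n]$, $\mathfrak S_J=\langle s_a,\dotsc,s_{b-1}\rangle$, $s_J$ is its longest element and $\widetilde C_{s_J}(q)=\sum_{w\in\mathfrak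 S_J}T_w$ (a modified signless Kazhdan-Lusztig basis element). Quantum matrix bialgebra. $\mathcal A$ is the associative unital $\mathbb Z[q^{1/2},q^{ -1/2}]$-algebra generated by $x_{i,j}$ ($1\le i,j\le n$) with relations, for $i<j$ and $k<\ell$: $x_{i,\ell}x_{i,k}=q^{1/2}x_{i,k}x_{i,\ell}$, $x_{j,k}x_{i,k}=q^{1/2}x_{i,k}x_{j,k}$, $x_{j,k}x_{i,\ell}=x_{i,\ell}x_{j,k}$, $x_{j,\ell}x_{i,k}=x_{i,k}x_{j,\ell}+(q^{1/2}-q^{ -1/2})x_{i,\ell}x_{j,k}$. Write $x^{u,w}=x_{u_1,w_1}\cdots x_{u_n,w_n}$ for $u,w\in\mathfrak S_n$; $\mathcal A_{[n],[n]}$ is the span of these, with basis $\{x^{e,w}\mid w\in\mathfrak S_n\}$. For linear $\theta_q$, $\mathrm{Imm}_{\theta_q}(x)=\sum_{w\in\mathfrak S_n}q^{ -\ell(w)/2}\theta_q(T_w)\,x_{1,w_1}\cdots x_{n,w_n}\in\mathcal A_{[n],[n]}$. Star networks. For $1\le a<b\le n$, $G_{[a,b]}$ is the planar directed graph with sources $1,\dotsc,n$ in a column on the left (bottom to top), sinks $1,\dotsc,n$ in a column on the right (bottom to top), one interior (central) vertex, an edge from source $i$ to sink $i$ for $i<a$ and $i>b$, and, for $a\le i\le b$, an edge from source $i$ to the interior vertex and an edge from the interior vertex to sink $i$. $G_{[a,a]}$ has just the edges from source $i$ to sink $i$. $G\circ H$ identifies sink $i$ of $G$ with source $i$ of $H$.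 A star network is a concatenation $G=G_{J_1}\circ\cdots\circ G_{J_m}$. Weights and $\sigma_B$. Write $J_p=[i_p,j_p]$. For each $p\in\{1,\dotsc,m\}$ with $i_p<j_p$, take indeterminates $z_{h,p,k}$ ($i_p\le h\le j_p$, $k\in\{1,2\}$). $Z_G$ is the $\mathbb Z[q^{1/2},q^{ -1/2}]$-algebra generated by all of these modulo $z_{h_2,p_2,k_2}z_{h_1,p_1,k_1}=z_{h_1,p_1,k_1}z_{h_2,p_2,k_2}$ if $p_1\ne p_2$ or $k_1\ne k_2$, and $z_{h_2,p,k}z_{h_1,p,k}=q^{1/2}z_{h_1,p,k}z_{h_2,p,k}$ if $h_1<h_2$. In $G_{J_p}$, the edge from source $h$ into the central vertex has weight $z_{h,p,1}$, the edge from the central vertex to sink $h$ has weight $z_{h,p,2}$, and all other edges have weight $1$. The weight of a path is the product of its edge weights in order along the path. The weighted path matrix $B=(b_{i,j})$ has $b_{i,j}$ equal to the sum of the weights of all paths from source $i$ to sink $j$ of $G$. Let $z_G$ be the product of all the indeterminates $z_{h,p,k}$, in lexicographic order of $(h,p,k)$, and let $[z_G]f$ be the coefficient of $z_G$ in $f\in Z_G$ after expansion in the basis of lexicographically ordered monomials. Then $\sigma_B:\mathcal A_{[n],[n]}\to\mathbb Z[q^{1/2},q^{ -1/2}]$ is the linear map defined on the basis by $\sigma_B(x_{1,v_1}\cdots x_{n,v_n})=[z_G]\,b_{1,v_1}\cdots b_{n,v_n}$. -}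

module Defs where

open import Level using (0ℓ)
open import Algebra.Bundles using (CommutativeRing; Ring)
open import Algebra.Module.Bundles using (LeftModule)
import Algebra.Module.Construct.TensorUnit as TensorUnit
open import Algebra.Module.Morphism.Structures using (module LeftModuleMorphisms)
import Algebra.Properties.CommutativeSemigroup as CommutativeSemigroupProperties
import Algebra.Properties.Ring as RingProperties
import Algebra.Properties.Semiring.Exp as Exp
import Algebra.Solver.Ring.NaturalCoefficients.Default as Solver
open import Data.Bool.Base using (Bool; true; false; if_then_else_; _∧_; not)
open import Data.Empty.Irrelevant using (⊥-elim)
open import Data.Fin.Base as Fin using (Fin; zero; suc; toℕ; inject₁; punchIn; punchOut)
open import Data.Fin.Patterns using (0F; 1F)
open import Data.Fin.Permutation as Perm
  using (Permutation′; _⟨$⟩ʳ_; _∘ₚ_; transpose; insert; remove; lift₀)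
import Data.Fin.Properties as Fin
open import Data.Integer.Base as ℤ using (ℤ; 0ℤ; 1ℤ; -1ℤ)
import Data.Integer.Properties as ℤ
open import Data.Integer.Tactic.RingSolver using (solve-∀)
open import Data.List.Base as List
  using (List; []; _∷_; [_]; _++_; map; length; allFin; filter; foldr; concatMap; replicate;
         cartesianProductWith)
open import Data.List.Membership.Propositional using (_∈_)
open import Data.List.Membership.Propositional.Properties as ∈ using (∈-allFin; ∈-concatMap⁺)
import Data.List.Properties as List
open import Data.List.Relation.Binary.Permutation.Propositional
  using (_↭_; ↭⇒↭ₛ; ↭-refl; ↭-sym; ↭-trans; prep; swap)
import Data.List.Relation.Binary.Permutation.Propositional.Properties as ↭
open import Data.List.Relation.Unary.All as All using (All; []; _∷_)
import Data.List.Relation.Unary.All.Properties as All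
open import Data.List.Relation.Unary.AllPairs as AllPairs using (AllPairs; []; _∷_)
import Data.List.Relation.Unary.AllPairs.Properties as AllPairs
open import Data.List.Relation.Unary.Any as Any using (Any; here; there)
import Data.List.Relation.Unary.Any.Properties as Any
open import Data.List.Relation.Unary.Unique.Propositional using (Unique)
import Data.List.Relation.Unary.Unique.Propositional.Properties as Unique
open import Data.Maybe.Base as Maybe using (Maybe; just; nothing; maybe′)
open import Data.Nat.Base as ℕ using (ℕ; zero; suc; pred; z≤n; s≤s; z<s; s<s; s≤s⁻¹; ∣_-_∣)
import Data.Nat.Properties as ℕ
open import Algebra.Properties.CommutativeMonoid.Sum ℕ.+-0-commutativeMonoid
  using (sum; sum-cong-≗; sum-permute)
open import Data.Product.Base using (Σ-syntax; ∃-syntax; _×_; _,_; proj₁; proj₂)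
open import Data.Sum.Base using (_⊎_; inj₁; inj₂)
open import Data.Vec.Base using (Vec; []; _∷_; lookup)
open import Function.Base using (_∘_; _on_)
open import Function.Bundles using (Injection; mk⇔)
open import Function.Properties.Inverse using (↔⇒↣)
open import Relation.Binary.Construct.Closure.ReflexiveTransitive using (Star; ε; _◅_; gmap)
open import Relation.Binary.PropositionalEquality as ≡
  using (_≡_; _≢_; refl; sym; trans; cong; cong₂; subst; module ≡-Reasoning)
open import Relation.Nullary using (Dec; yes; no; does; ¬_; contradiction; ¬?; _×-dec_)
import Relation.Nullary.Decidable as Dec

module LaurentPolynomials where

  -- A list of terms c·vᵉ (v = q^½), each written (c , e); exponents may repeat,
  -- so equality compares coefficients.
  Laurent : Set
  Laurent = List (ℤ × ℤ)

  coeff : Laurent → ℤ → ℤ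
  coeff []            k = 0ℤ
  coeff ((c , e) ∷ f) k = (if does (e ℤ.≟ k) then c else 0ℤ) ℤ.+ coeff f k

  infix 4 _≈_
  record _≈_ (f g : Laurent) : Set where
    constructor mk
    field at : ∀ k → coeff f k ≡ coeff g k
  open _≈_

  scale : ℤ × ℤ → Laurent → Laurent
  scale (c , e) = map (λ (d , f) → c ℤ.* d , e ℤ.+ f)

  infixl 7 _*_
  _*_ : Laurent → Laurent → Laurent
  []      * g = []
  (t ∷ f) * g = scale t g ++ (f * g)

  -_ : Laurent → Laurent
  -_ = scale (-1ℤ , 0ℤ)

  private
    coeff-++ : ∀ f g k → coeff (f ++ g) k ≡ coeff f k ℤ.+ coeff g k
    coeff-++ []      g k = sym (ℤ.+-identityˡ _)
    coeff-++ ((c , e) ∷ f) g k = trans (cong (ℤ._+_ a) (coeff-++ f g k))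
                                         (sym (ℤ.+-assoc a (coeff f k) (coeff g k)))
      where a = if does (e ℤ.≟ k) then c else 0ℤ

    coeff-scale : ∀ c e g k → coeff (scale (c , e) g) k ≡ c ℤ.* coeff g (k ℤ.- e)
    coeff-scale c e []            k = sym (ℤ.*-zeroʳ c)
    coeff-scale c e ((d , h) ∷ g) k = begin
      (if does (e ℤ.+ h ℤ.≟ k) then c ℤ.* d else 0ℤ) ℤ.+ coeff (scale (c , e) g) k
        ≡⟨ cong₂ ℤ._+_ head (coeff-scale c e g k) ⟩
      c ℤ.* (if does (h ℤ.≟ k ℤ.- e) then d else 0ℤ) ℤ.+ c ℤ.* coeff g (k ℤ.- e)
        ≡⟨ ℤ.*-distribˡ-+ c _ _ ⟨
      c ℤ.* coeff ((d , h) ∷ g) (k ℤ.- e) ∎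
      where
      open ≡-Reasoning
      eh-e : ∀ e h → (e ℤ.+ h) ℤ.- e ≡ h
      eh-e = solve-∀
      ke+e : ∀ e k → e ℤ.+ (k ℤ.- e) ≡ k
      ke+e = solve-∀
      head : (if does (e ℤ.+ h ℤ.≟ k) then c ℤ.* d else 0ℤ)
             ≡ c ℤ.* (if does (h ℤ.≟ k ℤ.- e) then d else 0ℤ)
      head with e ℤ.+ h ℤ.≟ k | h ℤ.≟ k ℤ.- e
      ... | yes _    | yes _ = refl
      ... | no  _    | no  _ = sym (ℤ.*-zeroʳ c)
      ... | yes refl | no  ¬q = contradiction (sym (eh-e e h)) ¬q
      ... | no  ¬p   | yes refl = contradiction (ke+e e k) ¬p

    ≈-refl : ∀ {f} → f ≈ f
    ≈-refl = mk λ _ → refl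

    ≈-sym : ∀ {f g} → f ≈ g → g ≈ f
    ≈-sym p = mk λ k → sym (at p k)

    ≈-trans : ∀ {f g h} → f ≈ g → g ≈ h → f ≈ h
    ≈-trans p q = mk λ k → trans (at p k) (at q k)

    ≡⇒≈ : ∀ {f g} → f ≡ g → f ≈ g
    ≡⇒≈ refl = ≈-refl

    +-cong : ∀ {f f′ g g′} → f ≈ f′ → g ≈ g′ → f ++ g ≈ f′ ++ g′
    +-cong {f} {f′} {g} {g′} p q = mk λ k →
      trans (coeff-++ f g k) (trans (cong₂ ℤ._+_ (at p k) (at q k)) (sym (coeff-++ f′ g′ k)))

    +-comm : ∀ f g → f ++ g ≈ g ++ f
    +-comm f g = mk λ k →
      trans (coeff-++ f g k) (trans (ℤ.+-comm (coeff f k) _) (sym (coeff-++ g f k)))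

    scale-cong : ∀ t {f g} → f ≈ g → scale t f ≈ scale t g
    scale-cong (c , e) {f} {g} p = mk λ k →
      trans (coeff-scale c e f k)
        (trans (cong (ℤ._*_ c) (at p _)) (sym (coeff-scale c e g k)))

    -‿inverseʳ : ∀ f → f ++ - f ≈ []
    -‿inverseʳ f = mk λ k → trans (coeff-++ f (- f) k)
      (trans (cong (ℤ._+_ (coeff f k))
                (trans (coeff-scale -1ℤ 0ℤ f k)
                  (trans (ℤ.-1*i≡-i _) (cong (λ j → ℤ.- coeff f j) (ℤ.+-identityʳ k)))))
             (ℤ.+-inverseʳ (coeff f k)))

    *-congʳ : ∀ f {g h} → g ≈ h → f * g ≈ f * h
    *-congʳ []      p = ≈-refl
    *-congʳ (t ∷ f) p = +-cong (scale-cong t p) (*-congʳ f p)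

    *-zeroʳ : ∀ f → f * [] ≡ []
    *-zeroʳ []      = refl
    *-zeroʳ (t ∷ f) = *-zeroʳ f

    *-∷ : ∀ f t g → f * (t ∷ g) ≈ scale t f ++ f * g
    *-∷ []            t         g = ≈-refl
    *-∷ ((c , e) ∷ f) (d , h) g = mk λ k → begin
      a k ℤ.+ coeff (s g ++ f * ((d , h) ∷ g)) k
        ≡⟨ cong (ℤ._+_ (a k)) (trans (coeff-++ (s g) _ k) (cong (ℤ._+_ (coeff (s g) k))
             (trans (at (*-∷ f (d , h) g) k) (coeff-++ (scale (d , h) f) (f * g) k)))) ⟩
      a k ℤ.+ (coeff (s g) k ℤ.+ (coeff (scale (d , h) f) k ℤ.+ coeff (f * g) k))
        ≡⟨ cong₂ ℤ._+_ (cong₂ (λ i j → if does (i ℤ.≟ k) then j else 0ℤ)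
                         (ℤ.+-comm e h) (ℤ.*-comm c d))
                       (exchange (coeff (s g) k) (coeff (scale (d , h) f) k) (coeff (f * g) k)) ⟩
      a′ k ℤ.+ (coeff (scale (d , h) f) k ℤ.+ (coeff (s g) k ℤ.+ coeff (f * g) k))
        ≡⟨ cong (λ i → a′ k ℤ.+ (coeff (scale (d , h) f) k ℤ.+ i)) (coeff-++ (s g) (f * g) k) ⟨
      a′ k ℤ.+ (coeff (scale (d , h) f) k ℤ.+ coeff (s g ++ f * g) k)
        ≡⟨ cong (ℤ._+_ (a′ k)) (coeff-++ (scale (d , h) f) _ k) ⟨
      coeff (scale (d , h) ((c , e) ∷ f) ++ (s g ++ f * g)) k ∎
      where
      open ≡-Reasoning
      s = scale (c , e)
      a a′ : ℤ → ℤ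
      a  k = if does (e ℤ.+ h ℤ.≟ k) then c ℤ.* d else 0ℤ
      a′ k = if does (h ℤ.+ e ℤ.≟ k) then d ℤ.* c else 0ℤ
      exchange : ∀ x y z → x ℤ.+ (y ℤ.+ z) ≡ y ℤ.+ (x ℤ.+ z)
      exchange = solve-∀

    *-comm : ∀ f g → f * g ≈ g * f
    *-comm []      g = ≡⇒≈ (sym (*-zeroʳ g))
    *-comm (t ∷ f) g = ≈-trans (+-cong (≈-refl {scale t g}) (*-comm f g)) (≈-sym (*-∷ g t f))

    *-cong : ∀ {f f′ g g′} → f ≈ f′ → g ≈ g′ → f * g ≈ f′ * g′
    *-cong {f} {f′} {g} {g′} p q =
      ≈-trans (*-congʳ f q) (≈-trans (*-comm f g′) (≈-trans (*-congʳ g′ p) (*-comm g′ f′)))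

    *-distribʳ : ∀ h f g → (f ++ g) * h ≡ f * h ++ g * h
    *-distribʳ h []      g = refl
    *-distribʳ h (t ∷ f) g =
      trans (cong (scale t h ++_) (*-distribʳ h f g)) (sym (List.++-assoc (scale t h) _ _))

    *-distribˡ : ∀ h f g → h * (f ++ g) ≈ h * f ++ h * g
    *-distribˡ h f g = ≈-trans (*-comm h (f ++ g))
      (≈-trans (≡⇒≈ (*-distribʳ h f g)) (+-cong (*-comm f h) (*-comm g h)))

    scale-scale : ∀ c e d h g →
      scale (c ℤ.* d , e ℤ.+ h) g ≡ scale (c , e) (scale (d , h) g)
    scale-scale c e d h g = trans
      (List.map-cong (λ (a , b) → cong₂ _,_ (ℤ.*-assoc c d a) (ℤ.+-assoc e h b)) g)
      (List.map-∘ g)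

    scale-* : ∀ t f g → scale t f * g ≡ scale t (f * g)
    scale-* t []      g = refl
    scale-* t@(c , e) ((d , h) ∷ f) g =
      trans (cong₂ _++_ (scale-scale c e d h g) (scale-* t f g))
            (sym (List.map-++ _ (scale (d , h) g) (f * g)))

    *-assoc : ∀ f g h → (f * g) * h ≡ f * (g * h)
    *-assoc []      g h = refl
    *-assoc (t ∷ f) g h = trans (*-distribʳ h (scale t g) (f * g))
      (cong₂ _++_ (scale-* t g h) (*-assoc f g h))

    *-identityˡ : ∀ f → [ (1ℤ , 0ℤ) ] * f ≡ f
    *-identityˡ f = trans (List.++-identityʳ _) (trans
      (List.map-cong (λ (c , e) → cong₂ _,_ (ℤ.*-identityˡ c) (ℤ.+-identityˡ e)) f)
      (List.map-id f))

  commutativeRing : CommutativeRing 0ℓ 0ℓ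
  commutativeRing = record
    { Carrier = Laurent
    ; _≈_ = _≈_
    ; _+_ = _++_
    ; _*_ = _*_
    ; -_ = -_
    ; 0# = []
    ; 1# = [ (1ℤ , 0ℤ) ]
    ; isCommutativeRing = record
      { isRing = record
        { +-isAbelianGroup = record
          { isGroup = record
            { isMonoid = record
              { isSemigroup = record
                { isMagma = record
                  { isEquivalence = record { refl = ≈-refl ; sym = ≈-sym ; trans = ≈-trans }
                  ; ∙-cong = +-cong }
                ; assoc = λ f g h → ≡⇒≈ (List.++-assoc f g h) }
              ; identity = (λ _ → ≈-refl) , λ f → ≡⇒≈ (List.++-identityʳ f) }
            ; inverse = (λ f → ≈-trans (+-comm (- f) f) (-‿inverseʳ f)) , -‿inverseʳ
            ; ⁻¹-cong = scale-cong (-1ℤ , 0ℤ) }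
          ; comm = +-comm }
        ; *-cong = *-cong
        ; *-assoc = λ f g h → ≡⇒≈ (*-assoc f g h)
        ; *-identity = (λ f → ≡⇒≈ (*-identityˡ f))
                     , λ f → ≈-trans (*-comm f _) (≡⇒≈ (*-identityˡ f))
        ; distrib = *-distribˡ , λ h f g → ≡⇒≈ (*-distribʳ h f g) }
      ; *-comm = *-comm }
    }

module LinearAlgebra (R : CommutativeRing 0ℓ 0ℓ) where
  private module R = CommutativeRing R

  record LinearForm (M : LeftModule R.ring 0ℓ 0ℓ) : Set where
    private module M = LeftModule M
    open LeftModuleMorphisms M.rawLeftModule
      (LeftModule.rawLeftModule (TensorUnit.leftModule {R = R.ring}))
    field
      ⟦_⟧      : M.Carrierᴹ → R.Carrier
      isLinear : IsLeftModuleHomomorphism ⟦_⟧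
    open IsLeftModuleHomomorphism isLinear public

  module _ (M : LeftModule R.ring 0ℓ 0ℓ) {I : Set} (b : I → LeftModule.Carrierᴹ M) where
    open LeftModule M

    data InSpan : Carrierᴹ → Set where
      gen   : ∀ i → InSpan (b i)
      zero  : InSpan 0ᴹ
      plus  : ∀ {x y} → InSpan x → InSpan y → InSpan (x +ᴹ y)
      neg   : ∀ {x} → InSpan x → InSpan (-ᴹ x)
      scale : ∀ c {x} → InSpan x → InSpan (c *ₗ x)

    span : LeftModule R.ring 0ℓ 0ℓ
    span = record
      { Carrierᴹ = Σ[ x ∈ Carrierᴹ ] InSpan x
      ; _≈ᴹ_     = _≈ᴹ_ on proj₁
      ; _+ᴹ_     = λ (x , p) (y , q) → x +ᴹ y , plus p q
      ; _*ₗ_     = λ c (x , p) → c *ₗ x , scale c p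
      ; 0ᴹ       = 0ᴹ , zero
      ; -ᴹ_      = λ (x , p) → -ᴹ x , neg p
      ; isLeftModule = record
        { isLeftSemimodule = record
          { +ᴹ-isCommutativeMonoid = record
            { isMonoid = record
              { isSemigroup = record
                { isMagma = record
                  { isEquivalence = record { refl = ≈ᴹ-refl ; sym = ≈ᴹ-sym ; trans = ≈ᴹ-trans }
                  ; ∙-cong = +ᴹ-cong }
                ; assoc = λ _ _ _ → +ᴹ-assoc _ _ _ }
              ; identity = (λ _ → +ᴹ-identityˡ _) , λ _ → +ᴹ-identityʳ _ }
            ; comm = λ _ _ → +ᴹ-comm _ _ }
          ; isPreleftSemimodule = record
            { *ₗ-cong = *ₗ-cong
            ; *ₗ-zeroˡ = λ _ → *ₗ-zeroˡ _
            ; *ₗ-distribʳ = λ _ _ _ → *ₗ-distribʳ _ _ _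
            ; *ₗ-identityˡ = λ _ → *ₗ-identityˡ _
            ; *ₗ-assoc = λ _ _ _ → *ₗ-assoc _ _ _
            ; *ₗ-zeroʳ = *ₗ-zeroʳ
            ; *ₗ-distribˡ = λ _ _ _ → *ₗ-distribˡ _ _ _ } }
        ; -ᴹ‿cong = -ᴹ‿cong
        ; -ᴹ‿inverse = (λ _ → -ᴹ‿inverseˡ _) , λ _ → -ᴹ‿inverseʳ _ } }

    restrict : LinearForm M → LinearForm span
    restrict φ = record
      { ⟦_⟧ = λ (x , _) → ⟦ φ ⟧ x
      ; isLinear = record
        { +ᴹ-isGroupHomomorphism = record
          { isMonoidHomomorphism = record
            { isMagmaHomomorphism = record
              { isRelHomomorphism = record { cong = ⟦⟧-cong φ }
              ; homo = λ _ _ → +ᴹ-homo φ _ _ }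
            ; ε-homo = 0ᴹ-homo φ }
          ; ⁻¹-homo = λ _ → -ᴹ-homo φ _ }
        ; *ₗ-homo = λ c _ → *ₗ-homo φ c _ } }
      where open LinearForm

  ∑ᴹ : (M : LeftModule R.ring 0ℓ 0ℓ) → List (LeftModule.Carrierᴹ M) → LeftModule.Carrierᴹ M
  ∑ᴹ M = foldr (LeftModule._+ᴹ_ M) (LeftModule.0ᴹ M)

  infixl 6 _+_
  infixl 7 _*_
  data Expr (X : Set) : Set where
    const   : R.Carrier → Expr X
    gen     : X → Expr X
    _+_ _*_ : Expr X → Expr X → Expr X
    -_      : Expr X → Expr X

  ∑ ∏ : ∀ {X} → List (Expr X) → Expr X
  ∑ = foldr _+_ (const R.0#)
  ∏ = foldr _*_ (const R.1#)

  record Presentation : Set₁ where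
    field
      Gen : Set
      Rel : Expr Gen → Expr Gen → Set

  -- The associative unital R-algebra ⟨ Gen ∣ Rel ⟩: expressions modulo the least
  -- congruence containing Rel and the algebra axioms, scalars being central constants.
  module Algebra (P : Presentation) where
    open Presentation P

    infix 4 _≈_
    data _≈_ : Expr Gen → Expr Gen → Set where
      rel         : ∀ {s t} → Rel s t → s ≈ t
      ≈-refl      : ∀ {s} → s ≈ s
      ≈-sym       : ∀ {s t} → s ≈ t → t ≈ s
      ≈-trans     : ∀ {s t u} → s ≈ t → t ≈ u → s ≈ u
      +-cong      : ∀ {s s′ t t′} → s ≈ s′ → t ≈ t′ → s + t ≈ s′ + t′
      *-cong      : ∀ {s s′ t t′} → s ≈ s′ → t ≈ t′ → s * t ≈ s′ * t′
      -‿cong      : ∀ {s s′} → s ≈ s′ → - s ≈ - s′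
      +-assoc     : ∀ s t u → (s + t) + u ≈ s + (t + u)
      +-comm      : ∀ s t → s + t ≈ t + s
      +-identityˡ : ∀ s → const R.0# + s ≈ s
      -‿inverseˡ  : ∀ s → (- s) + s ≈ const R.0#
      *-assoc     : ∀ s t u → (s * t) * u ≈ s * (t * u)
      *-identityˡ : ∀ s → const R.1# * s ≈ s
      distribˡ    : ∀ s t u → s * (t + u) ≈ s * t + s * u
      distribʳ    : ∀ s t u → (t + u) * s ≈ t * s + u * s
      const-cong  : ∀ {c d} → c R.≈ d → const c ≈ const d
      const-+     : ∀ c d → const (c R.+ d) ≈ const c + const d
      const-*     : ∀ c d → const (c R.* d) ≈ const c * const d
      central     : ∀ c s → const c * s ≈ s * const c

    private
      +-identityʳ : ∀ s → s + const R.0# ≈ s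
      +-identityʳ s = ≈-trans (+-comm s _) (+-identityˡ s)

    ring : Ring 0ℓ 0ℓ
    ring = record
      { Carrier = Expr Gen
      ; _≈_ = _≈_
      ; _+_ = _+_
      ; _*_ = _*_
      ; -_ = -_
      ; 0# = const R.0#
      ; 1# = const R.1#
      ; isRing = record
        { +-isAbelianGroup = record
          { isGroup = record
            { isMonoid = record
              { isSemigroup = record
                { isMagma = record
                  { isEquivalence = record { refl = ≈-refl ; sym = ≈-sym ; trans = ≈-trans }
                  ; ∙-cong = +-cong }
                ; assoc = +-assoc }
              ; identity = +-identityˡ , +-identityʳ }
            ; inverse = -‿inverseˡ , λ s → ≈-trans (+-comm s (- s)) (-‿inverseˡ s)
            ; ⁻¹-cong = -‿cong }
          ; comm = +-comm }
        ; *-cong = *-cong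
        ; *-assoc = *-assoc
        ; *-identity = *-identityˡ , λ s → ≈-trans (≈-sym (central _ s)) (*-identityˡ s)
        ; distrib = distribˡ , distribʳ } }

    leftModule : LeftModule R.ring 0ℓ 0ℓ
    leftModule = record
      { Carrierᴹ = Expr Gen
      ; _≈ᴹ_ = _≈_
      ; _+ᴹ_ = _+_
      ; _*ₗ_ = λ c s → const c * s
      ; 0ᴹ = const R.0#
      ; -ᴹ_ = -_
      ; isLeftModule = record
        { isLeftSemimodule = record
          { +ᴹ-isCommutativeMonoid = Ring.+-isCommutativeMonoid ring
          ; isPreleftSemimodule = record
            { *ₗ-cong = λ p q → *-cong (const-cong p) q
            ; *ₗ-zeroˡ = Ring.zeroˡ ring
            ; *ₗ-distribʳ = λ s c d → ≈-trans (*-cong (const-+ c d) ≈-refl) (distribʳ s _ _)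
            ; *ₗ-identityˡ = *-identityˡ
            ; *ₗ-assoc = λ c d s → ≈-trans (*-cong (const-* c d) ≈-refl) (*-assoc _ _ s)
            ; *ₗ-zeroʳ = λ c → Ring.zeroʳ ring (const c)
            ; *ₗ-distribˡ = λ c → distribˡ (const c) } }
        ; -ᴹ‿cong = -‿cong
        ; -ᴹ‿inverse = Ring.-‿inverse ring } }

  -- Let the algebra act on the left on the free module with basis B / ∼.  Its transpose is
  -- a right action on the functions ψ : B → R respecting _∼_, and for fixed ψ and b the
  -- map t ↦ ψ (t b) is a linear form.  `act x ψ b` is ψ (x b), `eval t ψ b` is ψ (t b).
  module Action (P : Presentation) (B : Set) (_∼_ : B → B → Set)
                (act : Presentation.Gen P → (B → R.Carrier) → B → R.Carrier) where
    open Presentation P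
    open Algebra P using (_≈_; leftModule)
    open Algebra._≈_

    infix 4 _≗_
    _≗_ : (ψ χ : B → R.Carrier) → Set
    ψ ≗ χ = ∀ b → ψ b R.≈ χ b

    Respects : (B → R.Carrier) → Set
    Respects ψ = ∀ {b b′} → b ∼ b′ → ψ b R.≈ ψ b′

    eval : Expr Gen → (B → R.Carrier) → B → R.Carrier
    eval (const c) ψ b = c R.* ψ b
    eval (gen x)   ψ b = act x ψ b
    eval (s + t)   ψ b = eval s ψ b R.+ eval t ψ b
    eval (s * t)   ψ b = eval t (eval s ψ) b
    eval (- s)     ψ b = R.- eval s ψ b

    record IsAction : Set where
      field
        act-cong : ∀ x {ψ χ} → ψ ≗ χ → act x ψ ≗ act x χ
        act-+    : ∀ x ψ χ → act x (λ b → ψ b R.+ χ b) ≗ λ b → act x ψ b R.+ act x χ b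
        act-*    : ∀ x c ψ → act x (λ b → c R.* ψ b) ≗ λ b → c R.* act x ψ b
        act-resp : ∀ x {ψ} → Respects ψ → Respects (act x ψ)
        act-rel  : ∀ {s t} → Rel s t → ∀ {ψ} → Respects ψ → eval s ψ ≗ eval t ψ

    module _ (isAction : IsAction) where
      open IsAction isAction
      open RingProperties R.ring using (-‿distribʳ-*; -‿+-comm)
      private
        left-comm : ∀ c d e → c R.* (d R.* e) R.≈ d R.* (c R.* e)
        left-comm c d e = R.trans (R.sym (R.*-assoc c d e))
          (R.trans (R.*-cong (R.*-comm c d) R.refl) (R.*-assoc d c e))

        medial : ∀ a b c d → (a R.+ b) R.+ (c R.+ d) R.≈ (a R.+ c) R.+ (b R.+ d)
        medial a b c d = R.trans (R.+-assoc a b _) (R.trans (R.+-cong R.refl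
          (R.trans (R.sym (R.+-assoc b c d)) (R.trans (R.+-cong (R.+-comm b c) R.refl)
            (R.+-assoc c b d)))) (R.sym (R.+-assoc a c _)))

        eval-cong : ∀ t {ψ χ} → ψ ≗ χ → eval t ψ ≗ eval t χ
        eval-cong (const c) p b = R.*-cong R.refl (p b)
        eval-cong (gen x)   p b = act-cong x p b
        eval-cong (s + t)   p b = R.+-cong (eval-cong s p b) (eval-cong t p b)
        eval-cong (s * t)   p b = eval-cong t (eval-cong s p) b
        eval-cong (- t)     p b = R.-‿cong (eval-cong t p b)

        eval-+ : ∀ t ψ χ → eval t (λ b → ψ b R.+ χ b) ≗ λ b → eval t ψ b R.+ eval t χ b
        eval-+ (const c) ψ χ b = R.distribˡ c _ _
        eval-+ (gen x)   ψ χ b = act-+ x ψ χ b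
        eval-+ (s + t)   ψ χ b =
          R.trans (R.+-cong (eval-+ s ψ χ b) (eval-+ t ψ χ b)) (medial _ _ _ _)
        eval-+ (s * t)   ψ χ b =
          R.trans (eval-cong t (eval-+ s ψ χ) b) (eval-+ t (eval s ψ) (eval s χ) b)
        eval-+ (- t)     ψ χ b =
          R.trans (R.-‿cong (eval-+ t ψ χ b)) (R.sym (-‿+-comm _ _))

        eval-* : ∀ t c ψ → eval t (λ b → c R.* ψ b) ≗ λ b → c R.* eval t ψ b
        eval-* (const d) c ψ b = left-comm d c (ψ b)
        eval-* (gen x)   c ψ b = act-* x c ψ b
        eval-* (s + t)   c ψ b =
          R.trans (R.+-cong (eval-* s c ψ b) (eval-* t c ψ b)) (R.sym (R.distribˡ c _ _))
        eval-* (s * t)   c ψ b =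
          R.trans (eval-cong t (eval-* s c ψ) b) (eval-* t c (eval s ψ) b)
        eval-* (- t)     c ψ b =
          R.trans (R.-‿cong (eval-* t c ψ b)) (-‿distribʳ-* c _)

        eval-resp : ∀ t {ψ} → Respects ψ → Respects (eval t ψ)
        eval-resp (const c) r e = R.*-cong R.refl (r e)
        eval-resp (gen x)   r e = act-resp x r e
        eval-resp (s + t)   r e = R.+-cong (eval-resp s r e) (eval-resp t r e)
        eval-resp (s * t)   r e = eval-resp t (eval-resp s r) e
        eval-resp (- t)     r e = R.-‿cong (eval-resp t r e)

        sound : ∀ {s t} → s ≈ t → ∀ {ψ} → Respects ψ → eval s ψ ≗ eval t ψ
        sound (rel p)           r b = act-rel p r b
        sound ≈-refl            r b = R.refl
        sound (≈-sym p)         r b = R.sym (sound p r b)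
        sound (≈-trans p q)     r b = R.trans (sound p r b) (sound q r b)
        sound (+-cong p q)      r b = R.+-cong (sound p r b) (sound q r b)
        sound (*-cong {s} {s′} {t} {t′} p q) r b =
          R.trans (eval-cong t (sound p r) b) (sound q (eval-resp s′ r) b)
        sound (-‿cong p)        r b = R.-‿cong (sound p r b)
        sound (+-assoc s t u)   r b = R.+-assoc _ _ _
        sound (+-comm s t)      r b = R.+-comm _ _
        sound (+-identityˡ s)   r b = R.trans (R.+-cong (R.zeroˡ _) R.refl) (R.+-identityˡ _)
        sound (-‿inverseˡ s)    r b = R.trans (R.-‿inverseˡ _) (R.sym (R.zeroˡ _))
        sound (*-assoc s t u)   r b = R.refl
        sound (*-identityˡ s)   r b = eval-cong s (λ b → R.*-identityˡ _) b
        sound (distribˡ s t u)  r b = R.refl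
        sound (distribʳ s t u)  r b = eval-+ s _ _ b
        sound (const-cong p)    r b = R.*-cong p R.refl
        sound (const-+ c d)     r b = R.distribʳ _ c d
        sound (const-* c d)     r b = R.trans (R.*-assoc c d _) (left-comm c d _)
        sound (central c s) {ψ} r b = eval-* s c ψ b

      form : (ψ : B → R.Carrier) → Respects ψ → B → LinearForm leftModule
      form ψ r b = record
        { ⟦_⟧ = λ t → eval t ψ b
        ; isLinear = record
          { +ᴹ-isGroupHomomorphism = record
            { isMonoidHomomorphism = record
              { isMagmaHomomorphism = record
                { isRelHomomorphism = record { cong = λ p → sound p r b }
                ; homo = λ _ _ → R.refl }
              ; ε-homo = R.zeroˡ _ }
            ; ⁻¹-homo = λ _ → R.refl }
          ; *ₗ-homo = λ c t → eval-* t c ψ b } }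

module SymmetricGroup where

  -- One-line notation is w_i = w ⟨$⟩ʳ i, and (u ∘ₚ w)_i = w_{u_i}, so that s i ∘ₚ w is w
  -- with the letters in positions i and i + 1 exchanged.  Indices start at 0.
  s : ∀ {N} → Fin N → Permutation′ (suc N)
  s i = transpose (inject₁ i) (suc i)

  evalWord : ∀ {N} → List (Fin N) → Permutation′ (suc N)
  evalWord []      = Perm.id
  evalWord (i ∷ u) = s i ∘ₚ evalWord u

  ℓ : ∀ {n} → Permutation′ n → ℕ
  ℓ w = sum λ i → sum λ j → if does (i Fin.<? j) ∧ does (w ⟨$⟩ʳ j Fin.<? w ⟨$⟩ʳ i) then 1 else 0

  permutations : ∀ n → List (Permutation′ n)
  permutations zero    = Perm.id ∷ []
  permutations (suc n) = cartesianProductWith (insert zero) (allFin (suc n)) (permutations n)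

  below : ∀ {N} → Fin (suc N) → List (Fin N)
  below         zero    = []
  below {suc N} (suc k) = zero ∷ map suc (below k)

  -- The first letter of w exceeds w ⟨$⟩ʳ zero letters to its right; `below` carries it past
  -- them once these are sorted.
  reducedWord : ∀ {N} → Permutation′ (suc N) → List (Fin N)
  reducedWord {zero}  w = []
  reducedWord {suc N} w = map suc (reducedWord (remove zero w)) ++ below (w ⟨$⟩ʳ zero)

  private
    evalWord-++ : ∀ {N} (u t : List (Fin N)) → evalWord (u ++ t) Perm.≈ evalWord u ∘ₚ evalWord t
    evalWord-++ []      t i = refl
    evalWord-++ (k ∷ u) t i = evalWord-++ u t (s k ⟨$⟩ʳ i)

    evalWord-map-suc : ∀ {N} (u : List (Fin N)) → evalWord (map suc u) Perm.≈ lift₀ (evalWord u)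
    evalWord-map-suc []      i = sym (Perm.lift₀-id i)
    evalWord-map-suc (k ∷ u) i = trans
      (cong (evalWord (map suc u) ⟨$⟩ʳ_) (Perm.lift₀-transpose (inject₁ k) (suc k) i))
      (trans (evalWord-map-suc u _) (Perm.lift₀-comp (s k) (evalWord u) i))

    below-zero : ∀ {N} (k : Fin (suc N)) → evalWord (below k) ⟨$⟩ʳ zero ≡ k
    below-zero         zero    = refl
    below-zero {suc N} (suc k) =
      trans (evalWord-map-suc (below k) (suc zero)) (cong suc (below-zero k))

    below-suc : ∀ {N} (k : Fin (suc N)) i → evalWord (below k) ⟨$⟩ʳ suc i ≡ punchIn k i
    below-suc         zero    i       = refl
    below-suc {suc N} (suc k) zero    = evalWord-map-suc (below k) zero
    below-suc {suc N} (suc k) (suc i) =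
      trans (evalWord-map-suc (below k) (suc (suc i))) (cong suc (below-suc k i))

    length-below : ∀ {N} (k : Fin (suc N)) → length (below k) ≡ toℕ k
    length-below         zero    = refl
    length-below {suc N} (suc k) =
      cong suc (trans (List.length-map suc (below k)) (length-below k))

  reducedWord-eval : ∀ {N} (w : Permutation′ (suc N)) → evalWord (reducedWord w) Perm.≈ w
  reducedWord-eval {zero}  w zero with w ⟨$⟩ʳ zero
  ... | zero = refl
  reducedWord-eval {suc N} w i =
    trans (evalWord-++ (map suc u) (below (w ⟨$⟩ʳ zero)) i)
      (trans (cong (evalWord (below (w ⟨$⟩ʳ zero)) ⟨$⟩ʳ_)
               (trans (evalWord-map-suc u i) (Perm.lift₀-cong _ _ (reducedWord-eval w′) i)))
             (carry i))
    where
    w′ = remove zero w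
    u  = reducedWord w′
    carry : ∀ i → evalWord (below (w ⟨$⟩ʳ zero)) ⟨$⟩ʳ (lift₀ w′ ⟨$⟩ʳ i) ≡ w ⟨$⟩ʳ i
    carry zero    = below-zero _
    carry (suc i) = trans (below-suc (w ⟨$⟩ʳ zero) (w′ ⟨$⟩ʳ i)) (sym (Perm.punchIn-permute w zero i))

  private
    count-below : ∀ {n} (k : Fin n) → sum {n} (λ j → if does (j Fin.<? k) then 1 else 0) ≡ toℕ k
    count-below {suc n} zero    = none {n}
      where
      none : ∀ {n} → sum {n} (λ j → 0) ≡ 0
      none {zero}  = refl
      none {suc n} = none {n}
    count-below {suc n} (suc k) = cong suc (count-below {n} k)

    punchOut-<? : ∀ {n} {i j k : Fin (suc n)} (i≢j : ¬ i ≡ j) (i≢k : ¬ i ≡ k) →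
                  does (punchOut i≢j Fin.<? punchOut i≢k) ≡ does (j Fin.<? k)
    punchOut-<? {i = i} {j} {k} i≢j i≢k =
      Dec.does-⇔ (mk⇔ to from) (punchOut i≢j Fin.<? punchOut i≢k) (j Fin.<? k)
      where
      to : punchOut i≢j Fin.< punchOut i≢k → j Fin.< k
      to p = ℕ.≰⇒> (λ k≤j → ℕ.<⇒≱ p (Fin.punchOut-mono-≤ i≢k i≢j k≤j))
      from : j Fin.< k → punchOut i≢j Fin.< punchOut i≢k
      from p = ℕ.≰⇒> (λ q → ℕ.<⇒≱ p (Fin.punchOut-cancel-≤ i≢k i≢j q))

  ℓ-remove : ∀ {n} (w : Permutation′ (suc n)) → ℓ w ≡ ℓ (remove zero w) ℕ.+ toℕ (w ⟨$⟩ʳ zero)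
  ℓ-remove {n} w = trans (cong₂ ℕ._+_ first rest) (ℕ.+-comm (toℕ (w ⟨$⟩ʳ zero)) _)
    where
    ind : Bool → ℕ
    ind b = if b then 1 else 0
    w₀ = w ⟨$⟩ʳ zero
    first : sum {suc n} (λ j → ind (does (Fin.zero {n} Fin.<? j) ∧ does (w ⟨$⟩ʳ j Fin.<? w₀))) ≡ toℕ w₀
    first = trans (cong (ℕ._+ sum {n} (λ j → ind (does (w ⟨$⟩ʳ suc j Fin.<? w₀))))
                    (sym (cong ind (Dec.dec-false (w₀ Fin.<? w₀) (ℕ.n≮n (toℕ w₀))))))
            (trans (sym (sum-permute {suc n} {suc n} (λ j → ind (does (j Fin.<? w₀))) w))
                   (count-below {suc n} w₀))
    rest : sum {n} (λ i → sum {n} (λ j →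
             ind (does (i Fin.<? j) ∧ does (w ⟨$⟩ʳ suc j Fin.<? w ⟨$⟩ʳ suc i))))
           ≡ ℓ (remove zero w)
    rest = sum-cong-≗ {n} λ i → sum-cong-≗ {n} λ j →
      cong (λ b → ind (does (i Fin.<? j) ∧ b)) (sym (punchOut-<? (ne j) (ne i)))
      where
      ne : ∀ j → ¬ w₀ ≡ w ⟨$⟩ʳ suc j
      ne j e = Fin.0≢1+n (Injection.injective (↔⇒↣ w) e)

  reducedWord-length : ∀ {N} (w : Permutation′ (suc N)) → length (reducedWord w) ≡ ℓ w
  reducedWord-length {zero}  w with w ⟨$⟩ʳ zero
  ... | zero = refl
  reducedWord-length {suc N} w = begin
    length (map suc (reducedWord w′) ++ below (w ⟨$⟩ʳ zero))
      ≡⟨ List.length-++ (map suc (reducedWord w′)) ⟩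
    length (map suc (reducedWord w′)) ℕ.+ length (below (w ⟨$⟩ʳ zero))
      ≡⟨ cong₂ ℕ._+_ (trans (List.length-map Fin.suc (reducedWord w′)) (reducedWord-length w′))
                    (length-below (w ⟨$⟩ʳ zero)) ⟩
    ℓ w′ ℕ.+ toℕ (w ⟨$⟩ʳ zero)
      ≡⟨ ℓ-remove w ⟨
    ℓ w ∎
    where
    open ≡-Reasoning
    w′ = remove zero w

  private
    insert-zero : ∀ {n} j (π : Permutation′ n) → insert zero j π ⟨$⟩ʳ zero ≡ j
    insert-zero j π = refl

    insert-cong : ∀ {n} j (π ρ : Permutation′ n) →
                  π Perm.≈ ρ → insert zero j π Perm.≈ insert zero j ρ
    insert-cong j π ρ p zero    = refl
    insert-cong j π ρ p (suc i) = cong (punchIn j) (p i)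

    insert-injective : ∀ {n} {j k} {π ρ : Permutation′ n} →
                       insert zero j π Perm.≈ insert zero k ρ → j ≡ k × π Perm.≈ ρ
    insert-injective {j = j} p with p zero
    ... | refl = refl , λ i → Fin.punchIn-injective j _ _ (p (suc i))

  permutations-complete : ∀ {n} (w : Permutation′ n) → Any (w Perm.≈_) (permutations n)
  permutations-complete {zero}  w = Any.here λ ()
  permutations-complete {suc n} w =
    Any.cartesianProductWith⁺ (insert zero) combine
      (∈-allFin (w ⟨$⟩ʳ zero)) (permutations-complete (remove zero w))
    where
    combine : ∀ {j π} → w ⟨$⟩ʳ zero ≡ j → remove zero w Perm.≈ π → w Perm.≈ insert zero j π
    combine {π = π} refl p i = trans (sym (Perm.insert-remove zero w i)) (insert-cong _ _ π p i)

  permutations-unique : ∀ n → AllPairs (λ u w → ¬ u Perm.≈ w) (permutations n)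
  permutations-unique zero    = [] ∷ []
  permutations-unique (suc n) = product (allFin (suc n)) (Unique.allFin⁺ (suc n))
    where
    product : ∀ js → Unique js →
      AllPairs (λ u w → ¬ u Perm.≈ w) (cartesianProductWith (insert zero) js (permutations n))
    product []       []       = []
    product (j ∷ js) (j∉ ∷ u) = AllPairs.++⁺
      (AllPairs.map⁺ (AllPairs.map (λ ne eq → ne (proj₂ (insert-injective eq))) (permutations-unique n)))
      (product js u)
      (All.map⁺ (All.universal (λ π →
        All.cartesianProductWith⁺ (≡.setoid _) (≡.setoid _) (insert zero) js (permutations n)
        λ k∈ _ eq → All.lookup j∉ k∈ (proj₁ (insert-injective eq))) _))

  record Interval (n : ℕ) : Set where
    constructor interval
    field
      lo hi : Fin n
      lo≤hi : lo Fin.≤ hi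
  open Interval public

  infix 4 _∈ᴵ_ _∈ᴵ?_ _∈𝔖_ _∈𝔖?_
  _∈ᴵ_ : ∀ {n} → Fin n → Interval n → Set
  i ∈ᴵ J = lo J Fin.≤ i × i Fin.≤ hi J

  _∈ᴵ?_ : ∀ {n} (i : Fin n) (J : Interval n) → Dec (i ∈ᴵ J)
  i ∈ᴵ? J = lo J Fin.≤? i ×-dec i Fin.≤? hi J

  -- Since the s i are involutions, the subgroup they generate consists of their products.
  _∈𝔖_ : ∀ {N} → Permutation′ (suc N) → Interval (suc N) → Set
  w ∈𝔖 J = ∃[ u ] All (λ i → inject₁ i ∈ᴵ J × suc i ∈ᴵ J) u × w Perm.≈ evalWord u

  private
    Fixes : ∀ {n} → ℕ → ℕ → Permutation′ n → Set
    Fixes a c w = ∀ i → toℕ i ℕ.< a ⊎ c ℕ.≤ toℕ i → w ⟨$⟩ʳ i ≡ i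

    inj : ∀ {n} (w : Permutation′ n) {i j} → w ⟨$⟩ʳ i ≡ w ⟨$⟩ʳ j → i ≡ j
    inj w = Injection.injective (↔⇒↣ w)

    punchOut-< : ∀ {n} {i : Fin (suc n)} {j : Fin n} (i≢ : ¬ i ≡ suc j) →
                 i Fin.< suc j → punchOut i≢ ≡ j
    punchOut-<         {i = zero}              i≢ p       = refl
    punchOut-< {suc n} {i = suc i} {zero}  i≢ (s≤s ())
    punchOut-< {suc n} {i = suc i} {suc j} i≢ (s≤s p) = cong suc (punchOut-< _ p)

    below-< : ∀ {N} (k : Fin (suc N)) → All (λ i → toℕ i ℕ.< toℕ k) (below k)
    below-<         zero    = []
    below-< {suc N} (suc k) = z<s ∷ All.map⁺ (All.map s<s (below-< k))

    letters : ∀ {N} a c (w : Permutation′ (suc N)) → Fixes a c w →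
              All (λ i → a ℕ.≤ toℕ i × suc (toℕ i) ℕ.< c) (reducedWord w)
    letters {zero}  a c w fix = []
    letters {suc N} a c w fix = All.++⁺
      (All.map⁺ (All.map (λ (p , q) → up a p , up′ c q) (letters (pred a) (pred c) (remove zero w) fix′)))
      (All.map (λ {i} p → low p , high p) (below-< w₀))
      where
      w₀ = w ⟨$⟩ʳ zero
      up : ∀ a {i} → pred a ℕ.≤ i → a ℕ.≤ suc i
      up zero    p = z≤n
      up (suc a) p = s≤s p
      up′ : ∀ c {i} → suc i ℕ.< pred c → suc (suc i) ℕ.< c
      up′ (suc c) p = s<s p
      w₀-small : ∀ {i} → c ℕ.≤ suc i → toℕ w₀ ℕ.≤ i
      w₀-small {i} q with toℕ w₀ ℕ.≤? i
      ... | yes p = p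
      ... | no ¬p with inj w (fix w₀ (inj₂ (ℕ.≤-trans q (ℕ.≰⇒> ¬p))))
      ...   | e = contradiction (subst (λ k → toℕ k ℕ.≤ i) (sym e) z≤n) ¬p
      fix′ : Fixes (pred a) (pred c) (remove zero w)
      fix′ i o = trans (Fin.punchOut-cong w₀ fixed)
                   (punchOut-< (λ e → Fin.0≢1+n (inj w (trans e (sym fixed)))) (small o))
        where
        fixed : w ⟨$⟩ʳ suc i ≡ suc i
        shift : toℕ i ℕ.< pred a ⊎ pred c ℕ.≤ toℕ i → suc (toℕ i) ℕ.< a ⊎ c ℕ.≤ suc (toℕ i)
        shift (inj₁ p) = inj₁ (lemma a p)
          where
          lemma : ∀ a → toℕ i ℕ.< pred a → suc (toℕ i) ℕ.< a
          lemma (suc a) p = s<s p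
        shift (inj₂ p) = inj₂ (lemma c p)
          where
          lemma : ∀ c → pred c ℕ.≤ toℕ i → c ℕ.≤ suc (toℕ i)
          lemma zero    p = z≤n
          lemma (suc c) p = s≤s p
        fixed = fix (suc i) (shift o)
        small : toℕ i ℕ.< pred a ⊎ pred c ℕ.≤ toℕ i → w₀ Fin.< suc i
        small o with shift o
        ... | inj₁ p = s≤s (subst (λ k → toℕ k ℕ.≤ toℕ i)
                                 (sym (fix zero (inj₁ (ℕ.<-trans z<s p)))) z≤n)
        ... | inj₂ p = s≤s (w₀-small p)
      low : ∀ {i} → toℕ i ℕ.< toℕ w₀ → a ℕ.≤ toℕ i
      low {i} p with a ℕ.≤? toℕ i
      ... | yes q = q
      ... | no ¬q = contradiction
                      (subst (λ k → toℕ i ℕ.< toℕ k)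
                        (fix zero (inj₁ (ℕ.≤-<-trans z≤n (ℕ.≰⇒> ¬q)))) p) ℕ.n≮0
      high : ∀ {i} → toℕ i ℕ.< toℕ w₀ → suc (toℕ i) ℕ.< c
      high {i} p with suc (toℕ i) ℕ.<? c
      ... | yes q = q
      ... | no ¬q = contradiction (w₀-small (ℕ.≮⇒≥ ¬q)) (ℕ.<⇒≱ p)

    transpose-fixes : ∀ {n} (i j k : Fin n) → ¬ k ≡ i → ¬ k ≡ j → transpose i j ⟨$⟩ʳ k ≡ k
    transpose-fixes i j k k≢i k≢j with k Fin.≟ i
    ... | yes p = contradiction p k≢i
    ... | no _ with k Fin.≟ j
    ...   | yes p = contradiction p k≢j
    ...   | no _  = refl

    word-fixes : ∀ {N} (J : Interval (suc N)) u → All (λ i → inject₁ i ∈ᴵ J × suc i ∈ᴵ J) u →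
                 ∀ k → ¬ k ∈ᴵ J → evalWord u ⟨$⟩ʳ k ≡ k
    word-fixes J []      []             k k∉ = refl
    word-fixes J (i ∷ u) ((p , q) ∷ ps) k k∉ = trans
      (cong (evalWord u ⟨$⟩ʳ_) (transpose-fixes (inject₁ i) (suc i) k
        (λ { refl → k∉ p }) (λ { refl → k∉ q })))
      (word-fixes J u ps k k∉)

  _∈𝔖?_ : ∀ {N} (w : Permutation′ (suc N)) (J : Interval (suc N)) → Dec (w ∈𝔖 J)
  w ∈𝔖? J = Dec.map′
    (λ a → reducedWord w , a , λ i → sym (reducedWord-eval w i))
    (λ (u , a , p) → All.map convert (letters (toℕ (lo J)) (suc (toℕ (hi J))) w
       λ i o → trans (p i) (word-fixes J u a i (outside i o))))
    (All.all? (λ i → inject₁ i ∈ᴵ? J ×-dec suc i ∈ᴵ? J) (reducedWord w))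
    where
    outside : ∀ i → toℕ i ℕ.< toℕ (lo J) ⊎ toℕ (hi J) ℕ.< toℕ i → ¬ i ∈ᴵ J
    outside i (inj₁ p) (q , _) = ℕ.<⇒≱ p q
    outside i (inj₂ p) (_ , q) = ℕ.<⇒≱ p q
    convert : ∀ {i} → toℕ (lo J) ℕ.≤ toℕ i × suc (toℕ i) ℕ.< suc (toℕ (hi J)) →
              inject₁ i ∈ᴵ J × suc i ∈ᴵ J
    convert {i} (p , q) =
      (subst (toℕ (lo J) ℕ.≤_) e p , subst (ℕ._≤ toℕ (hi J)) e (ℕ.<⇒≤ (s≤s⁻¹ q)))
      , (ℕ.m≤n⇒m≤1+n p , s≤s⁻¹ q)
      where e = sym (Fin.toℕ-inject₁ i)

open SymmetricGroup

module StarNetworks where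

  Nondegenerate : ∀ {n} → Interval n → Set
  Nondegenerate J = lo J Fin.< hi J

  nondegenerate? : ∀ {n} (J : Interval n) → Dec (Nondegenerate J)
  nondegenerate? J = lo J Fin.<? hi J

  -- G_{J₁} ∘ ⋯ ∘ G_{Jₘ}.  Sink i of the first factor is identified with source i of the
  -- product of the others and is the vertex `rest (source i)`.  The empty product has n
  -- vertices, each both a source and a sink.
  data Vertex {n} : ∀ {m} → Vec (Interval n) m → Set where
    source : ∀ {m} {Js : Vec (Interval n) m} → Fin n → Vertex Js
    centre : ∀ {m J} {Js : Vec (Interval n) m} → .(Nondegenerate J) → Vertex (J ∷ Js)
    rest   : ∀ {m J} {Js : Vec (Interval n) m} → Vertex Js → Vertex (J ∷ Js)

  sink : ∀ {n m} {Js : Vec (Interval n) m} → Fin n → Vertex Js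
  sink {Js = []}     i = source i
  sink {Js = J ∷ Js} i = rest (sink i)

  data Edge {n} : ∀ {m} {Js : Vec (Interval n) m} → Vertex Js → Vertex Js → Set where
    straight : ∀ {m J} {Js : Vec (Interval n) m} i → .(¬ (Nondegenerate J × i ∈ᴵ J)) →
               Edge {Js = J ∷ Js} (source i) (rest (source i))
    enter    : ∀ {m J} {Js : Vec (Interval n) m} h .(l : Nondegenerate J) → .(h ∈ᴵ J) →
               Edge {Js = J ∷ Js} (source h) (centre l)
    leave    : ∀ {m J} {Js : Vec (Interval n) m} h .(l : Nondegenerate J) → .(h ∈ᴵ J) →
               Edge {Js = J ∷ Js} (centre l) (rest (source h))
    rest     : ∀ {m J} {Js : Vec (Interval n) m} {u v : Vertex Js} →
               Edge u v → Edge {Js = J ∷ Js} (rest u) (rest v)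

  Path : ∀ {n m} (Js : Vec (Interval n) m) → Fin n → Fin n → Set
  Path Js i j = Star Edge (source {Js = Js} i) (sink j)

  bypass : ∀ {n m J} {Js : Vec (Interval n) m} {i j} → .(¬ (Nondegenerate J × i ∈ᴵ J)) →
           Path Js i j → Path (J ∷ Js) i j
  bypass {i = i} ¬c π = straight i ¬c ◅ gmap rest rest π

  traverse : ∀ {n m J} {Js : Vec (Interval n) m} {i h j} →
             .(Nondegenerate J) → .(i ∈ᴵ J) → .(h ∈ᴵ J) →
             Path Js h j → Path (J ∷ Js) i j
  traverse {i = i} {h} l i∈ h∈ π = enter i l i∈ ◅ leave h l h∈ ◅ gmap rest rest π

  through : ∀ {n m J} {Js : Vec (Interval n) m} {i j} → .(Nondegenerate J) → .(i ∈ᴵ J) →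
            (∀ h → List (Path Js h j)) → Fin n → List (Path (J ∷ Js) i j)
  through {J = J} l i∈ πs h with h ∈ᴵ? J
  ... | yes h∈ = map (traverse l i∈ h∈) (πs h)
  ... | no  _  = []

  paths : ∀ {n m} (Js : Vec (Interval n) m) (i j : Fin n) → List (Path Js i j)
  paths []       i j with i Fin.≟ j
  ... | yes refl = [ ε ]
  ... | no  _    = []
  paths {n} (J ∷ Js) i j with nondegenerate? J ×-dec i ∈ᴵ? J
  ... | yes (l , i∈) = concatMap (through l i∈ λ h → paths Js h j) (allFin n)
  ... | no  ¬c       = map (bypass ¬c) (paths Js i j)

  private
    unrest : ∀ {n m J} {Js : Vec (Interval n) m} {u v : Vertex Js} {w} →
             Star Edge (rest {J = J} u) w → w ≡ rest v → Star Edge u v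
    unrest ε            refl = ε
    unrest (rest x ◅ π) e    = x ◅ unrest π e

    rest-unrest : ∀ {n m J} {Js : Vec (Interval n) m} {u v : Vertex Js} {w}
                  (π : Star Edge (rest {J = J} u) w) (e : w ≡ rest v) →
                  gmap rest rest (unrest π e) ≡ subst (Star Edge (rest u)) e π
    rest-unrest ε            refl = refl
    rest-unrest (rest x ◅ π) refl = cong (rest x ◅_) (rest-unrest π refl)

    unrest-rest : ∀ {n m J} {Js : Vec (Interval n) m} {u v : Vertex Js} (π : Star Edge u v) →
                  unrest {J = J} (gmap rest rest π) refl ≡ π
    unrest-rest ε       = refl
    unrest-rest (x ◅ π) = cong (x ◅_) (unrest-rest π)

    strip : ∀ {n m J} {Js : Vec (Interval n) m} {i j} → Path (J ∷ Js) i j → Σ[ h ∈ Fin n ] Path Js h j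
    strip (straight i _  ◅ π)               = i , unrest π refl
    strip (enter _ _ _ ◅ leave h _ _ ◅ π) = h , unrest π refl

    concatMap-AllPairs : ∀ {A : Set} {R : A → A → Set} {n} (f : Fin n → List A) →
      (∀ i → AllPairs R (f i)) →
      (∀ {i j} → i Fin.< j → All (λ x → All (R x) (f j)) (f i)) →
      AllPairs R (concatMap f (allFin n))
    concatMap-AllPairs {n = n} f p q = AllPairs.concat⁺
      (All.map⁺ (All.universal p (allFin n)))
      (AllPairs.map⁺ (AllPairs.tabulate⁺-< q))

    strip-injective : ∀ {n} {P : Fin n → Set} {h} {π ρ : P h} →
                      _≡_ {A = Σ[ h ∈ Fin n ] P h} (h , π) (h , ρ) → π ≡ ρ
    strip-injective refl = refl

  paths-complete : ∀ {n m} (Js : Vec (Interval n) m) {i j} (π : Path Js i j) → π ∈ paths Js i j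
  paths-complete [] {i} ε with i Fin.≟ i
  ... | yes refl = here refl
  ... | no  i≢i  = contradiction refl i≢i
  paths-complete (J ∷ Js) {i} {j} (straight .i ¬c ◅ π)
    with nondegenerate? J ×-dec i ∈ᴵ? J
  ... | yes c = ⊥-elim (¬c c)
  ... | no _  = subst (_∈ map (bypass ¬c) (paths Js i j)) (cong (straight i ¬c ◅_) (rest-unrest π refl))
                  (∈.∈-map⁺ (bypass ¬c) (paths-complete Js (unrest π refl)))
  paths-complete (J ∷ Js) {i} {j} (enter .i l i∈ ◅ leave h _ h∈ ◅ π)
    with nondegenerate? J ×-dec i ∈ᴵ? J
  ... | no ¬c = ⊥-elim (¬c (l , i∈))
  ... | yes _ = ∈-concatMap⁺ (through l i∈ λ h → paths Js h j) (Any.map exits (∈-allFin h))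
    where
    exits : ∀ {h′} → h ≡ h′ →
      (enter i l i∈ ◅ leave h l h∈ ◅ π) ∈ through l i∈ (λ h → paths Js h j) h′
    exits refl with h ∈ᴵ? J
    ... | no h∉ = ⊥-elim (h∉ h∈)
    ... | yes _ = subst (_∈ map (traverse l i∈ h∈) (paths Js h j))
                    (cong (λ π → enter i l i∈ ◅ leave h l h∈ ◅ π) (rest-unrest π refl))
                    (∈.∈-map⁺ (traverse l i∈ h∈) (paths-complete Js (unrest π refl)))

  paths-unique : ∀ {n m} (Js : Vec (Interval n) m) i j → Unique (paths Js i j)
  paths-unique []       i j with i Fin.≟ j
  ... | yes refl = [] ∷ []
  ... | no  _    = []
  paths-unique {n} (J ∷ Js) i j with nondegenerate? J ×-dec i ∈ᴵ? J
  ... | no ¬c        = AllPairs.map⁺ (AllPairs.map (λ ne e → ne (injective e)) (paths-unique Js i j))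
    where
    injective : ∀ {π ρ : Path Js i j} → bypass ¬c π ≡ bypass ¬c ρ → π ≡ ρ
    injective {π} {ρ} e = trans (sym (unrest-rest {J = J} π))
      (trans (strip-injective {P = λ h → Path Js h j} (cong strip e)) (unrest-rest {J = J} ρ))
  ... | yes (l , i∈) = concatMap-AllPairs (through l i∈ λ h → paths Js h j) each different
    where
    injective : ∀ {h} .{h∈} {π ρ : Path Js h j} →
                traverse l i∈ h∈ π ≡ traverse l i∈ h∈ ρ → π ≡ ρ
    injective {π = π} {ρ} e = trans (sym (unrest-rest {J = J} π))
      (trans (strip-injective {P = λ h → Path Js h j} (cong strip e)) (unrest-rest {J = J} ρ))
    each : ∀ h → Unique (through l i∈ (λ h → paths Js h j) h)
    each h with h ∈ᴵ? J
    ... | yes h∈ = AllPairs.map⁺ (AllPairs.map (λ ne e → ne (injective {h∈ = h∈} e)) (paths-unique Js h j))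
    ... | no _   = []
    exits : ∀ h → All (λ π → proj₁ (strip π) ≡ h) (through l i∈ (λ h → paths Js h j) h)
    exits h with h ∈ᴵ? J
    ... | yes _ = All.map⁺ (All.universal (λ _ → refl) _)
    ... | no _  = []
    different : ∀ {h h′} → h Fin.< h′ →
      All (λ π → All (π ≢_) (through l i∈ (λ h → paths Js h j) h′))
          (through l i∈ (λ h → paths Js h j) h)
    different h<h′ = All.map (λ p → All.map
      (λ q e → Fin.<⇒≢ h<h′ (trans (sym p) (trans (cong (proj₁ ∘ strip) e) q))) (exits _)) (exits _)

  -- z_{h,p,k}; k = 1, 2 is encoded as 0F, 1F.
  record Indeterminate {n m} (Js : Vec (Interval n) m) : Set where
    constructor ζ
    field
      h : Fin n
      p : Fin m
      k : Fin 2
      .{nondegenerate} : Nondegenerate (lookup Js p)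
      .{inside}        : h ∈ᴵ lookup Js p

  module _ {n m} {Js : Vec (Interval n) m} where
    open Indeterminate

    infix 4 _≟ᶻ_
    _≟ᶻ_ : (x y : Indeterminate Js) → Dec (x ≡ y)
    x ≟ᶻ y = Dec.map′ (λ { (refl , refl , refl) → refl }) (λ { refl → refl , refl , refl })
      (h x Fin.≟ h y ×-dec p x Fin.≟ p y ×-dec k x Fin.≟ k y)

    infix 4 _≺_
    _≺_ : (x y : Indeterminate Js) → Set
    x ≺ y = h x Fin.< h y ⊎ (h x ≡ h y × (p x Fin.< p y ⊎ (p x ≡ p y × k x Fin.< k y)))

  shift : ∀ {n m J} {Js : Vec (Interval n) m} → Indeterminate Js → Indeterminate (J ∷ Js)
  shift (ζ h p k {l} {h∈}) = ζ h (suc p) k {l} {h∈}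

  label : ∀ {n m} {Js : Vec (Interval n) m} {u v : Vertex Js} → Edge u v → Maybe (Indeterminate Js)
  label (straight _ _)   = nothing
  label (enter h l h∈)   = just (ζ h zero 0F {l} {h∈})
  label (leave h l h∈)   = just (ζ h zero 1F {l} {h∈})
  label (rest e)         = Maybe.map shift (label e)

  module _ {n m} (Js : Vec (Interval n) m) where
    private
      at : (h : Fin n) (p : Fin m) (k : Fin 2) → List (Indeterminate Js)
      at h p k with nondegenerate? (lookup Js p) ×-dec h ∈ᴵ? lookup Js p
      ... | yes (l , h∈) = [ ζ h p k {l} {h∈} ]
      ... | no  _        = []

    indeterminates : List (Indeterminate Js)
    indeterminates =
      concatMap (λ h → concatMap (λ p → concatMap (at h p) (allFin 2)) (allFin m)) (allFin n)

    indeterminates-complete : ∀ x → x ∈ indeterminates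
    indeterminates-complete (ζ h p k {l} {h∈}) =
      ∈-concatMap⁺ (λ h → concatMap (λ p → concatMap (at h p) (allFin 2)) (allFin m))
        (Any.map (λ { refl → ∈-concatMap⁺ (λ p → concatMap (at h p) (allFin 2))
          (Any.map (λ { refl → ∈-concatMap⁺ (at h p)
            (Any.map (λ { refl → member }) (∈-allFin k)) }) (∈-allFin p)) }) (∈-allFin h))
      where
      member : ζ h p k {l} {h∈} ∈ at h p k
      member with nondegenerate? (lookup Js p) ×-dec h ∈ᴵ? lookup Js p
      ... | yes _ = here refl
      ... | no ¬c = ⊥-elim (¬c (l , h∈))

    indeterminates-sorted : AllPairs _≺_ indeterminates
    indeterminates-sorted =
      concatMap-AllPairs (λ h → concatMap (λ p → concatMap (at h p) (allFin 2)) (allFin m))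
        (λ h → concatMap-AllPairs (λ p → concatMap (at h p) (allFin 2))
          (λ p → concatMap-AllPairs (at h p) (sorted h p)
            (λ {k} {k′} k<k′ → All.map (λ { (refl , refl , refl) →
              All.map (λ { (refl , refl , refl) → inj₂ (refl , inj₂ (refl , k<k′)) })
                (coords h p k′) }) (coords h p k)))
          (λ {p} {p′} p<p′ → All.map (λ { (refl , refl) →
            All.map (λ { (refl , refl) → inj₂ (refl , inj₁ p<p′) }) (coords₂ h p′) }) (coords₂ h p)))
        (λ {h} {h′} h<h′ → All.map (λ { refl →
          All.map (λ { refl → inj₁ h<h′ }) (coords₁ h′) }) (coords₁ h))
      where
      sorted : ∀ h p k → AllPairs _≺_ (at h p k)
      sorted h p k with nondegenerate? (lookup Js p) ×-dec h ∈ᴵ? lookup Js p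
      ... | yes _ = [] ∷ []
      ... | no  _ = []
      coords : ∀ h p k →
        All (λ x → Indeterminate.h x ≡ h × Indeterminate.p x ≡ p × Indeterminate.k x ≡ k)
                             (at h p k)
      coords h p k with nondegenerate? (lookup Js p) ×-dec h ∈ᴵ? lookup Js p
      ... | yes _ = (refl , refl , refl) ∷ []
      ... | no  _ = []
      coords₂ : ∀ h p → All (λ x → Indeterminate.h x ≡ h × Indeterminate.p x ≡ p)
                            (concatMap (at h p) (allFin 2))
      coords₂ h p = All.concat⁺ (All.map⁺ {f = at h p} (All.universal
        (λ k → All.map (λ (e , f , _) → e , f) (coords h p k)) (allFin 2)))
      coords₁ : ∀ h → All (λ x → Indeterminate.h x ≡ h)
                          (concatMap (λ p → concatMap (at h p) (allFin 2)) (allFin m))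
      coords₁ h = All.concat⁺ (All.map⁺ (All.universal
        (λ p → All.map proj₁ (coords₂ h p)) (allFin m)))

open StarNetworks

-- R stands for ℤ[q^½, q^-½], at which this module is instantiated below; keeping it
-- abstract only keeps Laurent polynomials from unfolding.
module Quantum (R : CommutativeRing 0ℓ 0ℓ) (q½ q⁻½ : CommutativeRing.Carrier R) where
  private module R = CommutativeRing R
  open LinearAlgebra R
  open Exp R.semiring using (_^_)

  q : R.Carrier
  q = q½ R.* q½

  module QuantumMatrix (n : ℕ) where

    -- gen (i , j) is x_{i,j}.
    infix 4 _~_
    data _~_ : Expr (Fin n × Fin n) → Expr (Fin n × Fin n) → Set where
      same-row    : ∀ {i k l} → k Fin.< l →
        gen (i , l) * gen (i , k) ~ const q½ * (gen (i , k) * gen (i , l))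
      same-column : ∀ {i j k} → i Fin.< j →
        gen (j , k) * gen (i , k) ~ const q½ * (gen (i , k) * gen (j , k))
      commute     : ∀ {i j k l} → i Fin.< j → k Fin.< l →
        gen (j , k) * gen (i , l) ~ gen (i , l) * gen (j , k)
      cross       : ∀ {i j k l} → i Fin.< j → k Fin.< l →
        gen (j , l) * gen (i , k) ~
          gen (i , k) * gen (j , l) + const (q½ R.- q⁻½) * (gen (i , l) * gen (j , k))

    𝒜 : Presentation
    𝒜 = record { Gen = Fin n × Fin n ; Rel = _~_ }

    Word : Set
    Word = List (Fin n × Fin n)

    private
      d : R.Carrier
      d = q½ R.- q⁻½

    Distinct : Word → Set
    Distinct W = Unique (map proj₁ W) × Unique (map proj₂ W)

    distinct? : ∀ W → Dec (Distinct W)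
    distinct? W = unique? (map proj₁ W) ×-dec unique? (map proj₂ W)
      where
      unique? : (is : List (Fin n)) → Dec (Unique is)
      unique? = AllPairs.allPairs? λ i j → ¬? (i Fin.≟ j)

    -- For i < j and c ≢ e the relations turn x_{j,c} x_{i,e} into a combination of products
    -- x_{i,a} x_{j,b}; exchange (c <ᵇ e) c e K is that combination of the values K a b.
    exchange : Bool → Fin n → Fin n → (Fin n → Fin n → R.Carrier) → R.Carrier
    exchange t c e K = if t then K e c else K e c R.+ d R.* K c e

    _<ᵇ_ : Fin n → Fin n → Bool
    c <ᵇ e = does (c Fin.<? e)

    insertion : Fin n × Fin n → (Word → R.Carrier) → Word → R.Carrier
    insertion x       ψ []            = ψ (x ∷ [])
    insertion (j , c) ψ ((r , e) ∷ W) =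
      if j <ᵇ r then ψ ((j , c) ∷ (r , e) ∷ W)
      else exchange (c <ᵇ e) c e λ a b → insertion (j , b) (λ W′ → ψ ((r , a) ∷ W′)) W

    -- The action on the quotient of 𝒜 in which products with a repeated row or column vanish.
    act : Fin n × Fin n → (Word → R.Carrier) → Word → R.Carrier
    act x ψ W = if does (distinct? (x ∷ W)) then insertion x ψ W else R.0#

    open Action 𝒜 Word _≡_ act

    private
      open Solver R.commutativeSemiring using (solve; _:+_; _:*_; _:=_)

      step : Bool → R.Carrier → R.Carrier → R.Carrier
      step t x y = if t then x else x R.+ d R.* y

      step-cong : ∀ t {x x′ y y′} → x R.≈ x′ → y R.≈ y′ → step t x y R.≈ step t x′ y′
      step-cong true  p q = p
      step-cong false p q = R.+-cong p (R.*-cong R.refl q)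

      step-+ : ∀ t x x′ y y′ → step t (x R.+ x′) (y R.+ y′) R.≈ step t x y R.+ step t x′ y′
      step-+ true  x x′ y y′ = R.refl
      step-+ false x x′ y y′ = solve 5
        (λ d x x′ y y′ → (x :+ x′) :+ d :* (y :+ y′) := (x :+ d :* y) :+ (x′ :+ d :* y′)) R.refl
        d x x′ y y′

      step-* : ∀ t f x y → step t (f R.* x) (f R.* y) R.≈ f R.* step t x y
      step-* true  f x y = R.refl
      step-* false f x y = solve 4
        (λ d f x y → f :* x :+ d :* (f :* y) := f :* (x :+ d :* y)) R.refl d f x y

      insertion-cong : ∀ x {ψ χ} → ψ ≗ χ → insertion x ψ ≗ insertion x χ
      insertion-cong x       p []            = p _
      insertion-cong (j , c) p ((r , e) ∷ W) with j <ᵇ r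
      ... | true  = p _
      ... | false = step-cong (c <ᵇ e) (insertion-cong (j , c) (λ V → p ((r , e) ∷ V)) W)
                                        (insertion-cong (j , e) (λ V → p ((r , c) ∷ V)) W)

      insertion-+ : ∀ x ψ χ →
        insertion x (λ W → ψ W R.+ χ W) ≗ λ W → insertion x ψ W R.+ insertion x χ W
      insertion-+ x       ψ χ []            = R.refl
      insertion-+ (j , c) ψ χ ((r , e) ∷ W) with j <ᵇ r
      ... | true  = R.refl
      ... | false = R.trans
        (step-cong (c <ᵇ e)
          (insertion-+ (j , c) (λ V → ψ ((r , e) ∷ V)) (λ V → χ ((r , e) ∷ V)) W)
          (insertion-+ (j , e) (λ V → ψ ((r , c) ∷ V)) (λ V → χ ((r , c) ∷ V)) W))
        (step-+ (c <ᵇ e) _ _ _ _)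

      insertion-* : ∀ x f ψ → insertion x (λ W → f R.* ψ W) ≗ λ W → f R.* insertion x ψ W
      insertion-* x       f ψ []            = R.refl
      insertion-* (j , c) f ψ ((r , e) ∷ W) with j <ᵇ r
      ... | true  = R.refl
      ... | false = R.trans
        (step-cong (c <ᵇ e) (insertion-* (j , c) f (λ V → ψ ((r , e) ∷ V)) W)
                            (insertion-* (j , e) f (λ V → ψ ((r , c) ∷ V)) W))
        (step-* (c <ᵇ e) f _ _)

      insertion-0 : ∀ x W → insertion x (λ _ → R.0#) W R.≈ R.0#
      insertion-0 x W = R.trans (insertion-cong x (λ _ → R.sym (R.zeroˡ R.0#)) W)
        (R.trans (insertion-* x R.0# (λ _ → R.0#) W) (R.zeroˡ _))

      insertion-exchange : ∀ x t c e (F : Fin n → Fin n → Word → R.Carrier) W →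
        insertion x (λ W → exchange t c e λ a b → F a b W) W
        R.≈ exchange t c e λ a b → insertion x (F a b) W
      insertion-exchange x true  c e F W = R.refl
      insertion-exchange x false c e F W =
        R.trans (insertion-+ x _ _ W) (R.+-cong R.refl (insertion-* x d _ W))

      infix 4 _≅_
      _≅_ : Word → Word → Set
      V ≅ W = map proj₁ V ↭ map proj₁ W × map proj₂ V ↭ map proj₂ W

      ≅-trans : ∀ {U V W} → U ≅ V → V ≅ W → U ≅ W
      ≅-trans (p , q) (p′ , q′) = ↭-trans p p′ , ↭-trans q q′

      ≅-sym : ∀ {V W} → V ≅ W → W ≅ V
      ≅-sym (p , q) = ↭-sym p , ↭-sym q

      ≅-∷ : ∀ z {V W} → V ≅ W → z ∷ V ≅ z ∷ W
      ≅-∷ z (p , q) = prep _ p , prep _ q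

      ≅-swap : ∀ {x y W} → x ∷ y ∷ W ≅ y ∷ x ∷ W
      ≅-swap = swap _ _ ↭-refl , swap _ _ ↭-refl

      ≅-columns : ∀ {i j c e W} → (i , c) ∷ (j , e) ∷ W ≅ (i , e) ∷ (j , c) ∷ W
      ≅-columns = ↭-refl , swap _ _ ↭-refl

      distinct-resp : ∀ {V W} → V ≅ W → Distinct V → Distinct W
      distinct-resp (p , q) (u , v) = Unique-resp p u , Unique-resp q v
        where
        open import Data.List.Relation.Binary.Permutation.Setoid.Properties (≡.setoid (Fin n))
          using (Unique-resp-↭)
        Unique-resp : ∀ {is js} → is ↭ js → Unique is → Unique js
        Unique-resp p = Unique-resp-↭ (↭⇒↭ₛ p)

      distinct-tail : ∀ {x W} → Distinct (x ∷ W) → Distinct W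
      distinct-tail (_ ∷ u , _ ∷ v) = u , v

      insertion-local : ∀ x W {ψ χ} → (∀ V → V ≅ x ∷ W → ψ V R.≈ χ V) →
                        insertion x ψ W R.≈ insertion x χ W
      insertion-local x       []            p = p _ (↭-refl , ↭-refl)
      insertion-local (j , c) ((r , e) ∷ W) p with j <ᵇ r
      ... | true  = p _ (↭-refl , ↭-refl)
      ... | false = step-cong (c <ᵇ e)
        (insertion-local (j , c) W λ V q → p _ (≅-trans (≅-∷ _ q) ≅-swap))
        (insertion-local (j , e) W λ V q → p _ (≅-trans (≅-∷ _ q) (≅-trans ≅-columns ≅-swap)))

      yang-baxter : (lt : Fin n → Fin n → Bool) → ∀ {c e g} →
        lt e c ≡ not (lt c e) → lt g e ≡ not (lt e g) →
        (lt c e ≡ true → lt e g ≡ true → lt c g ≡ true) →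
        (lt c e ≡ false → lt e g ≡ false → lt c g ≡ false) →
        (Φ : Fin n → Fin n → Fin n → R.Carrier) →
        (exchange (lt e g) e g λ a b → exchange (lt c a) c a λ a′ b′ →
           exchange (lt b′ b) b′ b λ f h → Φ a′ f h)
        R.≈
        (exchange (lt c e) c e λ a b → exchange (lt b g) b g λ a′ b′ →
           exchange (lt a a′) a a′ λ a″ f → Φ a″ f b′)
      yang-baxter lt {c} {e} {g} ec ge t f Φ rewrite ec | ge
        with lt c e | lt e g | lt c g
      ... | true  | true  | true  = R.refl
      ... | true  | false | true  = R.refl
      ... | false | true  | true  = R.refl
      ... | true  | false | false = solve 5 (λ d x y z w →
              (x :+ d :* y) :+ d :* (z :+ d :* w) := (x :+ d :* z) :+ d :* (y :+ d :* w)) R.refl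
              d (Φ g e c) (Φ c e g) (Φ e g c) (Φ e c g)
      ... | false | true  | false = solve 5 (λ d x y z w →
              (x :+ d :* y) :+ d :* (z :+ d :* w) := (x :+ d :* z) :+ d :* (y :+ d :* w)) R.refl
              d (Φ g e c) (Φ g c e) (Φ c e g) (Φ c g e)
      ... | false | false | false = solve 7 (λ d x y z u v w →
              ((x :+ d :* y) :+ d :* z) :+ d :* ((u :+ d :* v) :+ d :* (w :+ d :* z)) :=
              ((x :+ d :* u) :+ d :* z) :+ d :* ((y :+ d :* w) :+ d :* (v :+ d :* z))) R.refl
              d (Φ g e c) (Φ g c e) (Φ c e g) (Φ e g c) (Φ e c g) (Φ c g e)
      ... | true  | true  | false = contradiction (t refl refl) λ ()
      ... | false | false | true  = contradiction (f refl refl) λ ()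

      true⇒ : ∀ {P : Set} (p? : Dec P) → does p? ≡ true → P
      true⇒ (yes p) _ = p

      false⇒ : ∀ {P : Set} (p? : Dec P) → does p? ≡ false → ¬ P
      false⇒ (no ¬p) _ = ¬p

      <ᵇ-flip : ∀ {c e} → c ≢ e → e <ᵇ c ≡ not (c <ᵇ e)
      <ᵇ-flip {c} {e} c≢e = flip (c Fin.<? e)
        where
        flip : (p? : Dec (c Fin.< e)) → e <ᵇ c ≡ not (does p?)
        flip (yes p) = Dec.dec-false (e Fin.<? c) (ℕ.<⇒≯ p)
        flip (no ¬p) = Dec.dec-true (e Fin.<? c) (Fin.≤∧≢⇒< (ℕ.≮⇒≥ ¬p) (c≢e ∘ sym))

      <ᵇ-trans : ∀ {c e g} → c <ᵇ e ≡ true → e <ᵇ g ≡ true → c <ᵇ g ≡ true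
      <ᵇ-trans {c} {e} {g} p q = Dec.dec-true (c Fin.<? g)
        (Fin.<-trans {i = c} {e} {g} (true⇒ (c Fin.<? e) p) (true⇒ (e Fin.<? g) q))

      ≮ᵇ-trans : ∀ {c e g} → c <ᵇ e ≡ false → e <ᵇ g ≡ false → c <ᵇ g ≡ false
      ≮ᵇ-trans {c} {e} {g} p q = Dec.dec-false (c Fin.<? g) (ℕ.≤⇒≯
        (ℕ.≤-trans (ℕ.≮⇒≥ (false⇒ (e Fin.<? g) q)) (ℕ.≮⇒≥ (false⇒ (c Fin.<? e) p))))

      insertion-swap : ∀ {i j c e} → i Fin.< j → ∀ ψ W → Distinct ((j , c) ∷ (i , e) ∷ W) →
        insertion (i , e) (insertion (j , c) ψ) W
        R.≈ exchange (c <ᵇ e) c e λ a b → insertion (j , b) (insertion (i , a) ψ) W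
      insertion-swap {i} {j} {c} {e} i<j ψ [] D
        rewrite Dec.dec-false (j Fin.<? i) (ℕ.<⇒≯ i<j) | Dec.dec-true (i Fin.<? j) i<j = R.refl
      insertion-swap {i} {j} {c} {e} i<j ψ ((r , g) ∷ W)
                     D@(((j≢i ∷ j≢r ∷ _) ∷ (i≢r ∷ _) ∷ _) , ((c≢e ∷ c≢g ∷ _) ∷ (e≢g ∷ _) ∷ _))
        = cases (i Fin.<? r) (j Fin.<? r)
        where
        Goal : Set
        Goal = insertion (i , e) (insertion (j , c) ψ) ((r , g) ∷ W)
          R.≈ exchange (c <ᵇ e) c e λ a b → insertion (j , b) (insertion (i , a) ψ) ((r , g) ∷ W)

        cases : Dec (i Fin.< r) → Dec (j Fin.< r) → Goal
        cases (no i≮r) (yes j<r) = contradiction (ℕ.<-trans i<j j<r) i≮r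
        cases (yes i<r) (yes j<r)
          rewrite Dec.dec-true (i Fin.<? r) i<r | Dec.dec-true (j Fin.<? r) j<r
                | Dec.dec-false (j Fin.<? i) (ℕ.<⇒≯ i<j) | Dec.dec-true (i Fin.<? j) i<j = R.refl
        cases (yes i<r) (no j≮r)
          rewrite Dec.dec-true (i Fin.<? r) i<r | Dec.dec-false (j Fin.<? r) j≮r
                | Dec.dec-false (j Fin.<? i) (ℕ.<⇒≯ i<j) = R.refl
        cases (no i≮r) (no j≮r)
          rewrite Dec.dec-false (i Fin.<? r) i≮r | Dec.dec-false (j Fin.<? r) j≮r =
          R.trans
            (step-cong (e <ᵇ g) (expand g e (ih g c e D₁) (ih c g e D₂))
                                (expand e g (ih e c g D₃) (ih c e g D₄)))
          (R.trans
            (yang-baxter _<ᵇ_ {c} {e} {g} (<ᵇ-flip c≢e) (<ᵇ-flip e≢g) (<ᵇ-trans {c} {e} {g})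
                         (≮ᵇ-trans {c} {e} {g}) Φ)
            (R.sym (step-cong (c <ᵇ e)
              (step-cong (c <ᵇ g) (pull e g c) (pull e c g))
              (step-cong (e <ᵇ g) (pull c g e) (pull c e g)))))
          where
          Φ : Fin n → Fin n → Fin n → R.Carrier
          Φ a f h = insertion (j , h) (insertion (i , f) (λ V → ψ ((r , a) ∷ V))) W

          drop : ∀ {x y z} → c ∷ e ∷ g ∷ map proj₂ W ↭ z ∷ x ∷ y ∷ map proj₂ W →
                 Distinct ((j , x) ∷ (i , y) ∷ W)
          drop {x} {y} {z} p = distinct-tail {r , z} (distinct-resp
            {(j , c) ∷ (i , e) ∷ (r , g) ∷ W} {(r , z) ∷ (j , x) ∷ (i , y) ∷ W}
            (↭-trans (prep j (swap i r ↭-refl)) (swap j r ↭-refl) , p) D)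
          D₁ : Distinct ((j , c) ∷ (i , e) ∷ W)
          D₁ = drop (↭-trans (prep c (swap e g ↭-refl)) (swap c g ↭-refl))
          D₂ : Distinct ((j , g) ∷ (i , e) ∷ W)
          D₂ = drop (prep c (swap e g ↭-refl))
          D₃ : Distinct ((j , c) ∷ (i , g) ∷ W)
          D₃ = drop (swap c e ↭-refl)
          D₄ : Distinct ((j , e) ∷ (i , g) ∷ W)
          D₄ = drop ↭-refl

          ih : ∀ a x y → Distinct ((j , x) ∷ (i , y) ∷ W) →
               insertion (i , y) (insertion (j , x) (λ V → ψ ((r , a) ∷ V))) W
               R.≈ exchange (x <ᵇ y) x y (Φ a)
          ih a x y = insertion-swap i<j (λ V → ψ ((r , a) ∷ V)) W

          expand : ∀ a b {u v} →
            insertion (i , b) (insertion (j , c) (λ V → ψ ((r , a) ∷ V))) W R.≈ u →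
            insertion (i , b) (insertion (j , a) (λ V → ψ ((r , c) ∷ V))) W R.≈ v →
            insertion (i , b) (λ V → exchange (c <ᵇ a) c a λ a′ b′ →
              insertion (j , b′) (λ V → ψ ((r , a′) ∷ V)) V) W R.≈ step (c <ᵇ a) u v
          expand a b p q = R.trans
            (insertion-exchange (i , b) (c <ᵇ a) c a
              (λ a′ b′ → insertion (j , b′) (λ V → ψ ((r , a′) ∷ V))) W)
            (step-cong (c <ᵇ a) p q)

          pull : ∀ a a′ b′ →
            insertion (j , b′) (λ V → exchange (a <ᵇ a′) a a′ λ a″ f →
              insertion (i , f) (λ V → ψ ((r , a″) ∷ V)) V) W
            R.≈ exchange (a <ᵇ a′) a a′ λ a″ f → Φ a″ f b′
          pull a a′ b′ = insertion-exchange (j , b′) (a <ᵇ a′) a a′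
            (λ a″ f → insertion (i , f) (λ V → ψ ((r , a″) ∷ V))) W

      act-cong : ∀ x {ψ χ} → ψ ≗ χ → act x ψ ≗ act x χ
      act-cong x p W with does (distinct? (x ∷ W))
      ... | true  = insertion-cong x p W
      ... | false = R.refl

      act-+ : ∀ x ψ χ → act x (λ W → ψ W R.+ χ W) ≗ λ W → act x ψ W R.+ act x χ W
      act-+ x ψ χ W with does (distinct? (x ∷ W))
      ... | true  = insertion-+ x ψ χ W
      ... | false = R.sym (R.+-identityˡ R.0#)

      act-* : ∀ x f ψ → act x (λ W → f R.* ψ W) ≗ λ W → f R.* act x ψ W
      act-* x f ψ W with does (distinct? (x ∷ W))
      ... | true  = insertion-* x f ψ W
      ... | false = R.sym (R.zeroʳ f)

      act-1 : ∀ x ψ W → Distinct (x ∷ W) → act x ψ W R.≈ insertion x ψ W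
      act-1 x ψ W D = R.reflexive (cong (λ t → if t then insertion x ψ W else R.0#)
        (Dec.dec-true (distinct? (x ∷ W)) D))

      act-0 : ∀ x ψ W → ¬ Distinct (x ∷ W) → act x ψ W R.≈ R.0#
      act-0 x ψ W ¬D = R.reflexive (cong (λ t → if t then insertion x ψ W else R.0#)
        (Dec.dec-false (distinct? (x ∷ W)) ¬D))

      act₂-1 : ∀ x y ψ W → Distinct (x ∷ y ∷ W) →
               act y (act x ψ) W R.≈ insertion y (insertion x ψ) W
      act₂-1 x y ψ W D = R.trans (act-1 y (act x ψ) W (distinct-tail {x} D))
        (insertion-local y W λ V p → act-1 x ψ V (distinct-resp (≅-∷ x (≅-sym p)) D))

      act₂-0 : ∀ x y ψ W → ¬ Distinct (x ∷ y ∷ W) → act y (act x ψ) W R.≈ R.0#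
      act₂-0 x y ψ W ¬D with distinct? (y ∷ W)
      ... | no ¬D′ = act-0 y (act x ψ) W ¬D′
      ... | yes D′ = R.trans (act-1 y (act x ψ) W D′) (R.trans
        (insertion-local y W λ V p → act-0 x ψ V (¬D ∘ distinct-resp (≅-∷ x p)))
        (insertion-0 y W))

      same-row-∉ : ∀ {i k l W} → ¬ Distinct ((i , l) ∷ (i , k) ∷ W)
      same-row-∉ (((i≢i ∷ _) ∷ _) , _) = i≢i refl

      same-column-∉ : ∀ {i j k W} → ¬ Distinct ((j , k) ∷ (i , k) ∷ W)
      same-column-∉ (_ , ((k≢k ∷ _) ∷ _)) = k≢k refl

      act-rel : ∀ {s t} → s ~ t → ∀ ψ → eval s ψ ≗ eval t ψ
      act-rel (same-row {i} {k} {l} k<l) ψ W = R.trans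
        (act₂-0 (i , l) (i , k) ψ W same-row-∉)
        (R.sym (act₂-0 (i , k) (i , l) _ W same-row-∉))
      act-rel (same-column {i} {j} {k} i<j) ψ W = R.trans
        (act₂-0 (j , k) (i , k) ψ W same-column-∉)
        (R.sym (act₂-0 (i , k) (j , k) _ W same-column-∉))
      act-rel (commute {i} {j} {k} {l} i<j k<l) ψ W with distinct? ((j , k) ∷ (i , l) ∷ W)
      ... | no ¬D = R.trans (act₂-0 (j , k) (i , l) ψ W ¬D)
        (R.sym (act₂-0 (i , l) (j , k) ψ W (¬D ∘ distinct-resp ≅-swap)))
      ... | yes D = R.trans (act₂-1 (j , k) (i , l) ψ W D)
        (R.trans (R.trans (insertion-swap i<j ψ W D)
          (R.reflexive (cong (λ t → exchange t k l (λ a b → insertion (j , b) (insertion (i , a) ψ) W))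
            (Dec.dec-true (k Fin.<? l) k<l))))
        (R.sym (act₂-1 (i , l) (j , k) ψ W (distinct-resp ≅-swap D))))
      act-rel (cross {i} {j} {k} {l} i<j k<l) ψ W with distinct? ((j , l) ∷ (i , k) ∷ W)
      ... | no ¬D = R.trans (act₂-0 (j , l) (i , k) ψ W ¬D)
        (R.sym (R.trans (R.+-cong
          (act₂-0 (i , k) (j , l) ψ W (¬D ∘ distinct-resp ≅-swap))
          (act₂-0 (i , l) (j , k) _ W (¬D ∘ distinct-resp (≅-trans ≅-columns ≅-swap))))
          (R.+-identityˡ _)))
      ... | yes D = R.trans (act₂-1 (j , l) (i , k) ψ W D)
        (R.trans (R.trans (insertion-swap i<j ψ W D)
          (R.reflexive (cong (λ t → exchange t l k (λ a b → insertion (j , b) (insertion (i , a) ψ) W))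
            (Dec.dec-false (l Fin.<? k) (ℕ.<⇒≯ k<l)))))
        (R.sym (R.+-cong
          (act₂-1 (i , k) (j , l) ψ W (distinct-resp ≅-swap D))
          (R.trans (act₂-1 (i , l) (j , k) _ W (distinct-resp (≅-trans ≅-swap ≅-columns) D))
            (R.trans (insertion-cong (j , k) (insertion-* (i , l) d ψ) W)
                     (insertion-* (j , k) d (insertion (i , l) ψ) W))))))

    isAction : IsAction
    isAction = record
      { act-cong = act-cong
      ; act-+    = act-+
      ; act-*    = act-*
      ; act-resp = λ { x _ refl → R.refl }
      ; act-rel  = λ p {ψ} _ → act-rel p ψ }

    -- The value at x_{i₁,j₁} ⋯ x_{iₖ,jₖ} is f of that word if i₁ < ⋯ < iₖ and the columns are
    -- distinct (straighten-∏); in particular the values at the basis x^{e,w} are arbitrary.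
    straighten : (Word → R.Carrier) → LinearForm (Algebra.leftModule 𝒜)
    straighten f = form isAction f (λ { refl → R.refl }) []

    private
      act-prepend : ∀ x W ψ → All (λ y → proj₁ x Fin.< proj₁ y) W →
                    All (λ y → proj₂ x ≢ proj₂ y) W → Distinct W → act x ψ W R.≈ ψ (x ∷ W)
      act-prepend x W ψ rs cs (u , v) = R.trans
        (act-1 x ψ W (All.map⁺ (All.map Fin.<⇒≢ rs) ∷ u , All.map⁺ cs ∷ v)) (prepend W rs)
        where
        prepend : ∀ W → All (λ y → proj₁ x Fin.< proj₁ y) W → insertion x ψ W R.≈ ψ (x ∷ W)
        prepend []            _       = R.refl
        prepend ((r , e) ∷ W) (l ∷ _) rewrite Dec.dec-true (proj₁ x Fin.<? r) l = R.refl

      eval-∏ : ∀ W ψ → AllPairs (λ x y → proj₁ x Fin.< proj₁ y) W →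
               AllPairs (λ x y → proj₂ x ≢ proj₂ y) W → eval (∏ (map gen W)) ψ [] R.≈ ψ W
      eval-∏ []      ψ []       []       = R.*-identityˡ _
      eval-∏ (x ∷ W) ψ (r ∷ rs) (c ∷ cs) = R.trans (eval-∏ W (act x ψ) rs cs)
        (act-prepend x W ψ r c (AllPairs.map⁺ (AllPairs.map Fin.<⇒≢ rs) , AllPairs.map⁺ cs))

    straighten-∏ : ∀ f W → AllPairs (λ x y → proj₁ x Fin.< proj₁ y) W →
      AllPairs (λ x y → proj₂ x ≢ proj₂ y) W →
      LinearForm.⟦ straighten f ⟧ (∏ (map gen W)) R.≈ f W
    straighten-∏ f W = eval-∏ W f

    x^ : Permutation′ n × Permutation′ n → Expr (Fin n × Fin n)
    x^ (u , w) = ∏ (map gen (map (λ i → u ⟨$⟩ʳ i , w ⟨$⟩ʳ i) (allFin n)))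

    𝒜[n,n] : LeftModule R.ring 0ℓ 0ℓ
    𝒜[n,n] = span (Algebra.leftModule 𝒜) x^

    x^e_ : Permutation′ n → LeftModule.Carrierᴹ 𝒜[n,n]
    x^e w = x^ (Perm.id , w) , gen (Perm.id , w)

  module Hecke (N : ℕ) where

    -- gen i is T_{s i}, and const R.1# is T_e.
    infix 4 _~_
    data _~_ : Expr (Fin N) → Expr (Fin N) → Set where
      quadratic : ∀ i → gen i * gen i ~ const (q R.- R.1#) * gen i + const q * const R.1#
      braid     : ∀ i j → ∣ toℕ i - toℕ j ∣ ≡ 1 → gen i * gen j * gen i ~ gen j * gen i * gen j
      commute   : ∀ i j → 2 ℕ.≤ ∣ toℕ i - toℕ j ∣ → gen i * gen j ~ gen j * gen i

    H : Presentation
    H = record { Gen = Fin N ; Rel = _~_ }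

    -- reducedWord w is a reduced expression of w: see reducedWord-eval, reducedWord-length.
    T : Permutation′ (suc N) → Expr (Fin N)
    T w = ∏ (map gen (reducedWord w))

    -- C̃ J is C̃_{s_J}(q), s_J being the longest element of 𝔖_J.
    C̃ : Interval (suc N) → Expr (Fin N)
    C̃ J = ∑ (map T (filter (_∈𝔖? J) (permutations (suc N))))

  -- n = N + 1, since S_n has generators indexed by Fin N.
  Imm : ∀ {N} → LinearForm (Algebra.leftModule (Hecke.H N)) →
        LeftModule.Carrierᴹ (QuantumMatrix.𝒜[n,n] (suc N))
  Imm {N} θ = ∑ᴹ 𝒜[n,n]
    (map (λ w → ((q⁻½ ^ ℓ w) R.* LinearForm.⟦ θ ⟧ (Hecke.T N w)) *ₗ (x^e w)) (permutations (suc N)))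
    where
    open QuantumMatrix (suc N)
    open LeftModule 𝒜[n,n]

  module _ {n m} (Js : Vec (Interval n) m) where
    open Indeterminate

    infix 4 _~ᶻ_
    data _~ᶻ_ : Expr (Indeterminate Js) → Expr (Indeterminate Js) → Set where
      commute   : ∀ {x y} → p y ≢ p x ⊎ k y ≢ k x → gen y * gen x ~ᶻ gen x * gen y
      q-commute : ∀ {x y} → p y ≡ p x → k y ≡ k x → h x Fin.< h y →
                  gen y * gen x ~ᶻ const q½ * (gen x * gen y)

    Z : Presentation
    Z = record { Gen = Indeterminate Js ; Rel = _~ᶻ_ }

    -- The lexicographically ordered monomial with exponents e; z_G is monomial (λ _ → 1).
    monomial : (Indeterminate Js → ℕ) → Expr (Indeterminate Js)
    monomial e = ∏ (map gen (concatMap (λ x → replicate (e x) x) (indeterminates Js)))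

    private
      Word : Set
      Word = List (Indeterminate Js)

      passes? : (x y : Indeterminate Js) → Dec (p y ≡ p x × k y ≡ k x × h y Fin.< h x)
      passes? x y = p y Fin.≟ p x ×-dec k y Fin.≟ k x ×-dec h y Fin.<? h x

      passed : Indeterminate Js → Word → ℕ
      passed x W = length (filter (passes? x) W)

      count : Indeterminate Js → Word → ℕ
      count x W = length (filter (x ≟ᶻ_) W)

      -- A word up to ↭ stands for the lexicographically ordered product of its letters.
      -- Left multiplication by x picks up q^½ for every smaller letter that x passes and
      -- does not commute with.
      act : Indeterminate Js → (Word → R.Carrier) → Word → R.Carrier
      act x ψ W = (q½ ^ passed x W) R.* ψ (x ∷ W)

      squarefree : Word → R.Carrier
      squarefree W =
        if does (All.all? (λ x → count x W ℕ.≟ 1) (indeterminates Js)) then R.1# else R.0#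

      open Action Z Word _↭_ act
      open CommutativeSemigroupProperties R.*-commutativeSemigroup using (x∙yz≈y∙xz)

      passed-skip : ∀ x {y W} → ¬ (p y ≡ p x × k y ≡ k x × h y Fin.< h x) →
                    passed x (y ∷ W) ≡ passed x W
      passed-skip x {y} {W} ¬q = cong length (List.filter-reject (passes? x) {y} {W} ¬q)

      passed-step : ∀ x {y W} → p y ≡ p x × k y ≡ k x × h y Fin.< h x →
                    passed x (y ∷ W) ≡ suc (passed x W)
      passed-step x {y} {W} q = cong length (List.filter-accept (passes? x) {y} {W} q)

      passed-↭ : ∀ x {V W} → V ↭ W → passed x V ≡ passed x W
      passed-↭ x p = ↭.↭-length (↭.filter-↭ (passes? x) p)

      act-rel : ∀ {s t} → s ~ᶻ t → ∀ {ψ} → Respects ψ → eval s ψ ≗ eval t ψ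
      act-rel (commute {x} {y} ne) {ψ} r W = begin
        a R.* ((q½ ^ passed y (x ∷ W)) R.* ψ (y ∷ x ∷ W))
          ≡⟨ cong (λ c → a R.* ((q½ ^ c) R.* ψ (y ∷ x ∷ W))) (skip y x ne) ⟩
        a R.* (b R.* ψ (y ∷ x ∷ W))
          ≈⟨ x∙yz≈y∙xz a b _ ⟩
        b R.* (a R.* ψ (y ∷ x ∷ W))
          ≈⟨ R.*-cong R.refl (R.*-cong R.refl (r (swap y x ↭-refl))) ⟩
        b R.* (a R.* ψ (x ∷ y ∷ W))
          ≡⟨ cong (λ c → b R.* ((q½ ^ c) R.* ψ (x ∷ y ∷ W))) (skip x y (flip ne)) ⟨
        b R.* ((q½ ^ passed x (y ∷ W)) R.* ψ (x ∷ y ∷ W)) ∎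
        where
        open import Relation.Binary.Reasoning.Setoid R.setoid
        a = q½ ^ passed x W
        b = q½ ^ passed y W
        flip : p y ≢ p x ⊎ k y ≢ k x → p x ≢ p y ⊎ k x ≢ k y
        flip (inj₁ ne) = inj₁ (ne ∘ sym)
        flip (inj₂ ne) = inj₂ (ne ∘ sym)
        skip : ∀ y x → p y ≢ p x ⊎ k y ≢ k x → passed y (x ∷ W) ≡ passed y W
        skip y x (inj₁ ne) = passed-skip y {x} {W} λ (e , _) → ne (sym e)
        skip y x (inj₂ ne) = passed-skip y {x} {W} λ (_ , e , _) → ne (sym e)
      act-rel (q-commute {x} {y} p≡ k≡ h<) {ψ} r W = begin
        a R.* ((q½ ^ passed y (x ∷ W)) R.* ψ (y ∷ x ∷ W))
          ≡⟨ cong (λ c → a R.* ((q½ ^ c) R.* ψ (y ∷ x ∷ W)))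
               (passed-step y {x} {W} (sym p≡ , sym k≡ , h<)) ⟩
        a R.* ((q½ R.* b) R.* ψ (y ∷ x ∷ W))
          ≈⟨ R.*-cong R.refl (R.*-cong (R.*-comm q½ b) (r (swap y x ↭-refl))) ⟩
        a R.* ((b R.* q½) R.* ψ (x ∷ y ∷ W))
          ≈⟨ R.*-cong R.refl (R.*-assoc b q½ _) ⟩
        a R.* (b R.* (q½ R.* ψ (x ∷ y ∷ W)))
          ≈⟨ x∙yz≈y∙xz a b _ ⟩
        b R.* (a R.* (q½ R.* ψ (x ∷ y ∷ W)))
          ≡⟨ cong (λ c → b R.* ((q½ ^ c) R.* (q½ R.* ψ (x ∷ y ∷ W))))
               (passed-skip x {y} {W} λ (_ , _ , l) → ℕ.<-asym h< l) ⟨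
        b R.* ((q½ ^ passed x (y ∷ W)) R.* (q½ R.* ψ (x ∷ y ∷ W))) ∎
        where
        open import Relation.Binary.Reasoning.Setoid R.setoid
        a = q½ ^ passed x W
        b = q½ ^ passed y W

      isAction : IsAction
      isAction = record
        { act-cong = λ x p W → R.*-cong R.refl (p (x ∷ W))
        ; act-+    = λ x ψ χ W → R.distribˡ _ _ _
        ; act-*    = λ x c ψ W → x∙yz≈y∙xz _ c _
        ; act-resp = λ x r p → R.*-cong (R.reflexive (cong (q½ ^_) (passed-↭ x p))) (r (prep x p))
        ; act-rel  = act-rel }

      squarefree-resp : Respects squarefree
      squarefree-resp {V} {W} p = R.reflexive (cong (λ t → if t then R.1# else R.0#)
        (Dec.does-⇔ (mk⇔ (All.map (trans (sym (count-↭ _ p)))) (All.map (trans (count-↭ _ p))))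
          (All.all? (λ x → count x V ℕ.≟ 1) (indeterminates Js))
          (All.all? (λ x → count x W ℕ.≟ 1) (indeterminates Js))))
        where
        count-↭ : ∀ x {V W} → V ↭ W → count x V ≡ count x W
        count-↭ x p = ↭.↭-length (↭.filter-↭ (x ≟ᶻ_) p)

    -- The coefficient [z_G]: see [z]-monomial for its values on the ordered monomials.
    [z] : LinearForm (Algebra.leftModule Z)
    [z] = form isAction squarefree squarefree-resp []

    private
      eval-∏ : ∀ W ψ → AllPairs (λ x y → ¬ (p y ≡ p x × k y ≡ k x × h y Fin.< h x)) W →
               eval (∏ (map gen W)) ψ [] R.≈ ψ W
      eval-∏ []      ψ []       = R.*-identityˡ _
      eval-∏ (x ∷ W) ψ (ps ∷ s) = R.trans (eval-∏ W (act x ψ) s) (R.trans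
        (R.*-cong (R.reflexive (cong ((q½ ^_) ∘ length) (List.filter-none (passes? x) ps))) R.refl)
        (R.*-identityˡ _))

      module _ (e : Indeterminate Js → ℕ) where

        powers : Word → Word
        powers = concatMap λ x → replicate (e x) x

        replicate-AllPairs : ∀ {S : Indeterminate Js → Indeterminate Js → Set} c {x} →
                             S x x → AllPairs S (replicate c x)
        replicate-AllPairs zero    s = []
        replicate-AllPairs (suc c) s = All.replicate⁺ c s ∷ replicate-AllPairs c s

        powers-sorted : ∀ {W} → AllPairs _≺_ W →
          AllPairs (λ x y → ¬ (p y ≡ p x × k y ≡ k x × h y Fin.< h x)) (powers W)
        powers-sorted s = AllPairs.concat⁺
          (All.map⁺ (All.universal (λ x → replicate-AllPairs (e x) λ (_ , _ , l) → ℕ.n≮n _ l) _))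
          (AllPairs.map⁺ (AllPairs.map
            (λ {x} {y} l → All.replicate⁺ (e x) (All.replicate⁺ (e y) (≺⇒ {x} {y} l))) s))
          where
          ≺⇒ : ∀ {x y} → x ≺ y → ¬ (p y ≡ p x × k y ≡ k x × h y Fin.< h x)
          ≺⇒ (inj₁ l)       (_ , _ , g) = ℕ.<-asym l g
          ≺⇒ (inj₂ (e , _)) (_ , _ , g) = ℕ.<-irrefl (cong toℕ (sym e)) g

        ≺-irrefl : ∀ {x : Indeterminate Js} → ¬ x ≺ x
        ≺-irrefl (inj₁ l)                  = ℕ.n≮n _ l
        ≺-irrefl (inj₂ (_ , inj₁ l))       = ℕ.n≮n _ l
        ≺-irrefl (inj₂ (_ , inj₂ (_ , l))) = ℕ.n≮n _ l

        count-replicate : ∀ x c → count x (replicate c x) ≡ c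
        count-replicate x c = trans
          (cong length (List.filter-all (x ≟ᶻ_) (All.replicate⁺ c refl))) (List.length-replicate c)

        count-∷ : ∀ x y W → count x (powers (y ∷ W)) ≡ count x (replicate (e y) y) ℕ.+ count x (powers W)
        count-∷ x y W = trans (cong length (List.filter-++ (x ≟ᶻ_) (replicate (e y) y) (powers W)))
          (List.length-++ (filter (x ≟ᶻ_) (replicate (e y) y)))

        count-absent : ∀ {x} W → All (x ≢_) W → count x (powers W) ≡ 0
        count-absent []      []        = refl
        count-absent {x} (y ∷ W) (ne ∷ nes) = trans (count-∷ x y W) (cong₂ ℕ._+_
          (cong length (List.filter-none (x ≟ᶻ_) (All.replicate⁺ (e y) ne))) (count-absent W nes))

        count-powers : ∀ {x W} → AllPairs _≺_ W → x ∈ W → count x (powers W) ≡ e x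
        count-powers {x} {_ ∷ W} (l ∷ s) (here refl) = trans (count-∷ x x W)
          (trans (cong₂ ℕ._+_ (count-replicate x (e x))
            (count-absent W (All.map (λ { l refl → ≺-irrefl {x} l }) l))) (ℕ.+-identityʳ _))
        count-powers {x} {y ∷ W} (l ∷ s) (there x∈) = trans (count-∷ x y W)
          (cong₂ ℕ._+_ (cong length (List.filter-none (x ≟ᶻ_) (All.replicate⁺ (e y)
            λ { refl → ≺-irrefl {x} (All.lookup l x∈) }))) (count-powers s x∈))

    [z]-monomial : ∀ e → LinearForm.⟦ [z] ⟧ (monomial e) R.≈
      (if does (All.all? (λ x → e x ℕ.≟ 1) (indeterminates Js)) then R.1# else R.0#)
    [z]-monomial e = R.trans
      (eval-∏ (powers e (indeterminates Js)) squarefree (powers-sorted e (indeterminates-sorted Js)))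
      (R.reflexive (cong (λ t → if t then R.1# else R.0#) (Dec.does-⇔
        (mk⇔ (λ a → All.tabulate λ x∈ → trans (sym (counted x∈)) (All.lookup a x∈))
             (λ a → All.tabulate λ x∈ → trans (counted x∈) (All.lookup a x∈)))
        (All.all? (λ x → count x (powers e (indeterminates Js)) ℕ.≟ 1) (indeterminates Js))
        (All.all? (λ x → e x ℕ.≟ 1) (indeterminates Js)))))
      where
      counted : ∀ {x} → x ∈ indeterminates Js → count x (powers e (indeterminates Js)) ≡ e x
      counted = count-powers e (indeterminates-sorted Js)

    weight : ∀ {u v : Vertex Js} → Star Edge u v → Expr (Indeterminate Js)
    weight ε       = const R.1#
    weight (x ◅ π) = maybe′ gen (const R.1#) (label x) * weight π

    B : Fin n → Fin n → Expr (Indeterminate Js)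
    B i j = ∑ (map weight (paths Js i j))

    open QuantumMatrix n

    σB : LinearForm 𝒜[n,n]
    σB = restrict (Algebra.leftModule 𝒜) x^
      (straighten λ W → LinearForm.⟦ [z] ⟧ (∏ (map (λ (i , j) → B i j) W)))

    -- As the x^{e,w} span 𝒜[n,n], this and linearity characterise σB.
    σB-x^e : ∀ w → LinearForm.⟦ σB ⟧ (x^e w)
      R.≈ LinearForm.⟦ [z] ⟧ (∏ (map (λ i → B i (w ⟨$⟩ʳ i)) (allFin n)))
    σB-x^e w = R.trans
      (straighten-∏ (λ W → LinearForm.⟦ [z] ⟧ (∏ (map (λ (i , j) → B i j) W)))
        (map (λ i → i , w ⟨$⟩ʳ i) (allFin n))
        (AllPairs.map⁺ (AllPairs.tabulate⁺-< λ l → l))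
        (AllPairs.map⁺ (AllPairs.tabulate⁺ λ ne e → ne (Injection.injective (↔⇒↣ w) e))))
      (R.reflexive (cong (LinearForm.⟦ [z] ⟧ ∘ ∏) (sym (List.map-∘ (allFin n)))))

ℤ[q±½] : CommutativeRing 0ℓ 0ℓ
ℤ[q±½] = LaurentPolynomials.commutativeRing

q½ q⁻½ : CommutativeRing.Carrier ℤ[q±½]
q½  = [ 1ℤ , 1ℤ ]
q⁻½ = [ 1ℤ , -1ℤ ]

open SymmetricGroup public using (Interval)
open CommutativeRing ℤ[q±½] public using (_≈_)
open LinearAlgebra ℤ[q±½] public using (LinearForm; ∏; module Algebra)
open LinearForm public using (⟦_⟧)
open Quantum ℤ[q±½] q½ q⁻½ public

module Submission where

-- The star network is peeled off one factor at a time.  For functions u, w write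
-- M(u,w) = [z_G] ∏ b_{u_i,w_i} and X_u = Σ_w q^{-ℓ(w)/2} M(u,w) T_w in H_n(q).
-- The entries of B satisfy the relations of the quantum matrix bialgebra, which gives
-- T_s X_u = q^{½} X_{su} whenever su > u, hence T_f X_e = q^{ℓ(f)/2} X_f.  On the other
-- hand, to contribute to the coefficient of z_G the paths must leave the centre of the
-- first factor G_J through its edges in the order of some f ∈ 𝔖_J, and sorting these
-- edges costs q^{ℓ(f)/2}: X_e for G_J ∘ G is Σ_{f ∈ 𝔖_J} q^{ℓ(f)/2} X_f, that is C̃_{s_J} X_e.

open import Defs using (module LinearAlgebra; module Quantum; module SymmetricGroup; module StarNetworks)
open SymmetricGroup
open StarNetworks

open import Level using (Level; 0ℓ)
open import Algebra.Bundles using (CommutativeMonoid; CommutativeRing; Ring)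
open import Algebra.Module.Bundles using (LeftModule)
import Algebra.Properties.CommutativeMonoid.Sum as Sum
import Algebra.Properties.CommutativeSemigroup as CommutativeSemigroupProperties
open import Data.Bool.Base using (Bool; true; false; if_then_else_; _∧_)
import Data.Bool.Properties as Bool
open import Data.Empty.Irrelevant using (⊥-elim)
open import Data.Fin.Base as Fin using (Fin; zero; suc; toℕ; inject₁; punchIn)
open import Data.Fin.Patterns using (0F; 1F)
open import Data.Fin.Permutation as Perm
  using (Permutation′; _⟨$⟩ʳ_; _∘ₚ_; insert; remove; lift₀)
import Data.Fin.Properties as Fin
open import Data.List.Base
  using (List; []; _∷_; [_]; _++_; map; length; allFin; filter; foldr; concat; concatMap; tabulate;
         cartesianProductWith)
open import Data.List.Membership.Propositional using (_∈_; find)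
open import Data.List.Membership.Propositional.Properties using (∈-∃++; ∈-allFin; ∈-filter⁺)
import Data.List.Membership.Setoid.Properties as Membership
import Data.List.Properties as List
open import Data.List.Relation.Binary.Permutation.Propositional as ↭
  using (_↭_; ↭⇒↭ₛ; prep; swap)
import Data.List.Relation.Binary.Permutation.Propositional.Properties as ↭
open import Data.List.Relation.Unary.All as All using (All; []; _∷_)
import Data.List.Relation.Unary.All.Properties as All
open import Data.List.Relation.Unary.AllPairs as AllPairs using (AllPairs; []; _∷_)
import Data.List.Relation.Unary.AllPairs.Properties as AllPairs
open import Data.List.Relation.Unary.Any as Any using (Any; here; there)
import Data.List.Relation.Unary.Any.Properties as Any
open import Data.Maybe.Base as Maybe using (just; nothing; maybe′)
open import Data.Nat.Base as ℕ using (ℕ; zero; suc; z≤n; s≤s; z<s; s<s; ∣_-_∣)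
import Data.Nat.Properties as ℕ
open import Data.Product.Base using (Σ-syntax; ∃-syntax; _×_; _,_; proj₁; proj₂)
open import Data.Sum.Base as ⊎ using (_⊎_; inj₁; inj₂)
open import Data.Vec.Base using (Vec; []; _∷_; toList)
import Data.Vec.Functional as Vector
open import Function.Base using (_∘_)
open import Function.Bundles using (Injection; mk⇔)
open import Function.Properties.Inverse using (↔⇒↣)
open import Relation.Binary.Bundles using (Setoid)
open import Relation.Binary.Construct.Closure.ReflexiveTransitive using (Star; ε; _◅_; gmap)
open import Relation.Binary.PropositionalEquality as ≡
  using (_≡_; _≢_; refl; sym; trans; cong; cong₂; subst; module ≡-Reasoning)
open import Relation.Nullary using (Dec; yes; no; does; ¬_; contradiction; _×-dec_)
import Relation.Nullary.Decidable as Dec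
open import Relation.Unary using (Decidable)

open Sum ℕ.+-0-commutativeMonoid using (sum; sum-cong-≗; sum-permute)

-- The recursion takes place in H_n(q): the product of the `C̃ J` is shown to equal X_e, and θ_q is
-- applied only at the end. The rows u are arbitrary functions, because expanding the b_{i,w_i} over
-- the exits of G_J lets several paths leave by the same edge; such u vanish only under [z_G]. Two
-- obstacles shape the proof. `T w` is a product along one chosen reduced word, so T_s T_w = T_{sw}
-- at an ascent requires explicit braid moves between chosen words. The same identity, read as q - 1
-- = q^½ d, matches the descents: for v_i < v_{i+1} the relations of B give M(sv,w) = M(v,sw) + e
-- M(v,w) with e = d at a descent of w and e = 0 at an ascent, while T_s T_w acquires a term (q - 1)
-- T_w at descents only.

-- Finite sums over lists.

module ListSum {c ℓ : Level} (M : CommutativeMonoid c ℓ) where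
  open CommutativeMonoid M
    renaming (_∙_ to _+_; ε to 0#; ∙-cong to +-cong; identityˡ to +-identityˡ;
              identityʳ to +-identityʳ; assoc to +-assoc; refl to ≈-refl; sym to ≈-sym;
              trans to ≈-trans)
  open CommutativeSemigroupProperties commutativeSemigroup using (interchange; x∙yz≈y∙xz)
  open import Relation.Binary.Reasoning.Setoid setoid

  private variable
    A B : Set

  -- A fold over `map F xs`, so that in a presented algebra it is definitionally `∑ (map F xs)` and
  -- applies to `B` and `C̃` without conversion.
  ∑[_] : List A → (A → Carrier) → Carrier
  ∑[ xs ] F = foldr _+_ 0# (map F xs)

  ∑-cong-All : ∀ {xs : List A} {F G} → All (λ x → F x ≈ G x) xs → ∑[ xs ] F ≈ ∑[ xs ] G
  ∑-cong-All []       = ≈-refl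
  ∑-cong-All (p ∷ ps) = +-cong p (∑-cong-All ps)

  ∑-cong : ∀ (xs : List A) {F G} → (∀ x → F x ≈ G x) → ∑[ xs ] F ≈ ∑[ xs ] G
  ∑-cong xs p = ∑-cong-All (All.universal p xs)

  ∑-++ : ∀ (xs ys : List A) F → ∑[ xs ++ ys ] F ≈ ∑[ xs ] F + ∑[ ys ] F
  ∑-++ []       ys F = ≈-sym (+-identityˡ _)
  ∑-++ (x ∷ xs) ys F = ≈-trans (+-cong ≈-refl (∑-++ xs ys F)) (≈-sym (+-assoc _ _ _))

  ∑-+ : ∀ (xs : List A) F G → ∑[ xs ] (λ x → F x + G x) ≈ ∑[ xs ] F + ∑[ xs ] G
  ∑-+ []       F G = ≈-sym (+-identityˡ _)
  ∑-+ (x ∷ xs) F G = ≈-trans (+-cong ≈-refl (∑-+ xs F G)) (interchange _ _ _ _)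

  ∑-map : ∀ (g : A → B) xs F → ∑[ map g xs ] F ≡ ∑[ xs ] (F ∘ g)
  ∑-map g []       F = refl
  ∑-map g (x ∷ xs) F = ≡.cong (F (g x) +_) (∑-map g xs F)

  ∑-concatMap : ∀ (g : A → List B) xs F → ∑[ concatMap g xs ] F ≈ ∑[ xs ] (λ x → ∑[ g x ] F)
  ∑-concatMap g []       F = ≈-refl
  ∑-concatMap g (x ∷ xs) F =
    ≈-trans (∑-++ (g x) (concatMap g xs) F) (+-cong ≈-refl (∑-concatMap g xs F))

  ∑-0 : ∀ (xs : List A) → ∑[ xs ] (λ _ → 0#) ≈ 0#
  ∑-0 []       = ≈-refl
  ∑-0 (x ∷ xs) = ≈-trans (+-identityˡ _) (∑-0 xs)

  ∑-swap : ∀ (xs : List A) (ys : List B) (F : A → B → Carrier) →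
           ∑[ xs ] (λ x → ∑[ ys ] (F x)) ≈ ∑[ ys ] (λ y → ∑[ xs ] (λ x → F x y))
  ∑-swap []       ys F = ≈-sym (∑-0 ys)
  ∑-swap (x ∷ xs) ys F =
    ≈-trans (+-cong ≈-refl (∑-swap xs ys F)) (≈-sym (∑-+ ys (F x) _))

  ∑-cartesian : ∀ {C : Set} (g : A → B → C) xs ys (F : C → Carrier) →
    ∑[ cartesianProductWith g xs ys ] F ≈ ∑[ xs ] (λ x → ∑[ ys ] (λ y → F (g x y)))
  ∑-cartesian g []       ys F = ≈-refl
  ∑-cartesian g (x ∷ xs) ys F = ≈-trans (∑-++ (map (g x) ys) _ F)
    (+-cong (reflexive (∑-map (g x) ys F)) (∑-cartesian g xs ys F))

  ∑-filter : ∀ {P : A → Set} (P? : Decidable P) {xs} {F} →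
             All (λ x → ¬ P x → F x ≈ 0#) xs → ∑[ filter P? xs ] F ≈ ∑[ xs ] F
  ∑-filter P? {[]}     []       = ≈-refl
  ∑-filter P? {x ∷ xs} (p ∷ ps) with P? x
  ... | yes _  = +-cong ≈-refl (∑-filter P? ps)
  ... | no ¬px = ≈-trans (∑-filter P? ps)
                   (≈-trans (≈-sym (+-identityˡ _)) (+-cong (≈-sym (p ¬px)) ≈-refl))

  ∑-filter-if : ∀ {P : A → Set} (P? : Decidable P) xs F →
                ∑[ filter P? xs ] F ≈ ∑[ xs ] (λ x → if does (P? x) then F x else 0#)
  ∑-filter-if P? []       F = ≈-refl
  ∑-filter-if P? (x ∷ xs) F with does (P? x)
  ... | true  = +-cong ≈-refl (∑-filter-if P? xs F)
  ... | false = ≈-trans (∑-filter-if P? xs F) (≈-sym (+-identityˡ _))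

  ∑-↭ : ∀ {xs ys : List A} F → xs ↭ ys → ∑[ xs ] F ≈ ∑[ ys ] F
  ∑-↭ F ↭.refl        = ≈-refl
  ∑-↭ F (prep x p)    = +-cong ≈-refl (∑-↭ F p)
  ∑-↭ F (swap x y p)  =
    ≈-trans (x∙yz≈y∙xz _ _ _) (+-cong ≈-refl (+-cong ≈-refl (∑-↭ F p)))
  ∑-↭ F (↭.trans p q) = ≈-trans (∑-↭ F p) (∑-↭ F q)

  module _ (S : Setoid 0ℓ 0ℓ) where
    private module S = Setoid S

    Unique : List S.Carrier → Set
    Unique = AllPairs (λ x y → ¬ x S.≈ y)

    Contains : List S.Carrier → S.Carrier → Set
    Contains ys x = Any (x S.≈_) ys

    -- Permutations and choice functions are compared pointwise, so two enumerations of one finite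
    -- set need not be related by `↭`. The element of `ys` matching the head of `xs` is moved to the
    -- front; uniqueness on both sides shows that the tails still contain each other.
    ∑-reindex : ∀ {xs ys} F → (∀ {x y} → x S.≈ y → F x ≈ F y) → Unique xs → Unique ys →
                All (Contains ys) xs → All (Contains xs) ys → ∑[ xs ] F ≈ ∑[ ys ] F
    ∑-reindex {[]} {[]}     F F-cong u v i j = ≈-refl
    ∑-reindex {[]} {y ∷ ys} F F-cong u v i (() ∷ _)
    ∑-reindex {x ∷ xs} {ys} F F-cong (x∉ ∷ u) v (x∈ ∷ i) j
      with y , y∈ , x≈y ← find x∈
      with ys₁ , ys₂ , refl ← ∈-∃++ y∈ = begin
        F x + ∑[ xs ] F
          ≈⟨ +-cong (F-cong x≈y) (∑-reindex F F-cong u (AllPairs.tail v′)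
               (All.zipWith (λ { (x≉z , here z≈y) → contradiction (S.trans x≈y (S.sym z≈y)) x≉z
                               ; (_ , there z∈) → z∈ })
                 (x∉ , All.map (↭.Any-resp-↭ p) i))
               (All.zipWith (λ { (y≉z , here z≈x) → contradiction (S.sym (S.trans z≈x x≈y)) y≉z
                               ; (_ , there z∈) → z∈ })
                 (AllPairs.head v′ , All.tail (↭.All-resp-↭ p j)))) ⟩
        F y + ∑[ ys₁ ++ ys₂ ] F ≈⟨ ∑-↭ F p ⟨
        ∑[ ys ] F ∎
      where
      open import Data.List.Relation.Binary.Permutation.Setoid.Properties
        (≡.setoid S.Carrier) using (AllPairs-resp-↭)
      p = ↭.shift y ys₁ ys₂
      v′ = AllPairs-resp-↭ (_∘ S.sym) ((λ { refl n → n }) , (λ { refl n → n })) (↭⇒↭ₛ p) v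

-- Chosen reduced words, braid moves and length.

permutationSetoid : ℕ → Setoid 0ℓ 0ℓ
permutationSetoid n = record
  { Carrier = Permutation′ n ; _≈_ = Perm._≈_
  ; isEquivalence = record
    { refl = λ _ → refl ; sym = λ e i → sym (e i) ; trans = λ e f i → trans (e i) (f i) } }

private variable
  N : ℕ

perm-injective : ∀ {n} (w : Permutation′ n) {i j} → w ⟨$⟩ʳ i ≡ w ⟨$⟩ʳ j → i ≡ j
perm-injective w = Injection.injective (↔⇒↣ w)

remove-cong : ∀ {n} (v w : Permutation′ (suc n)) → v Perm.≈ w → remove zero v Perm.≈ remove zero w
remove-cong v w p i = Fin.punchIn-injective (v ⟨$⟩ʳ zero) _ _ (begin
  punchIn (v ⟨$⟩ʳ zero) (remove zero v ⟨$⟩ʳ i) ≡⟨ Perm.punchIn-permute v zero i ⟨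
  v ⟨$⟩ʳ suc i                                 ≡⟨ p (suc i) ⟩
  w ⟨$⟩ʳ suc i                                 ≡⟨ Perm.punchIn-permute w zero i ⟩
  punchIn (w ⟨$⟩ʳ zero) (remove zero w ⟨$⟩ʳ i) ≡⟨ cong (λ k → punchIn k _) (p zero) ⟨
  punchIn (v ⟨$⟩ʳ zero) (remove zero w ⟨$⟩ʳ i) ∎)
  where open ≡-Reasoning

reducedWord-cong : (v w : Permutation′ (suc N)) → v Perm.≈ w → reducedWord v ≡ reducedWord w
reducedWord-cong {zero}  v w p = refl
reducedWord-cong {suc N} v w p =
  cong₂ (λ u k → map suc u ++ below k) (reducedWord-cong (remove zero v) (remove zero w) (remove-cong v w p)) (p zero)

reducedWord-insert : ∀ k (w : Permutation′ (suc N)) →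
                     reducedWord (insert zero k w) ≡ map suc (reducedWord w) ++ below k
reducedWord-insert k w =
  cong (λ u → map suc u ++ below k) (reducedWord-cong (remove zero (insert zero k w)) w (Perm.remove-insert zero k w))

s-suc : ∀ (i : Fin N) → s (suc i) Perm.≈ lift₀ (s i)
s-suc i = Perm.lift₀-transpose (inject₁ i) (suc i)

s-involutive : ∀ (i : Fin N) j → s i ⟨$⟩ʳ (s i ⟨$⟩ʳ j) ≡ j
s-involutive zero    zero          = refl
s-involutive zero    (suc zero)    = refl
s-involutive zero    (suc (suc j)) = refl
s-involutive (suc i) zero          = refl
s-involutive (suc i) (suc j)       = begin
  s (suc i) ⟨$⟩ʳ (s (suc i) ⟨$⟩ʳ suc j) ≡⟨ cong (s (suc i) ⟨$⟩ʳ_) (s-suc i (suc j)) ⟩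
  s (suc i) ⟨$⟩ʳ suc (s i ⟨$⟩ʳ j)       ≡⟨ s-suc i (suc (s i ⟨$⟩ʳ j)) ⟩
  suc (s i ⟨$⟩ʳ (s i ⟨$⟩ʳ j))           ≡⟨ cong suc (s-involutive i j) ⟩
  suc j ∎
  where open ≡-Reasoning

s-left : ∀ (i : Fin N) → s i ⟨$⟩ʳ inject₁ i ≡ suc i
s-left zero    = refl
s-left (suc i) = trans (s-suc i (inject₁ (suc i))) (cong suc (s-left i))

s-right : ∀ (i : Fin N) → s i ⟨$⟩ʳ suc i ≡ inject₁ i
s-right i = trans (cong (s i ⟨$⟩ʳ_) (sym (s-left i))) (s-involutive i (inject₁ i))

infix 4 _≃_
-- The congruence generated by braid and commutation moves only. Omitting cancellation makes it
-- preserve the number of letters and hold in the Hecke algebra as well as in the symmetric group.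
data _≃_ {N} : (u v : List (Fin N)) → Set where
  ≃-refl  : ∀ {u} → u ≃ u
  ≃-sym   : ∀ {u v} → u ≃ v → v ≃ u
  ≃-trans : ∀ {u v w} → u ≃ v → v ≃ w → u ≃ w
  ++-cong : ∀ {u u′ v v′} → u ≃ u′ → v ≃ v′ → u ++ v ≃ u′ ++ v′
  braid   : ∀ i j → ∣ toℕ i - toℕ j ∣ ≡ 1 → i ∷ j ∷ i ∷ [] ≃ j ∷ i ∷ j ∷ []
  commute : ∀ i j → 2 ℕ.≤ ∣ toℕ i - toℕ j ∣ → i ∷ j ∷ [] ≃ j ∷ i ∷ []

≃-reflexive : ∀ {u v : List (Fin N)} → u ≡ v → u ≃ v
≃-reflexive refl = ≃-refl

≃-setoid : ℕ → Setoid 0ℓ 0ℓ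
≃-setoid N = record
  { Carrier = List (Fin N) ; _≈_ = _≃_
  ; isEquivalence = record { refl = ≃-refl ; sym = ≃-sym ; trans = ≃-trans } }

module ≃-Reasoning {N : ℕ} where
  open import Relation.Binary.Reasoning.Setoid (≃-setoid N) public

∷-cong : ∀ (i : Fin N) {u v} → u ≃ v → i ∷ u ≃ i ∷ v
∷-cong i = ++-cong (≃-refl {u = [ i ]})

map-suc-cong : ∀ {u v : List (Fin N)} → u ≃ v → map suc u ≃ map suc v
map-suc-cong ≃-refl          = ≃-refl
map-suc-cong (≃-sym p)       = ≃-sym (map-suc-cong p)
map-suc-cong (≃-trans p q)   = ≃-trans (map-suc-cong p) (map-suc-cong q)
map-suc-cong (++-cong {u} {u′} {v} {v′} p q) = ≃-trans (≃-reflexive (List.map-++ suc u v))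
  (≃-trans (++-cong (map-suc-cong p) (map-suc-cong q)) (≃-reflexive (sym (List.map-++ suc u′ v′))))
map-suc-cong (braid i j e)   = braid (suc i) (suc j) e
map-suc-cong (commute i j l) = commute (suc i) (suc j) l

≃-length : ∀ {u v : List (Fin N)} → u ≃ v → length u ≡ length v
≃-length ≃-refl          = refl
≃-length (≃-sym p)       = sym (≃-length p)
≃-length (≃-trans p q)   = trans (≃-length p) (≃-length q)
≃-length (++-cong {u} {u′} p q) =
  trans (List.length-++ u) (trans (cong₂ ℕ._+_ (≃-length p) (≃-length q)) (sym (List.length-++ u′)))
≃-length (braid i j e)   = refl
≃-length (commute i j l) = refl

suc² : Fin N → Fin (suc (suc N))
suc² i = suc (suc i)

zero-commutes : ∀ (u : List (Fin N)) → zero ∷ map suc² u ≃ map suc² u ++ [ zero ]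
zero-commutes []      = ≃-refl
zero-commutes (j ∷ u) = ≃-trans (++-cong (commute zero (suc (suc j)) (s≤s (s≤s z≤n))) ≃-refl)
  (∷-cong (suc (suc j)) (zero-commutes u))

-- `below k` is the word 0, 1, ..., k-1 of a cycle, which conjugates each generator to the next one.
-- The last letter j moves left past the letters above j+1, meets j and j+1 in a braid relation, and
-- the resulting j+1 commutes past the letters below j.
below-slide : ∀ (j : Fin N) (k : Fin (suc (suc N))) → suc (toℕ j) ℕ.< toℕ k →
              below k ++ [ inject₁ j ] ≃ suc j ∷ below k
below-slide zero (suc zero) (s≤s ())
below-slide zero (suc (suc k)) _ = begin
  zero ∷ suc zero ∷ map suc (map suc (below k)) ++ [ zero ]
    ≡⟨ cong (λ u → zero ∷ suc zero ∷ u ++ [ zero ]) (List.map-∘ (below k)) ⟨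
  zero ∷ suc zero ∷ map suc² (below k) ++ [ zero ]
    ≈⟨ ∷-cong zero (∷-cong (suc zero) (zero-commutes (below k))) ⟨
  (zero ∷ suc zero ∷ zero ∷ []) ++ map suc² (below k)
    ≈⟨ ++-cong (braid zero (suc zero) refl) ≃-refl ⟩
  suc zero ∷ zero ∷ suc zero ∷ map suc² (below k)
    ≡⟨ cong (λ u → suc zero ∷ zero ∷ suc zero ∷ u) (List.map-∘ (below k)) ⟩
  suc zero ∷ zero ∷ suc zero ∷ map suc (map suc (below k)) ∎
  where open ≃-Reasoning
below-slide (suc j) (suc k) (s≤s l) = begin
  zero ∷ map suc (below k) ++ [ suc (inject₁ j) ]
    ≡⟨ cong (zero ∷_) (List.map-++ suc (below k) [ inject₁ j ]) ⟨
  zero ∷ map suc (below k ++ [ inject₁ j ])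
    ≈⟨ ∷-cong zero (map-suc-cong (below-slide j k l)) ⟩
  zero ∷ suc (suc j) ∷ map suc (below k)
    ≈⟨ ++-cong (commute zero (suc (suc j)) (s≤s (s≤s z≤n))) ≃-refl ⟩
  suc (suc j) ∷ zero ∷ map suc (below k) ∎
  where open ≃-Reasoning

below-slide* : ∀ (u : List (Fin N)) k → All (λ j → suc (toℕ j) ℕ.< toℕ k) u →
               below k ++ map inject₁ u ≃ map suc u ++ below k
below-slide* []      k []       = ≃-reflexive (List.++-identityʳ _)
below-slide* (j ∷ u) k (l ∷ ls) = begin
  below k ++ inject₁ j ∷ map inject₁ u       ≡⟨ List.++-assoc (below k) [ inject₁ j ] _ ⟨
  (below k ++ [ inject₁ j ]) ++ map inject₁ u ≈⟨ ++-cong (below-slide j k l) ≃-refl ⟩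
  suc j ∷ below k ++ map inject₁ u           ≈⟨ ∷-cong (suc j) (below-slide* u k ls) ⟩
  suc j ∷ map suc u ++ below k               ∎
  where open ≃-Reasoning

below-< : ∀ (k : Fin (suc N)) → All (λ i → toℕ i ℕ.< toℕ k) (below k)
below-<         zero    = []
below-< {suc N} (suc k) = z<s ∷ All.map⁺ (All.map s<s (below-< k))

below-inject₁ : ∀ (k : Fin (suc N)) → below (inject₁ k) ≡ map inject₁ (below k)
below-inject₁         zero    = refl
below-inject₁ {suc N} (suc k) = cong (zero ∷_) (begin
  map suc (below (inject₁ k))     ≡⟨ cong (map suc) (below-inject₁ k) ⟩
  map suc (map inject₁ (below k)) ≡⟨ List.map-∘ (below k) ⟨
  map (inject₁ ∘ suc) (below k)   ≡⟨ List.map-∘ (below k) ⟩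
  map inject₁ (map suc (below k)) ∎)
  where open ≡-Reasoning

below-below : ∀ (r k : Fin (suc N)) → r Fin.≤ k →
              below (suc k) ++ below (inject₁ r) ≃ map suc (below r) ++ below (suc k)
below-below r k r≤k = ≃-trans (≃-reflexive (cong (below (suc k) ++_) (below-inject₁ r)))
  (below-slide* (below r) (suc k) (All.map (λ l → s≤s (ℕ.≤-trans l r≤k)) (below-< r)))

punchIn-≤ : ∀ {n} (r k : Fin n) → r Fin.≤ k → punchIn (inject₁ r) k ≡ suc k
punchIn-≤ zero    k       l       = refl
punchIn-≤ (suc r) (suc k) (s≤s l) = cong suc (punchIn-≤ r k l)

punchIn-suc-≤ : ∀ {n} (r k : Fin n) → r Fin.≤ k → punchIn (suc k) r ≡ inject₁ r
punchIn-suc-≤ zero    k       l       = refl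
punchIn-suc-≤ (suc r) (suc k) (s≤s l) = cong suc (punchIn-suc-≤ r k l)

-- The cosimplicial identity for the coface maps `punchIn`; it is the counterpart of `below-below`
-- for one-line notation.
punchIn-punchIn : ∀ {n} (r k : Fin (suc n)) x → r Fin.≤ k →
                  punchIn (inject₁ r) (punchIn k x) ≡ punchIn (suc k) (punchIn r x)
punchIn-punchIn zero    k       x       l       = refl
punchIn-punchIn (suc r) (suc k) zero    (s≤s l) = refl
punchIn-punchIn (suc r) (suc k) (suc x) (s≤s l) = cong suc (punchIn-punchIn r k x l)

<-punchIn : ∀ {n} (a : Fin (suc n)) (k : Fin n) → a Fin.< punchIn a k →
            Σ[ r ∈ Fin n ] a ≡ inject₁ r × r Fin.≤ k
<-punchIn zero    (zero)  _ = zero , refl , z≤n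
<-punchIn zero    (suc k) _ = zero , refl , z≤n
<-punchIn (suc a) (suc k) (s≤s l) with r , e , r≤k ← <-punchIn a k l = suc r , cong suc e , s≤s r≤k

punchIn-cancel-< : ∀ {n} (k : Fin (suc n)) {a b} → punchIn k a Fin.< punchIn k b → a Fin.< b
punchIn-cancel-< k {a} {b} l = ℕ.≰⇒> λ b≤a → ℕ.<⇒≱ l (Fin.punchIn-mono-≤ k b a b≤a)

Ascends : Fin N → Permutation′ (suc N) → Set
Ascends i w = w ⟨$⟩ʳ inject₁ i Fin.< w ⟨$⟩ʳ suc i

-- The instance of Matsumoto's theorem for the chosen words. For i > 0 it is inherited from
-- `remove zero w`. For i = 0 the one-line notation begins with r, k+1 where r ≤ k; the new letter 0
-- commutes past the part that sorts the other entries and completes `below (suc k)`, and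
-- `below-below` exchanges this cycle with the one for r.
reducedWord-ascent : ∀ (i : Fin N) w → Ascends i w → i ∷ reducedWord w ≃ reducedWord (s i ∘ₚ w)
reducedWord-ascent {suc N} (suc i) w asc = begin
  map suc (i ∷ reducedWord w′) ++ below w₀
    ≈⟨ ++-cong (map-suc-cong (reducedWord-ascent i w′ asc′)) ≃-refl ⟩
  map suc (reducedWord (s i ∘ₚ w′)) ++ below w₀
    ≡⟨ reducedWord-insert w₀ (s i ∘ₚ w′) ⟨
  reducedWord (insert zero w₀ (s i ∘ₚ w′))
    ≡⟨ reducedWord-cong (insert zero w₀ (s i ∘ₚ w′)) (s (suc i) ∘ₚ w) eq ⟩
  reducedWord (s (suc i) ∘ₚ w) ∎
  where
  open ≃-Reasoning
  w₀ = w ⟨$⟩ʳ zero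
  w′ = remove zero w
  asc′ : Ascends i w′
  asc′ = punchIn-cancel-< w₀ (≡.subst₂ Fin._<_
    (Perm.punchIn-permute w zero (inject₁ i)) (Perm.punchIn-permute w zero (suc i)) asc)
  eq : insert zero w₀ (s i ∘ₚ w′) Perm.≈ s (suc i) ∘ₚ w
  eq zero    = refl
  eq (suc j) = sym (trans (cong (w ⟨$⟩ʳ_) (s-suc i (suc j))) (Perm.punchIn-permute w zero (s i ⟨$⟩ʳ j)))
reducedWord-ascent {suc zero} zero w asc with w ⟨$⟩ʳ zero | w ⟨$⟩ʳ suc zero
... | zero | suc zero = ≃-refl
reducedWord-ascent {suc zero} zero w (s≤s ()) | suc zero | suc zero
reducedWord-ascent {suc (suc N)} zero w asc = result (<-punchIn w₀ k asc′)
  where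
  open ≃-Reasoning
  w₀ = w ⟨$⟩ʳ zero
  w′ = remove zero w
  k  = w′ ⟨$⟩ʳ zero
  w″ = remove zero w′
  at₁ : w ⟨$⟩ʳ suc zero ≡ punchIn w₀ k
  at₁ = Perm.punchIn-permute w zero zero
  asc′ : w₀ Fin.< punchIn w₀ k
  asc′ = subst (w₀ Fin.<_) at₁ asc
  result : Σ[ r ∈ Fin (suc (suc N)) ] w₀ ≡ inject₁ r × r Fin.≤ k →
           zero ∷ reducedWord w ≃ reducedWord (s zero ∘ₚ w)
  result (r , w₀≡ , r≤k) = begin
    zero ∷ map suc (map suc u ++ below k) ++ below w₀
      ≡⟨ cong (λ v → zero ∷ v ++ below w₀) (trans (List.map-++ suc (map suc u) (below k))
           (cong (_++ map suc (below k)) (sym (List.map-∘ u)))) ⟩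
    zero ∷ (map suc² u ++ map suc (below k)) ++ below w₀
      ≡⟨ cong (zero ∷_) (List.++-assoc (map suc² u) _ _) ⟩
    (zero ∷ map suc² u) ++ map suc (below k) ++ below w₀
      ≈⟨ ++-cong (zero-commutes u) ≃-refl ⟩
    (map suc² u ++ [ zero ]) ++ map suc (below k) ++ below w₀
      ≡⟨ List.++-assoc (map suc² u) [ zero ] _ ⟩
    map suc² u ++ below (suc k) ++ below w₀
      ≡⟨ cong (λ a → map suc² u ++ below (suc k) ++ below a) w₀≡ ⟩
    map suc² u ++ below (suc k) ++ below (inject₁ r)
      ≈⟨ ++-cong ≃-refl (below-below r k r≤k) ⟩
    map suc² u ++ map suc (below r) ++ below (suc k)
      ≡⟨ List.++-assoc (map suc² u) _ _ ⟨
    (map suc² u ++ map suc (below r)) ++ below (suc k)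
      ≡⟨ cong (_++ below (suc k)) (trans (List.map-++ suc (map suc u) (below r))
           (cong (_++ map suc (below r)) (sym (List.map-∘ u)))) ⟨
    map suc (map suc u ++ below r) ++ below (suc k)
      ≡⟨ cong (λ v → map suc v ++ below (suc k)) (reducedWord-insert r w″) ⟨
    map suc (reducedWord (insert zero r w″)) ++ below (suc k)
      ≡⟨ reducedWord-insert (suc k) (insert zero r w″) ⟨
    reducedWord (insert zero (suc k) (insert zero r w″))
      ≡⟨ reducedWord-cong (insert zero (suc k) (insert zero r w″)) (s zero ∘ₚ w) eq ⟩
    reducedWord (s zero ∘ₚ w) ∎
    where
    u = reducedWord w″
    eq : insert zero (suc k) (insert zero r w″) Perm.≈ s zero ∘ₚ w
    eq zero          = sym (trans at₁ (trans (cong (λ a → punchIn a k) w₀≡) (punchIn-≤ r k r≤k)))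
    eq (suc zero)    = trans (punchIn-suc-≤ r k r≤k) (sym w₀≡)
    eq (suc (suc j)) = sym (trans (Perm.punchIn-permute w zero (suc j)) (trans
      (cong₂ punchIn w₀≡ (Perm.punchIn-permute w′ zero j)) (punchIn-punchIn r k _ r≤k)))

ℓ-cong : ∀ (v w : Permutation′ (suc N)) → v Perm.≈ w → ℓ v ≡ ℓ w
ℓ-cong v w p = trans (sym (reducedWord-length v))
  (trans (cong length (reducedWord-cong v w p)) (reducedWord-length w))

-- The chosen words have length ℓ, and braid moves keep the number of letters.
ℓ-ascent : ∀ (i : Fin N) w → Ascends i w → ℓ (s i ∘ₚ w) ≡ suc (ℓ w)
ℓ-ascent i w asc = trans (sym (reducedWord-length (s i ∘ₚ w)))
  (trans (sym (≃-length (reducedWord-ascent i w asc))) (cong suc (reducedWord-length w)))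

data Direction (i : Fin N) (w : Permutation′ (suc N)) : Set where
  ascent  : Ascends i w → Direction i w
  descent : w ⟨$⟩ʳ suc i Fin.< w ⟨$⟩ʳ inject₁ i → Ascends i (s i ∘ₚ w) → Direction i w

direction : ∀ (i : Fin N) w → Direction i w
direction i w with w ⟨$⟩ʳ inject₁ i Fin.<? w ⟨$⟩ʳ suc i
... | yes asc = ascent asc
... | no ¬asc = descent desc (≡.subst₂ (λ a b → w ⟨$⟩ʳ a Fin.< w ⟨$⟩ʳ b)
                  (sym (s-left i)) (sym (s-right i)) desc)
  where
  desc : w ⟨$⟩ʳ suc i Fin.< w ⟨$⟩ʳ inject₁ i
  desc = Fin.≤∧≢⇒< (ℕ.≮⇒≥ ¬asc) λ e → ℕ.1+n≢n (trans (cong toℕ (perm-injective w e)) (Fin.toℕ-inject₁ i))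

s-s : ∀ (i : Fin N) (w : Permutation′ (suc N)) → s i ∘ₚ (s i ∘ₚ w) Perm.≈ w
s-s i w j = cong (w ⟨$⟩ʳ_) (s-involutive i j)

ℓ-descent : ∀ (i : Fin N) w → Ascends i (s i ∘ₚ w) → ℓ w ≡ suc (ℓ (s i ∘ₚ w))
ℓ-descent i w asc = trans (sym (ℓ-cong (s i ∘ₚ (s i ∘ₚ w)) w (s-s i w))) (ℓ-ascent i (s i ∘ₚ w) asc)

ℓ-evalWord : ∀ (u : List (Fin N)) → ℓ (evalWord u) ℕ.≤ length u
ℓ-evalWord {N} []  = ℕ.≤-reflexive (ℓ-id N)
  where
  ℓ-id : ∀ N → ℓ (Perm.id {suc N}) ≡ 0
  ℓ-id zero    = refl
  ℓ-id (suc N) = trans (ℓ-remove (Perm.id {suc (suc N)})) (trans (ℕ.+-identityʳ _)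
    (trans (ℓ-cong (remove zero (Perm.id {suc (suc N)})) (Perm.id {suc N}) (λ i → refl)) (ℓ-id N)))
ℓ-evalWord (i ∷ u) with direction i (evalWord u)
... | ascent asc    = ℕ.≤-trans (ℕ.≤-reflexive (ℓ-ascent i (evalWord u) asc)) (s≤s (ℓ-evalWord u))
... | descent _ asc = ℕ.≤-trans (ℕ.n≤1+n _)
  (ℕ.≤-trans (ℕ.≤-reflexive (sym (ℓ-descent i (evalWord u) asc))) (ℕ.m≤n⇒m≤1+n (ℓ-evalWord u)))

Reduced : List (Fin N) → Set
Reduced u = length u ≡ ℓ (evalWord u)

-- At a descent `evalWord u` would have length `length u + 2`, contrary to `ℓ-evalWord`.
reduced-ascends : ∀ (i : Fin N) u → Reduced (i ∷ u) → Ascends i (evalWord u)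
reduced-ascends i u red with direction i (evalWord u)
... | ascent asc    = asc
... | descent _ asc = contradiction (ℕ.≤-trans (ℕ.≤-reflexive (sym (trans
    (ℓ-descent i (evalWord u) asc) (cong suc (sym red))))) (ℓ-evalWord u)) (ℕ.<⇒≱ (ℕ.n≤1+n _))

reduced-tail : ∀ (i : Fin N) u → Reduced (i ∷ u) → Reduced u
reduced-tail i u red =
  ℕ.suc-injective (trans red (ℓ-ascent i (evalWord u) (reduced-ascends i u red)))

reducedWord-reduced : ∀ (w : Permutation′ (suc N)) → Reduced (reducedWord w)
reducedWord-reduced w =
  trans (reducedWord-length w)
    (ℓ-cong w (evalWord (reducedWord w)) λ i → sym (reducedWord-eval w i))

-- The subgroup of J as the permutations fixing every point outside J.

-- If `punchIn k` keeps a in place, then k > a > i and k itself lies above i+1; otherwise a moves up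
-- by one.
punchIn-cases : ∀ {n} (k : Fin (suc n)) (a : Fin n) {i} → i ℕ.< toℕ a →
                suc i ℕ.< toℕ k ⊎ suc i ℕ.< toℕ (punchIn k a)
punchIn-cases zero          a       l       = inj₂ (s≤s l)
punchIn-cases (suc zero)    (suc a) {zero}  l       = inj₂ (s≤s (s≤s z≤n))
punchIn-cases (suc (suc k)) (suc a) {zero}  l       = inj₁ (s≤s (s≤s z≤n))
punchIn-cases (suc k)       (suc a) {suc i} (s≤s l) = ⊎.map s≤s s≤s (punchIn-cases k a l)

-- A letter i of the chosen word is witnessed by an entry that crosses the gap between i and i+1
-- upwards. This confines the letters once the moved points are known.
reducedWord-crossing : ∀ (w : Permutation′ (suc N)) →
  All (λ i → ∃[ a ] toℕ a ℕ.≤ toℕ i × toℕ i ℕ.< toℕ (w ⟨$⟩ʳ a)) (reducedWord w)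
reducedWord-crossing {zero}  w = []
reducedWord-crossing {suc N} w = All.++⁺
  (All.map⁺ (All.map (λ (a , a≤i , i<) → lift a≤i (punchIn-cases (w ⟨$⟩ʳ zero) _ i<))
    (reducedWord-crossing (remove zero w))))
  (All.map (λ l → zero , z≤n , l) (below-< (w ⟨$⟩ʳ zero)))
  where
  lift : ∀ {a i} → toℕ a ℕ.≤ i →
    suc i ℕ.< toℕ (w ⟨$⟩ʳ zero) ⊎
      suc i ℕ.< toℕ (punchIn (w ⟨$⟩ʳ zero) (remove zero w ⟨$⟩ʳ a)) →
    ∃[ b ] toℕ b ℕ.≤ suc i × suc i ℕ.< toℕ (w ⟨$⟩ʳ b)
  lift {a} a≤i (inj₁ l) = zero , z≤n , l
  lift {a} a≤i (inj₂ l) =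
    suc a , s≤s a≤i , subst (λ b → _ ℕ.< toℕ b) (sym (Perm.punchIn-permute w zero a)) l

-- The crossing position a is moved by `w`, so a and its image both lie in J; as a ≤ i < w a, the
-- interval J contains i and i+1.
fixes⇒∈𝔖 : ∀ (J : Interval (suc N)) w → (∀ i → ¬ i ∈ᴵ J → w ⟨$⟩ʳ i ≡ i) → w ∈𝔖 J
fixes⇒∈𝔖 J w fix = reducedWord w , All.map inside (reducedWord-crossing w) ,
                   λ i → sym (reducedWord-eval w i)
  where
  inside : ∀ {i} → (∃[ a ] toℕ a ℕ.≤ toℕ i × toℕ i ℕ.< toℕ (w ⟨$⟩ʳ a)) →
           inject₁ i ∈ᴵ J × suc i ∈ᴵ J
  inside {i} (a , a≤i , i<wa) =
    (ℕ.≤-trans lo≤i i≤ , ℕ.≤-trans (ℕ.≤-reflexive (Fin.toℕ-inject₁ i)) (ℕ.<⇒≤ i<hi)) ,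
    (ℕ.m≤n⇒m≤1+n lo≤i , i<hi)
    where
    moved : w ⟨$⟩ʳ a ≢ a
    moved e = ℕ.<⇒≱ i<wa (subst (λ b → toℕ b ℕ.≤ toℕ i) (sym e) a≤i)
    a∈ : a ∈ᴵ J
    a∈ with a ∈ᴵ? J
    ... | yes a∈ = a∈
    ... | no a∉  = contradiction (fix a a∉) moved
    wa∈ : w ⟨$⟩ʳ a ∈ᴵ J
    wa∈ with w ⟨$⟩ʳ a ∈ᴵ? J
    ... | yes wa∈ = wa∈
    ... | no wa∉  = contradiction (perm-injective w (fix (w ⟨$⟩ʳ a) wa∉)) moved
    lo≤i : toℕ (lo J) ℕ.≤ toℕ i
    lo≤i = ℕ.≤-trans (proj₁ a∈) a≤i
    i≤ : toℕ i ℕ.≤ toℕ (inject₁ i)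
    i≤ = ℕ.≤-reflexive (sym (Fin.toℕ-inject₁ i))
    i<hi : toℕ i ℕ.< toℕ (hi J)
    i<hi = ℕ.≤-trans i<wa (proj₂ wa∈)

s-fixes : ∀ (i : Fin N) k → k ≢ inject₁ i → k ≢ suc i → s i ⟨$⟩ʳ k ≡ k
s-fixes zero    zero          ne _  = contradiction refl ne
s-fixes zero    (suc zero)    _  ne = contradiction refl ne
s-fixes zero    (suc (suc k)) _  _  = refl
s-fixes (suc i) zero          _  _  = refl
s-fixes (suc i) (suc k)       ne nf =
  trans (s-suc i (suc k)) (cong suc (s-fixes i k (ne ∘ cong suc) (nf ∘ cong suc)))

∈𝔖⇒fixes : ∀ (J : Interval (suc N)) w → w ∈𝔖 J → ∀ k → ¬ k ∈ᴵ J → w ⟨$⟩ʳ k ≡ k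
∈𝔖⇒fixes J w (u , ps , w≈) k k∉ = trans (w≈ k) (go u ps)
  where
  go : ∀ u → All (λ i → inject₁ i ∈ᴵ J × suc i ∈ᴵ J) u → evalWord u ⟨$⟩ʳ k ≡ k
  go []      []             = refl
  go (i ∷ u) ((p , q) ∷ ps) = trans
    (cong (evalWord u ⟨$⟩ʳ_) (s-fixes i k (λ { refl → k∉ p }) (λ { refl → k∉ q }))) (go u ps)

-- Sums and ordered products in presented algebras.

-- The index set of the expansion of a product of sums: all ways of choosing one summand from each
-- factor.
choices : ∀ {A : Set} {n} → (Fin n → List A) → List (Fin n → A)
choices {n = zero}  c = [ Vector.[] ]
choices {n = suc n} c = cartesianProductWith Vector._∷_ (c zero) (choices (c ∘ suc))

module PresentedAlgebra (R : CommutativeRing 0ℓ 0ℓ) (P : LinearAlgebra.Presentation R) where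
  private module R = CommutativeRing R
  open LinearAlgebra R
  open Presentation P
  open Algebra P public
  open ListSum (Ring.+-commutativeMonoid ring) public
  open import Relation.Binary.Reasoning.Setoid (Ring.setoid ring) public

  zeroˡ : ∀ s → const R.0# * s ≈ const R.0#
  zeroˡ = Ring.zeroˡ ring

  zeroʳ : ∀ s → s * const R.0# ≈ const R.0#
  zeroʳ = Ring.zeroʳ ring

  *-identityʳ : ∀ s → s * const R.1# ≈ s
  *-identityʳ = Ring.*-identityʳ ring

  +-identityʳ : ∀ s → s + const R.0# ≈ s
  +-identityʳ = Ring.+-identityʳ ring

  *-congˡ : ∀ {s t u} → t ≈ u → s * t ≈ s * u
  *-congˡ = *-cong ≈-refl

  *-congʳ : ∀ {s t u} → t ≈ u → t * s ≈ u * s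
  *-congʳ p = *-cong p ≈-refl

  +-congˡ : ∀ {s t u} → t ≈ u → s + t ≈ s + u
  +-congˡ = +-cong ≈-refl

  ≡⇒≈ : ∀ {s t} → s ≡ t → s ≈ t
  ≡⇒≈ refl = ≈-refl

  infixr 8 _•_
  _•_ : R.Carrier → Expr Gen → Expr Gen
  c • s = const c * s

  •-cong : ∀ c {s t} → s ≈ t → c • s ≈ c • t
  •-cong c = *-congˡ

  •-*ˡ : ∀ c s t → (c • s) * t ≈ c • (s * t)
  •-*ˡ c s t = *-assoc (const c) s t

  •-*ʳ : ∀ c s t → s * (c • t) ≈ c • (s * t)
  •-*ʳ c s t = begin
    s * (const c * t) ≈⟨ *-assoc s (const c) t ⟨
    s * const c * t   ≈⟨ *-congʳ (central c s) ⟨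
    const c * s * t   ≈⟨ *-assoc (const c) s t ⟩
    const c * (s * t) ∎

  •-• : ∀ c d s → c • d • s ≈ (c R.* d) • s
  •-• c d s = ≈-trans (≈-sym (*-assoc _ _ s)) (*-congʳ (≈-sym (const-* c d)))

  •-+ : ∀ c s t → c • (s + t) ≈ c • s + c • t
  •-+ c = distribˡ (const c)

  +-• : ∀ c d s → (c R.+ d) • s ≈ c • s + d • s
  +-• c d s = ≈-trans (*-congʳ (const-+ c d)) (distribʳ s _ _)

  •-congʳ : ∀ {c d} s → c R.≈ d → c • s ≈ d • s
  •-congʳ s p = *-congʳ (const-cong p)

  0-• : ∀ s → R.0# • s ≈ const R.0#
  0-• = zeroˡ

  1-• : ∀ s → R.1# • s ≈ s
  1-• = *-identityˡ

  Commutes : Expr Gen → Expr Gen → Set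
  Commutes s t = s * t ≈ t * s

  commutes-const : ∀ c s → Commutes s (const c)
  commutes-const c s = ≈-sym (central c s)

  commutes-* : ∀ {s t u} → Commutes s t → Commutes s u → Commutes s (t * u)
  commutes-* {s} {t} {u} p q = begin
    s * (t * u) ≈⟨ *-assoc s t u ⟨
    s * t * u   ≈⟨ *-congʳ p ⟩
    t * s * u   ≈⟨ *-assoc t s u ⟩
    t * (s * u) ≈⟨ *-congˡ q ⟩
    t * (u * s) ≈⟨ *-assoc t u s ⟨
    t * u * s   ∎

  commutes-+ : ∀ {s t u} → Commutes s t → Commutes s u → Commutes s (t + u)
  commutes-+ {s} {t} {u} p q = begin
    s * (t + u)   ≈⟨ distribˡ s t u ⟩
    s * t + s * u ≈⟨ +-cong p q ⟩
    t * s + u * s ≈⟨ distribʳ s t u ⟨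
    (t + u) * s   ∎

  commutes-neg : ∀ {s t} → Commutes s t → Commutes s (- t)
  commutes-neg {s} {t} p = begin
    s * - t   ≈⟨ -‿distribʳ-* s t ⟨
    - (s * t) ≈⟨ -‿cong p ⟩
    - (t * s) ≈⟨ -‿distribˡ-* t s ⟩
    - t * s   ∎
    where open import Algebra.Properties.Ring ring using (-‿distribʳ-*; -‿distribˡ-*)

  commutes-∑ : ∀ {A : Set} {s} (xs : List A) {F} → (∀ x → Commutes s (F x)) →
               Commutes s (∑[ xs ] F)
  commutes-∑ []       p = commutes-const R.0# _
  commutes-∑ (x ∷ xs) p = commutes-+ (p x) (commutes-∑ xs p)

  commutes-∏ : ∀ {s ts} → All (Commutes s) ts → Commutes s (∏ ts)
  commutes-∏ []       = commutes-const R.1# _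
  commutes-∏ (p ∷ ps) = commutes-* p (commutes-∏ ps)

  *-interchange : ∀ {s t u v} → Commutes t u → (s * t) * (u * v) ≈ (s * u) * (t * v)
  *-interchange {s} {t} {u} {v} p = begin
    s * t * (u * v)   ≈⟨ *-assoc s t (u * v) ⟩
    s * (t * (u * v)) ≈⟨ *-congˡ (*-assoc t u v) ⟨
    s * (t * u * v)   ≈⟨ *-congˡ (*-congʳ p) ⟩
    s * (u * t * v)   ≈⟨ *-congˡ (*-assoc u t v) ⟩
    s * (u * (t * v)) ≈⟨ *-assoc s u (t * v) ⟨
    s * u * (t * v)   ∎

  ∑-*ˡ : ∀ {A : Set} s (xs : List A) F → s * ∑[ xs ] F ≈ ∑[ xs ] (λ x → s * F x)
  ∑-*ˡ s []       F = zeroʳ s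
  ∑-*ˡ s (x ∷ xs) F = ≈-trans (distribˡ s _ _) (+-congˡ (∑-*ˡ s xs F))

  ∑-*ʳ : ∀ {A : Set} s (xs : List A) F → ∑[ xs ] F * s ≈ ∑[ xs ] (λ x → F x * s)
  ∑-*ʳ s []       F = zeroˡ s
  ∑-*ʳ s (x ∷ xs) F = ≈-trans (distribʳ s _ _) (+-congˡ (∑-*ʳ s xs F))

  ∑-*-∑ : ∀ {A A′ : Set} (xs : List A) (ys : List A′) F G →
          ∑[ xs ] F * ∑[ ys ] G ≈ ∑[ xs ] (λ x → ∑[ ys ] (λ y → F x * G y))
  ∑-*-∑ xs ys F G = ≈-trans (∑-*ʳ _ xs F) (∑-cong xs λ x → ∑-*ˡ (F x) ys G)

  ∏-cong : ∀ {n} {F G : Fin n → Expr Gen} → (∀ i → F i ≈ G i) → ∏ (tabulate F) ≈ ∏ (tabulate G)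
  ∏-cong {zero}  p = ≈-refl
  ∏-cong {suc n} p = *-cong (p zero) (∏-cong (p ∘ suc))

  ∏-++ : ∀ ss ts → ∏ (ss ++ ts) ≈ ∏ ss * ∏ ts
  ∏-++ []       ts = ≈-sym (*-identityˡ _)
  ∏-++ (s ∷ ss) ts = ≈-trans (*-congˡ (∏-++ ss ts)) (≈-sym (*-assoc s _ _))

  ∏-∑ : ∀ {A : Set} {n} (c : Fin n → List A) (F : Fin n → A → Expr Gen) →
        ∏ (tabulate λ i → ∑[ c i ] (F i)) ≈ ∑[ choices c ] (λ u → ∏ (tabulate λ i → F i (u i)))
  ∏-∑ {n = zero}  c F = ≈-sym (+-identityʳ _)
  ∏-∑ {n = suc n} c F = begin
    ∑[ c zero ] (F zero) * ∏ (tabulate λ i → ∑[ c (suc i) ] (F (suc i)))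
      ≈⟨ *-congˡ (∏-∑ (c ∘ suc) (F ∘ suc)) ⟩
    ∑[ c zero ] (F zero) * ∑[ choices (c ∘ suc) ] (λ u → ∏ (tabulate λ i → F (suc i) (u i)))
      ≈⟨ ∑-*-∑ (c zero) (choices (c ∘ suc)) (F zero) _ ⟩
    ∑[ c zero ] (λ x → ∑[ choices (c ∘ suc) ] (λ u →
      F zero x * ∏ (tabulate λ i → F (suc i) (u i))))
      ≈⟨ ∑-cartesian Vector._∷_ (c zero) (choices (c ∘ suc))
           (λ u → ∏ (tabulate λ i → F i (u i))) ⟨
    ∑[ choices c ] (λ u → ∏ (tabulate λ i → F i (u i))) ∎

  ∏-* : ∀ {n} (F G : Fin n → Expr Gen) → (∀ i j → Commutes (G i) (F j)) →
        ∏ (tabulate λ i → F i * G i) ≈ ∏ (tabulate F) * ∏ (tabulate G)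
  ∏-* {zero}  F G p = ≈-sym (*-identityˡ _)
  ∏-* {suc n} F G p = ≈-trans (*-congˡ (∏-* (F ∘ suc) (G ∘ suc) λ i j → p (suc i) (suc j)))
    (*-interchange (commutes-tabulate (F ∘ suc) λ j → p zero (suc j)))
    where
    commutes-tabulate : ∀ {n s} (F : Fin n → Expr Gen) → (∀ j → Commutes s (F j)) →
                        Commutes s (∏ (tabulate F))
    commutes-tabulate {zero}  F p = commutes-const R.1# _
    commutes-tabulate {suc n} F p = commutes-* (p zero) (commutes-tabulate (F ∘ suc) (p ∘ suc))

  -- Carries a relation between two neighbouring factors through an ordered noncommutative product.
  -- It is used with products of entries of B in which two neighbouring rows are exchanged (`F`),
  -- two neighbouring columns (`G`), or nothing (`H`).
  ∏-adjacent : ∀ {n} (i : Fin n) c (F G H : Fin (suc n) → Expr Gen) →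
    (∀ j → j ≢ inject₁ i → j ≢ suc i → F j ≡ G j × F j ≡ H j) →
    F (inject₁ i) * F (suc i) ≈ G (inject₁ i) * G (suc i) + c • (H (inject₁ i) * H (suc i)) →
    ∏ (tabulate F) ≈ ∏ (tabulate G) + c • ∏ (tabulate H)
  ∏-adjacent zero c F G H p q = begin
    F zero * (F (suc zero) * ∏ (tabulate (λ j → F (suc (suc j)))))
      ≈⟨ *-assoc _ _ _ ⟨
    F zero * F (suc zero) * ∏ (tabulate (λ j → F (suc (suc j))))
      ≈⟨ *-congʳ q ⟩
    (G zero * G (suc zero) + c • (H zero * H (suc zero))) * ∏ (tabulate (λ j → F (suc (suc j))))
      ≈⟨ distribʳ _ _ _ ⟩
    G zero * G (suc zero) * ∏ (tabulate (λ j → F (suc (suc j))))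
      + (c • (H zero * H (suc zero))) * ∏ (tabulate (λ j → F (suc (suc j))))
      ≈⟨ +-cong
           (≈-trans (*-assoc _ _ _) (*-congˡ (*-congˡ (∏-cong λ j → ≡⇒≈ (proj₁ (p (suc (suc j)) (λ ()) λ ()))))))
           (≈-trans (•-*ˡ c _ _) (•-cong c (≈-trans (*-assoc _ _ _)
             (*-congˡ (*-congˡ (∏-cong λ j → ≡⇒≈ (proj₂ (p (suc (suc j)) (λ ()) λ ())))))))) ⟩
    ∏ (tabulate G) + c • ∏ (tabulate H) ∎
  ∏-adjacent (suc i) c F G H p q = begin
    F zero * ∏ (tabulate (F ∘ suc))
      ≈⟨ *-congˡ (∏-adjacent i c (F ∘ suc) (G ∘ suc) (H ∘ suc)
           (λ j ne nf → p (suc j) (λ e → ne (Fin.suc-injective e)) (λ e → nf (Fin.suc-injective e))) q) ⟩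
    F zero * (∏ (tabulate (G ∘ suc)) + c • ∏ (tabulate (H ∘ suc)))
      ≈⟨ distribˡ _ _ _ ⟩
    F zero * ∏ (tabulate (G ∘ suc)) + F zero * (c • ∏ (tabulate (H ∘ suc)))
      ≈⟨ +-cong (*-congʳ (≡⇒≈ (proj₁ (p zero (λ ()) λ ()))))
           (≈-trans (•-*ʳ c _ _) (•-cong c (*-congʳ (≡⇒≈ (proj₂ (p zero (λ ()) λ ())))))) ⟩
    ∏ (tabulate G) + c • ∏ (tabulate H) ∎

-- Counting letters, inversions and choice functions.

𝟙 : Bool → ℕ
𝟙 b = if b then 1 else 0

module _ {A : Set} {P : A → Set} (P? : Decidable P) where

  # : List A → ℕ
  # xs = length (filter P? xs)

  #-∷ : ∀ x xs → # (x ∷ xs) ≡ 𝟙 (does (P? x)) ℕ.+ # xs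
  #-∷ x xs with does (P? x)
  ... | true  = refl
  ... | false = refl

  #-++ : ∀ xs ys → # (xs ++ ys) ≡ # xs ℕ.+ # ys
  #-++ xs ys = trans (cong length (List.filter-++ P? xs ys)) (List.length-++ (filter P? xs))

  #-none : ∀ {xs} → All (λ x → ¬ P x) xs → # xs ≡ 0
  #-none ps = cong length (List.filter-none P? ps)

#-map : ∀ {A A′ : Set} {P : A → Set} {Q : A′ → Set} (P? : Decidable P) (Q? : Decidable Q)
        (f : A → A′) → (∀ x → does (Q? (f x)) ≡ does (P? x)) → ∀ xs → # Q? (map f xs) ≡ # P? xs
#-map P? Q? f e []       = refl
#-map P? Q? f e (x ∷ xs) = trans (#-∷ Q? (f x) (map f xs))
  (trans (cong₂ (λ b c → 𝟙 b ℕ.+ c) (e x) (#-map P? Q? f e xs)) (sym (#-∷ P? x xs)))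

#-concat : ∀ {A : Set} {P : A → Set} (P? : Decidable P) {n} (f : Fin n → List A) →
           # P? (concat (tabulate f)) ≡ sum (λ i → # P? (f i))
#-concat P? {zero}  f = refl
#-concat P? {suc n} f = trans (#-++ P? (f zero) (concat (tabulate (f ∘ suc))))
  (cong (# P? (f zero) ℕ.+_) (#-concat P? (f ∘ suc)))

sum-0 : ∀ {n} {f : Fin n → ℕ} → (∀ i → f i ≡ 0) → sum f ≡ 0
sum-0 {zero}  p = refl
sum-0 {suc n} p = cong₂ ℕ._+_ (p zero) (sum-0 (p ∘ suc))

-- The formula of `ℓ` for arbitrary functions: on a permutation it is `ℓ` definitionally. Domain and
-- codomain differ in size so that an induction can drop the first row while keeping the values.
inversions : ∀ {k n} → (Fin k → Fin n) → ℕ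
inversions u = sum λ i → sum λ j → 𝟙 (does (i Fin.<? j) ∧ does (u j Fin.<? u i))

inversions-cong : ∀ {k n} {u v : Fin k → Fin n} → (∀ i → u i ≡ v i) → inversions u ≡ inversions v
inversions-cong e = sum-cong-≗ λ i → sum-cong-≗ λ j →
  cong₂ (λ a b → 𝟙 (does (i Fin.<? j) ∧ does (a Fin.<? b))) (e j) (e i)

sum-indicator : ∀ {n} (h : Fin n) → sum (λ i → 𝟙 (does (h Fin.≟ i))) ≡ 1
sum-indicator {suc n} zero    = cong suc (sum-0 {n} λ _ → refl)
sum-indicator {suc n} (suc h) = sum-indicator h

Surjective : ∀ {k n} → (Fin k → Fin n) → Set
Surjective u = ∀ h → ∃[ i ] u i ≡ h

surjective? : ∀ {k n} (u : Fin k → Fin n) → Dec (Surjective u)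
surjective? u = Fin.all? λ h → Fin.any? λ i → u i Fin.≟ h

-- Pigeonhole: a section g of `u` is injective, and if g (u i) differed from i then g would miss i
-- and embed the finite set into one with fewer elements.
surjective⇒permutation : ∀ {n} (u : Fin n → Fin n) → Surjective u →
                         Σ[ π ∈ Permutation′ n ] ∀ i → π ⟨$⟩ʳ i ≡ u i
surjective⇒permutation {n} u surj = Perm.permutation u g u∘g (g∘u n u g u∘g) , λ _ → refl
  where
  g = proj₁ ∘ surj
  u∘g = proj₂ ∘ surj
  g∘u : ∀ n (u g : Fin n → Fin n) → (∀ h → u (g h) ≡ h) → ∀ i → g (u i) ≡ i
  g∘u (suc n) u g u∘g i with g (u i) Fin.≟ i
  ... | yes e = e
  ... | no ne = contradiction (Fin.injective⇒≤ {f = λ h → Fin.punchOut (avoids h)} λ {h} {h′} e →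
      trans (sym (u∘g h)) (trans (cong u (Fin.punchOut-injective (avoids h) (avoids h′) e)) (u∘g h′)))
      (ℕ.<⇒≱ ℕ.≤-refl)
    where
    avoids : ∀ h → i ≢ g h
    avoids h e = ne (trans (cong g (trans (cong u e) (u∘g h))) (sym e))

choices-All : ∀ {A : Set} {n} {P : Fin n → A → Set} (c : Fin n → List A) →
              (∀ i → All (P i) (c i)) → All (λ u → ∀ i → P i (u i)) (choices c)
choices-All {n = zero}  c p = (λ ()) ∷ []
choices-All {n = suc n} {P} c p = product (c zero) (p zero)
  where
  product : ∀ xs → All (P zero) xs →
    All (λ u → ∀ i → P i (u i)) (cartesianProductWith Vector._∷_ xs (choices (c ∘ suc)))
  product []       []       = []
  product (x ∷ xs) (q ∷ qs) = All.++⁺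
    (All.map⁺ (All.map (λ r → λ { zero → q ; (suc i) → r i }) (choices-All (c ∘ suc) (p ∘ suc))))
    (product xs qs)

choices-unique : ∀ {A : Set} {n} (c : Fin n → List A) → (∀ i → AllPairs _≢_ (c i)) →
                 AllPairs (λ u v → ¬ (∀ i → u i ≡ v i)) (choices c)
choices-unique {n = zero}  c p = [] ∷ []
choices-unique {n = suc n} c p = product (c zero) (p zero)
  where
  product : ∀ xs → AllPairs _≢_ xs →
    AllPairs (λ u v → ¬ (∀ i → u i ≡ v i)) (cartesianProductWith Vector._∷_ xs (choices (c ∘ suc)))
  product []       []       = []
  product (x ∷ xs) (q ∷ qs) = AllPairs.++⁺
    (AllPairs.map⁺ (AllPairs.map (λ ne e → ne (e ∘ suc)) (choices-unique (c ∘ suc) (p ∘ suc))))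
    (product xs qs)
    (All.map⁺ (All.universal (λ u → heads xs q) (choices (c ∘ suc))))
    where
    heads : ∀ {u} ys → All (x ≢_) ys → All (λ v → ¬ (∀ i → (x Vector.∷ u) i ≡ v i))
      (cartesianProductWith Vector._∷_ ys (choices (c ∘ suc)))
    heads []       []       = []
    heads (y ∷ ys) (r ∷ rs) =
      All.++⁺ (All.map⁺ (All.universal (λ v e → r (e zero)) (choices (c ∘ suc)))) (heads ys rs)

choices-complete : ∀ {A : Set} {n} (c : Fin n → List A) (u : Fin n → A) → (∀ i → u i ∈ c i) →
                   Any (λ v → ∀ i → u i ≡ v i) (choices c)
choices-complete {n = zero}  c u p = here λ ()
choices-complete {n = suc n} c u p = Any.cartesianProductWith⁺ Vector._∷_
  (λ e f → λ { zero → e ; (suc i) → f i }) (p zero) (choices-complete (c ∘ suc) (u ∘ suc) (p ∘ suc))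

-- Over an arbitrary commutative ring, so that Laurent polynomials are never unfolded; the
-- hypothesis makes `q⁻½` the inverse of `q½`.
module StarNetworkImmanants (R : CommutativeRing 0ℓ 0ℓ) (q½ q⁻½ : CommutativeRing.Carrier R)
  (q½*q⁻½≈1 : CommutativeRing._≈_ R (CommutativeRing._*_ R q½ q⁻½) (CommutativeRing.1# R)) where

  private module R = CommutativeRing R
  open LinearAlgebra R
  open Quantum R q½ q⁻½
  open import Algebra.Properties.Semiring.Exp R.semiring using (_^_; ^-homo-*)

  d : R.Carrier
  d = q½ R.- q⁻½

  -- Links the coefficient d of the cross relation to the coefficient q - 1 of the quadratic Hecke
  -- relation. It is also what makes the induction for the relations of B close.
  q≈1+q½d : q½ R.* q½ R.≈ R.1# R.+ q½ R.* d
  q≈1+q½d = R.sym (begin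
    R.1# R.+ q½ R.* d
      ≈⟨ R.+-congˡ (R.trans (R.distribˡ q½ q½ (R.- q⁻½)) (R.+-congˡ (R.sym (-‿distribʳ-* q½ q⁻½)))) ⟩
    R.1# R.+ (q½ R.* q½ R.- q½ R.* q⁻½)
      ≈⟨ R.+-congˡ (R.+-congˡ (R.-‿cong q½*q⁻½≈1)) ⟩
    R.1# R.+ (q½ R.* q½ R.- R.1#)
      ≈⟨ R.+-comm _ _ ⟩
    q½ R.* q½ R.- R.1# R.+ R.1#
      ≈⟨ R.+-assoc _ _ _ ⟩
    q½ R.* q½ R.+ (R.- R.1# R.+ R.1#)
      ≈⟨ R.+-congˡ (R.-‿inverseˡ R.1#) ⟩
    q½ R.* q½ R.+ R.0#
      ≈⟨ R.+-identityʳ _ ⟩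
    q½ R.* q½ ∎)
    where
    open import Relation.Binary.Reasoning.Setoid R.setoid
    open import Algebra.Properties.Ring R.ring using (-‿distribʳ-*)

  mapᴱ : ∀ {X Y : Set} → (X → Y) → Expr X → Expr Y
  mapᴱ f (const c) = const c
  mapᴱ f (gen x)   = gen (f x)
  mapᴱ f (s + t)   = mapᴱ f s + mapᴱ f t
  mapᴱ f (s * t)   = mapᴱ f s * mapᴱ f t
  mapᴱ f (- t)     = - mapᴱ f t

  mapᴱ-∏ : ∀ {X Y : Set} (f : X → Y) {n} (F : Fin n → Expr X) →
           mapᴱ f (∏ (tabulate F)) ≡ ∏ (tabulate (mapᴱ f ∘ F))
  mapᴱ-∏ f {zero}  F = refl
  mapᴱ-∏ f {suc n} F = cong (mapᴱ f (F zero) *_) (mapᴱ-∏ f (F ∘ suc))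

  mapᴱ-∑ : ∀ {A X Y : Set} (f : X → Y) xs (F : A → Expr X) →
           mapᴱ f (∑ (map F xs)) ≡ ∑ (map (mapᴱ f ∘ F) xs)
  mapᴱ-∑ f []       F = refl
  mapᴱ-∑ f (x ∷ xs) F = cong (mapᴱ f (F x) +_) (mapᴱ-∑ f xs F)

  -- The quantum matrix relations for the entries of B.

  -- `X-commute` and `X-cross` yield the skein relation for M; `X-row` is what lets them pass
  -- through a star, where several sources share a row up to a factor.
  record QuantumRelations {n} (P : Presentation) (X : Fin n → Fin n → Expr (Presentation.Gen P)) : Set where
    open Algebra P using (_≈_)
    field
      X-row     : ∀ {i k l} → k Fin.< l → X i l * X i k ≈ const q½ * (X i k * X i l)
      X-commute : ∀ {i j k l} → i Fin.< j → k Fin.< l → X j k * X i l ≈ X i l * X j k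
      X-cross   : ∀ {i j k l} → i Fin.< j → k Fin.< l →
                  X j l * X i k ≈ X i k * X j l + const d * (X i l * X j k)

  module FirstFactor {n m} (J : Interval n) (Js : Vec (Interval n) m) where
    open PresentedAlgebra R (Z (J ∷ Js))
    private module Z′ = Algebra (Z Js)
    open Indeterminate

    shiftᴱ : Expr (Indeterminate Js) → Expr (Indeterminate (J ∷ Js))
    shiftᴱ = mapᴱ shift

    shiftᴱ-cong : ∀ {s t} → s Z′.≈ t → shiftᴱ s ≈ shiftᴱ t
    shiftᴱ-cong (Z′.rel (commute (inj₁ ne))) = rel (commute (inj₁ (ne ∘ Fin.suc-injective)))
    shiftᴱ-cong (Z′.rel (commute (inj₂ ne))) = rel (commute (inj₂ ne))
    shiftᴱ-cong (Z′.rel (q-commute e f l))   = rel (q-commute (cong suc e) f l)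
    shiftᴱ-cong Z′.≈-refl            = ≈-refl
    shiftᴱ-cong (Z′.≈-sym p)         = ≈-sym (shiftᴱ-cong p)
    shiftᴱ-cong (Z′.≈-trans p q)     = ≈-trans (shiftᴱ-cong p) (shiftᴱ-cong q)
    shiftᴱ-cong (Z′.+-cong p q)      = +-cong (shiftᴱ-cong p) (shiftᴱ-cong q)
    shiftᴱ-cong (Z′.*-cong p q)      = *-cong (shiftᴱ-cong p) (shiftᴱ-cong q)
    shiftᴱ-cong (Z′.-‿cong p)        = -‿cong (shiftᴱ-cong p)
    shiftᴱ-cong (Z′.+-assoc s t u)   = +-assoc _ _ _
    shiftᴱ-cong (Z′.+-comm s t)      = +-comm _ _
    shiftᴱ-cong (Z′.+-identityˡ s)   = +-identityˡ _
    shiftᴱ-cong (Z′.-‿inverseˡ s)    = -‿inverseˡ _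
    shiftᴱ-cong (Z′.*-assoc s t u)   = *-assoc _ _ _
    shiftᴱ-cong (Z′.*-identityˡ s)   = *-identityˡ _
    shiftᴱ-cong (Z′.distribˡ s t u)  = distribˡ _ _ _
    shiftᴱ-cong (Z′.distribʳ s t u)  = distribʳ _ _ _
    shiftᴱ-cong (Z′.const-cong p)    = const-cong p
    shiftᴱ-cong (Z′.const-+ c e)     = const-+ c e
    shiftᴱ-cong (Z′.const-* c e)     = const-* c e
    shiftᴱ-cong (Z′.central c s)     = central c _

    weight-rest : ∀ {u v} (π : Star Edge u v) →
                  weight (J ∷ Js) (gmap rest rest π) ≡ shiftᴱ (weight Js π)
    weight-rest ε       = refl
    weight-rest (e ◅ π) = cong₂ _*_ (step (label e)) (weight-rest π)
      where
      step : ∀ x → maybe′ gen (const R.1#) (Maybe.map shift x) ≡ shiftᴱ (maybe′ gen (const R.1#) x)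
      step (just x) = refl
      step nothing  = refl

    Crosses : Fin n → Set
    Crosses h = Nondegenerate J × h ∈ᴵ J

    crosses? : Decidable Crosses
    crosses? h = nondegenerate? J ×-dec h ∈ᴵ? J

    -- A word of at most one letter, empty where the edge is straight. Keeping words rather than
    -- expressions lets the letters of a product be collected and counted.
    port : Fin 2 → Fin n → List (Indeterminate (J ∷ Js))
    port k h with crosses? h
    ... | yes (l , h∈) = [ ζ h zero k {l} {h∈} ]
    ... | no  _        = []

    -- The sources of the remaining factors that a path entering at source i can reach.
    exits : Fin n → List (Fin n)
    exits i with crosses? i
    ... | yes _ = filter (_∈ᴵ? J) (allFin n)
    ... | no  _ = [ i ]

    portᴱ : Fin 2 → Fin n → Expr (Indeterminate (J ∷ Js))
    portᴱ k h = ∏ (map gen (port k h))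

    port-yes : ∀ k h (l : Nondegenerate J) (h∈ : h ∈ᴵ J) → port k h ≡ [ ζ h zero k {l} {h∈} ]
    port-yes k h l h∈ with crosses? h
    ... | yes _ = refl
    ... | no ¬c = contradiction (l , h∈) ¬c

    port-no : ∀ k h → ¬ Crosses h → port k h ≡ []
    port-no k h ¬c with crosses? h
    ... | yes c = contradiction c ¬c
    ... | no _  = refl

    exits-yes : ∀ i → Crosses i → exits i ≡ filter (_∈ᴵ? J) (allFin n)
    exits-yes i c with crosses? i
    ... | yes _ = refl
    ... | no ¬c = contradiction c ¬c

    exits-no : ∀ i → ¬ Crosses i → exits i ≡ [ i ]
    exits-no i ¬c with crosses? i
    ... | yes c = contradiction c ¬c
    ... | no _  = refl

    through-yes : ∀ {i j : Fin n} (l : Nondegenerate J) (i∈ : i ∈ᴵ J) (πs : ∀ h → List (Path Js h j)) h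
      (h∈ : h ∈ᴵ J) → through {J = J} l i∈ πs h ≡ map (traverse l i∈ h∈) (πs h)
    through-yes l i∈ πs h h∈ with h ∈ᴵ? J
    ... | yes _ = refl
    ... | no h∉ = contradiction h∈ h∉

    through-no : ∀ {i j : Fin n} (l : Nondegenerate J) (i∈ : i ∈ᴵ J) (πs : ∀ h → List (Path Js h j)) h →
      ¬ h ∈ᴵ J → through {J = J} l i∈ πs h ≡ []
    through-no l i∈ πs h h∉ with h ∈ᴵ? J
    ... | yes h∈ = contradiction h∈ h∉
    ... | no _   = refl

    -- Sorting paths by their exit from the first factor. One formula serves both kinds of source:
    -- for a straight edge the ports are empty, hence equal to 1, and i is the only exit.
    B-∷ : ∀ i j → B (J ∷ Js) i j
      ≈ portᴱ 0F i * ∑[ exits i ] (λ h → portᴱ 1F h * shiftᴱ (B Js h j))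
    B-∷ i j with nondegenerate? J ×-dec i ∈ᴵ? J
    ... | no ¬c = begin
      ∑ (map (weight (J ∷ Js)) (map (bypass ¬c) (paths Js i j)))
        ≡⟨ ∑-map (bypass ¬c) (paths Js i j) (weight (J ∷ Js)) ⟩
      ∑[ paths Js i j ] (weight (J ∷ Js) ∘ bypass ¬c)
        ≈⟨ ∑-cong (paths Js i j) (λ π →
             ≈-trans (*-identityˡ _) (≡⇒≈ (weight-rest π))) ⟩
      ∑[ paths Js i j ] (shiftᴱ ∘ weight Js)
        ≡⟨ mapᴱ-∑ shift (paths Js i j) (weight Js) ⟨
      shiftᴱ (B Js i j)
        ≈⟨ *-identityˡ _ ⟨
      const R.1# * shiftᴱ (B Js i j)
        ≡⟨ cong (λ w → ∏ (map gen w) * shiftᴱ (B Js i j)) (port-no 1F i ¬c) ⟨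
      portᴱ 1F i * shiftᴱ (B Js i j)
        ≈⟨ ≈-trans (*-identityˡ _) (+-identityʳ _) ⟨
      const R.1# * (portᴱ 1F i * shiftᴱ (B Js i j) + const R.0#) ∎
    ... | yes (l , i∈) = begin
      ∑ (map (weight (J ∷ Js)) (concatMap (through {J = J} l i∈ λ h → paths Js h j) (allFin n)))
        ≈⟨ ∑-concatMap (through {J = J} l i∈ λ h → paths Js h j) (allFin n) (weight (J ∷ Js)) ⟩
      ∑[ allFin n ] (λ h → ∑[ through {J = J} l i∈ (λ h → paths Js h j) h ] (weight (J ∷ Js)))
        ≈⟨ ∑-cong (allFin n) exit ⟩
      ∑[ allFin n ] (λ h → enterᴱ * (if does (h ∈ᴵ? J) then F h else const R.0#))
        ≈⟨ ∑-*ˡ enterᴱ (allFin n) _ ⟨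
      enterᴱ * ∑[ allFin n ] (λ h → if does (h ∈ᴵ? J) then F h else const R.0#)
        ≈⟨ *-cong (≈-sym (*-identityʳ _)) (≈-sym (∑-filter-if (_∈ᴵ? J) (allFin n) F)) ⟩
      (enterᴱ * const R.1#) * ∑[ filter (_∈ᴵ? J) (allFin n) ] F ∎
      where
      enterᴱ = gen (ζ i zero 0F {l} {i∈})
      F : Fin n → Expr (Indeterminate (J ∷ Js))
      F h = portᴱ 1F h * shiftᴱ (B Js h j)
      exit : ∀ h → ∑[ through {J = J} l i∈ (λ h → paths Js h j) h ] (weight (J ∷ Js))
        ≈ enterᴱ * (if does (h ∈ᴵ? J) then F h else const R.0#)
      exit h = cases (h ∈ᴵ? J)
        where
        cases : Dec (h ∈ᴵ J) → ∑[ through {J = J} l i∈ (λ h → paths Js h j) h ] (weight (J ∷ Js))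
          ≈ enterᴱ * (if does (h ∈ᴵ? J) then F h else const R.0#)
        cases (no h∉) = begin
          ∑[ through {J = J} l i∈ (λ h → paths Js h j) h ] (weight (J ∷ Js))
            ≡⟨ cong (λ πs → ∑[ πs ] (weight (J ∷ Js)))
                 (through-no l i∈ (λ h → paths Js h j) h h∉) ⟩
          const R.0#
            ≈⟨ zeroʳ enterᴱ ⟨
          enterᴱ * const R.0#
            ≡⟨ cong (λ b → enterᴱ * (if b then F h else const R.0#))
                 (Dec.dec-false (h ∈ᴵ? J) h∉) ⟨
          enterᴱ * (if does (h ∈ᴵ? J) then F h else const R.0#) ∎
        cases (yes h∈) = begin
          ∑[ through {J = J} l i∈ (λ h → paths Js h j) h ] (weight (J ∷ Js))
            ≡⟨ cong (λ πs → ∑[ πs ] (weight (J ∷ Js)))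
                 (through-yes l i∈ (λ h → paths Js h j) h h∈) ⟩
          ∑[ map (traverse l i∈ h∈) (paths Js h j) ] (weight (J ∷ Js))
            ≡⟨ ∑-map (traverse l i∈ h∈) (paths Js h j) (weight (J ∷ Js)) ⟩
          ∑[ paths Js h j ] (λ π → enterᴱ * (leaveᴱ * weight (J ∷ Js) (gmap rest rest π)))
            ≈⟨ ∑-*ˡ enterᴱ (paths Js h j) _ ⟨
          enterᴱ * ∑[ paths Js h j ] (λ π → leaveᴱ * weight (J ∷ Js) (gmap rest rest π))
            ≈⟨ *-congˡ (∑-*ˡ leaveᴱ (paths Js h j) _) ⟨
          enterᴱ * (leaveᴱ * ∑[ paths Js h j ] (λ π → weight (J ∷ Js) (gmap rest rest π)))
            ≈⟨ *-congˡ (*-cong (≈-sym (*-identityʳ _)) (≈-trans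
                 (∑-cong (paths Js h j) λ π → ≡⇒≈ (weight-rest π))
                 (≡⇒≈ (sym (mapᴱ-∑ shift (paths Js h j) (weight Js)))))) ⟩
          enterᴱ * (∏ (map gen [ ζ h zero 1F {l} {h∈} ]) * shiftᴱ (B Js h j))
            ≡⟨ cong (λ w → enterᴱ * (∏ (map gen w) * shiftᴱ (B Js h j))) (port-yes 1F h l h∈) ⟨
          enterᴱ * F h
            ≡⟨ cong (λ b → enterᴱ * (if b then F h else const R.0#))
                 (Dec.dec-true (h ∈ᴵ? J) h∈) ⟨
          enterᴱ * (if does (h ∈ᴵ? J) then F h else const R.0#) ∎
          where leaveᴱ = gen (ζ h zero 1F {l} {h∈})

  module FirstFactorRelations {n m} (J : Interval n) (Js : Vec (Interval n) m) where
    open FirstFactor J Js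
    open PresentedAlgebra R (Z (J ∷ Js))
    private module Z′ = Algebra (Z Js)
    open Indeterminate

    port-coordinates : ∀ k₀ h₀ → All (λ x → p x ≡ zero × k x ≡ k₀ × h x ≡ h₀) (port k₀ h₀)
    port-coordinates k₀ h₀ with crosses? h₀
    ... | yes _ = (refl , refl , refl) ∷ []
    ... | no  _ = []

    gen-shiftᴱ : ∀ x t → p x ≡ zero → Commutes (gen x) (shiftᴱ t)
    gen-shiftᴱ x (const c) e = commutes-const c _
    gen-shiftᴱ x (gen y)   e = rel (commute (inj₁ λ f → Fin.0≢1+n (trans (sym e) f)))
    gen-shiftᴱ x (s + t)   e = commutes-+ (gen-shiftᴱ x s e) (gen-shiftᴱ x t e)
    gen-shiftᴱ x (s * t)   e = commutes-* (gen-shiftᴱ x s e) (gen-shiftᴱ x t e)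
    gen-shiftᴱ x (- t)     e = commutes-neg (gen-shiftᴱ x t e)

    port-shiftᴱ : ∀ k h t → Commutes (shiftᴱ t) (portᴱ k h)
    port-shiftᴱ k h t = commutes-∏
      (All.map⁺ (All.map (λ {x} (e , _) → ≈-sym (gen-shiftᴱ x t e)) (port-coordinates k h)))

    port-port : ∀ {k k′} h h′ → k ≢ k′ → Commutes (portᴱ k h) (portᴱ k′ h′)
    port-port {k₀} {k₁} h h′ ne = commutes-∏ (All.map⁺ (All.map
      (λ (_ , e′ , _) → ≈-sym (commutes-∏ (All.map⁺ (All.map
        (λ (_ , e , _) → rel (commute (inj₂ λ f → ne (trans (sym e) (trans (sym f) e′)))))
        (port-coordinates k₀ h)))))
      (port-coordinates k₁ h′)))

    Scales : R.Carrier → Fin 2 → Fin n → Fin n → Set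
    Scales c k h g = portᴱ k g * portᴱ k h ≈ c • (portᴱ k h * portᴱ k g)

    scales-crossing : ∀ k {h g} → h Fin.< g → Crosses h → Crosses g → Scales q½ k h g
    scales-crossing k {h} {g} h<g (l , h∈) (_ , g∈)
      rewrite port-yes k h l h∈ | port-yes k g l g∈ = begin
        (gen y * const R.1#) * (gen x * const R.1#)
          ≈⟨ *-cong (*-identityʳ _) (*-identityʳ _) ⟩
        gen y * gen x
          ≈⟨ rel (q-commute refl refl h<g) ⟩
        q½ • (gen x * gen y)
          ≈⟨ •-cong q½ (*-cong (*-identityʳ _) (*-identityʳ _)) ⟨
        q½ • ((gen x * const R.1#) * (gen y * const R.1#)) ∎
      where
      x = ζ h zero k {l} {h∈}
      y = ζ g zero k {l} {g∈}

    scales-bypassing : ∀ k {h g} → ¬ Crosses h ⊎ ¬ Crosses g → Scales R.1# k h g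
    scales-bypassing k {h} {g} (inj₁ ¬c) rewrite port-no k h ¬c =
      ≈-sym (≈-trans (1-• _) (central R.1# _))
    scales-bypassing k {h} {g} (inj₂ ¬c) rewrite port-no k g ¬c =
      ≈-sym (≈-trans (1-• _) (≈-sym (central R.1# _)))

    -- Two rows either share their exits, or the exits of the upper one lie above those of
    -- the lower one.
    data RowPair (i j : Fin n) : Set where
      together : ∀ {hs} → exits i ≡ hs → exits j ≡ hs →
                 AllPairs (λ h g → h Fin.< g × Scales q½ 1F h g) hs →
                 Scales q½ 0F i j → RowPair i j
      apart    : All (λ h → All (λ g → h Fin.< g × Scales R.1# 1F h g) (exits j)) (exits i) →
                 Scales R.1# 0F i j → RowPair i j

    interior : List (Fin n)
    interior = filter (_∈ᴵ? J) (allFin n)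

    ∈-interior : All (_∈ᴵ J) interior
    ∈-interior = All.all-filter (_∈ᴵ? J) (allFin n)

    interior-sorted : AllPairs Fin._<_ interior
    interior-sorted = AllPairs.filter⁺ (_∈ᴵ? J) (AllPairs.tabulate⁺-< λ l → l)

    interior-scales : Nondegenerate J → AllPairs (λ h g → h Fin.< g × Scales q½ 1F h g) interior
    interior-scales l = zip interior-sorted ∈-interior
      where
      zip : ∀ {hs} → AllPairs Fin._<_ hs → All (_∈ᴵ J) hs →
            AllPairs (λ h g → h Fin.< g × Scales q½ 1F h g) hs
      zip []       []        = []
      zip (o ∷ os) (h∈ ∷ is) = All.zipWith (λ (h<g , g∈) →
        h<g , scales-crossing 1F h<g (l , h∈) (l , g∈)) (o , is) ∷ zip os is

    exits-scales : ∀ i → AllPairs (λ h g → h Fin.< g × Scales q½ 1F h g) (exits i)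
    exits-scales i = cases (crosses? i)
      where
      cases : Dec (Crosses i) → AllPairs (λ h g → h Fin.< g × Scales q½ 1F h g) (exits i)
      cases (yes c) = ≡.subst (AllPairs _) (sym (exits-yes i c)) (interior-scales (proj₁ c))
      cases (no ¬c) = ≡.subst (AllPairs _) (sym (exits-no i ¬c)) ([] ∷ [])

    -- J is an interval, so a source off the star lies entirely below or entirely above the sources
    -- that cross it.
    rowPair : ∀ {i j} → i Fin.< j → RowPair i j
    rowPair {i} {j} i<j = cases (crosses? i) (crosses? j)
      where
      cases : Dec (Crosses i) → Dec (Crosses j) → RowPair i j
      cases (yes c) (yes c′) = together (exits-yes i c) (exits-yes j c′) (interior-scales (proj₁ c))
        (scales-crossing 0F i<j c c′)
      cases (yes c@(l , i∈)) (no ¬c) = apart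
        (≡.subst₂ (λ gs hs → All (λ h → All (λ g → h Fin.< g × Scales R.1# 1F h g) gs) hs)
          (sym (exits-no j ¬c)) (sym (exits-yes i c))
          (All.map (λ h∈ → (ℕ.≤-<-trans (proj₂ h∈) hi<j , scales-bypassing 1F (inj₂ ¬c)) ∷ []) ∈-interior))
        (scales-bypassing 0F (inj₂ ¬c))
        where
        hi<j : hi J Fin.< j
        hi<j = ℕ.≰⇒> λ j≤hi → ¬c (l , ℕ.≤-trans (proj₁ i∈) (ℕ.<⇒≤ i<j) , j≤hi)
      cases (no ¬c) (yes c@(l , j∈)) = apart
        (≡.subst₂ (λ gs hs → All (λ h → All (λ g → h Fin.< g × Scales R.1# 1F h g) gs) hs)
          (sym (exits-yes j c)) (sym (exits-no i ¬c))
          (All.map (λ g∈ → ℕ.<-≤-trans i<lo (proj₁ g∈) , scales-bypassing 1F (inj₁ ¬c)) ∈-interior ∷ []))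
        (scales-bypassing 0F (inj₁ ¬c))
        where
        i<lo : i Fin.< lo J
        i<lo = ℕ.≰⇒> λ lo≤i → ¬c (l , lo≤i , ℕ.≤-trans (ℕ.<⇒≤ i<j) (proj₂ j∈))
      cases (no ¬c) (no ¬c′) = apart
        (≡.subst₂ (λ gs hs → All (λ h → All (λ g → h Fin.< g × Scales R.1# 1F h g) gs) hs)
          (sym (exits-no j ¬c′)) (sym (exits-no i ¬c))
          (((i<j , scales-bypassing 1F (inj₁ ¬c)) ∷ []) ∷ []))
        (scales-bypassing 0F (inj₁ ¬c))

    module _ (rels : QuantumRelations (Z Js) (B Js)) where
      open QuantumRelations rels

      E : Fin n → Fin n → Expr (Indeterminate (J ∷ Js))
      E h k = portᴱ 1F h * shiftᴱ (B Js h k)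

      -- The row common to all sources with exits `hs`: row i of the matrix is `portᴱ 0F i` times
      -- `D (exits i)`.
      D : List (Fin n) → Fin n → Expr (Indeterminate (J ∷ Js))
      D hs k = ∑[ hs ] (λ h → E h k)

      E-*-E : ∀ h k g l →
        E h k * E g l ≈ (portᴱ 1F h * portᴱ 1F g) * (shiftᴱ (B Js h k) * shiftᴱ (B Js g l))
      E-*-E h k g l = *-interchange (port-shiftᴱ 1F g (B Js h k))

      E-row : ∀ h {k l} → k Fin.< l → E h l * E h k ≈ q½ • (E h k * E h l)
      E-row h {k} {l} k<l = begin
        E h l * E h k
          ≈⟨ E-*-E h l h k ⟩
        (portᴱ 1F h * portᴱ 1F h) * (shiftᴱ (B Js h l) * shiftᴱ (B Js h k))
          ≈⟨ *-congˡ (shiftᴱ-cong (X-row k<l)) ⟩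
        (portᴱ 1F h * portᴱ 1F h) * (q½ • (shiftᴱ (B Js h k) * shiftᴱ (B Js h l)))
          ≈⟨ •-*ʳ q½ _ _ ⟩
        q½ • ((portᴱ 1F h * portᴱ 1F h) * (shiftᴱ (B Js h k) * shiftᴱ (B Js h l)))
          ≈⟨ •-cong q½ (E-*-E h k h l) ⟨
        q½ • (E h k * E h l) ∎

      E-commute : ∀ {c h g k l} → h Fin.< g → k Fin.< l → Scales c 1F h g →
                  E g k * E h l ≈ c • (E h l * E g k)
      E-commute {c} {h} {g} {k} {l} h<g k<l sc = begin
        E g k * E h l
          ≈⟨ E-*-E g k h l ⟩
        (portᴱ 1F g * portᴱ 1F h) * (shiftᴱ (B Js g k) * shiftᴱ (B Js h l))
          ≈⟨ *-cong sc (shiftᴱ-cong (X-commute h<g k<l)) ⟩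
        (c • (portᴱ 1F h * portᴱ 1F g)) * (shiftᴱ (B Js h l) * shiftᴱ (B Js g k))
          ≈⟨ •-*ˡ c _ _ ⟩
        c • ((portᴱ 1F h * portᴱ 1F g) * (shiftᴱ (B Js h l) * shiftᴱ (B Js g k)))
          ≈⟨ •-cong c (E-*-E h l g k) ⟨
        c • (E h l * E g k) ∎

      E-cross : ∀ {c h g k l} → h Fin.< g → k Fin.< l → Scales c 1F h g →
                E g l * E h k ≈ c • (E h k * E g l + d • (E h l * E g k))
      E-cross {c} {h} {g} {k} {l} h<g k<l sc = begin
        E g l * E h k
          ≈⟨ E-*-E g l h k ⟩
        (portᴱ 1F g * portᴱ 1F h) * (shiftᴱ (B Js g l) * shiftᴱ (B Js h k))
          ≈⟨ *-cong sc (shiftᴱ-cong (X-cross h<g k<l)) ⟩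
        (c • bb) * (shiftᴱ (B Js h k) * shiftᴱ (B Js g l) + d • (shiftᴱ (B Js h l) * shiftᴱ (B Js g k)))
          ≈⟨ •-*ˡ c _ _ ⟩
        c • (bb * (shiftᴱ (B Js h k) * shiftᴱ (B Js g l) + d • (shiftᴱ (B Js h l) * shiftᴱ (B Js g k))))
          ≈⟨ •-cong c (≈-trans (distribˡ bb _ _) (+-cong (≈-sym (E-*-E h k g l))
               (≈-trans (•-*ʳ d bb _) (•-cong d (≈-sym (E-*-E h l g k)))))) ⟩
        c • (E h k * E g l + d • (E h l * E g k)) ∎
        where bb = portᴱ 1F h * portᴱ 1F g

      -- Neither product q-commutes alone, but the sum over both assignments of the exits h < g to
      -- the two columns does: the cross relation contributes q½ v + q½ d u, the term u completes
      -- the coefficient of u to q, and q½ u is `E g k * E h l`.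
      E-symmetric : ∀ {h g k l} → h Fin.< g → k Fin.< l → Scales q½ 1F h g →
        E h l * E g k + E g l * E h k ≈ q½ • (E h k * E g l + E g k * E h l)
      E-symmetric {h} {g} {k} {l} h<g k<l sc = begin
        u + E g l * E h k
          ≈⟨ +-congˡ (≈-trans (E-cross h<g k<l sc) (•-+ q½ v (d • u))) ⟩
        u + (q½ • v + q½ • d • u)
          ≈⟨ +-congˡ (+-comm _ _) ⟩
        u + (q½ • d • u + q½ • v)
          ≈⟨ +-assoc _ _ _ ⟨
        u + q½ • d • u + q½ • v
          ≈⟨ +-cong (+-cong (≈-sym (1-• u)) (•-• q½ d u)) ≈-refl ⟩
        R.1# • u + (q½ R.* d) • u + q½ • v
          ≈⟨ +-cong (≈-trans (≈-sym (+-• R.1# _ u)) (•-congʳ u (R.sym q≈1+q½d))) ≈-refl ⟩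
        (q½ R.* q½) • u + q½ • v
          ≈⟨ +-cong (≈-sym (•-• q½ q½ u)) ≈-refl ⟩
        q½ • q½ • u + q½ • v
          ≈⟨ +-cong (•-cong q½ (≈-sym (E-commute h<g k<l sc))) ≈-refl ⟩
        q½ • (E g k * E h l) + q½ • v
          ≈⟨ +-comm _ _ ⟩
        q½ • v + q½ • (E g k * E h l)
          ≈⟨ •-+ q½ _ _ ⟨
        q½ • (v + E g k * E h l) ∎
        where
        u = E h l * E g k
        v = E h k * E g l

      -- In the expansion over pairs of exits, equal exits are governed by `E-row`, and each
      -- unordered pair of distinct exits by `E-symmetric`.
      D-row : ∀ {k l} → k Fin.< l → ∀ {hs} → AllPairs (λ h g → h Fin.< g × Scales q½ 1F h g) hs →
              D hs l * D hs k ≈ q½ • (D hs k * D hs l)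
      D-row k<l [] = ≈-trans (zeroˡ _) (≈-sym (≈-trans (•-cong q½ (zeroˡ _)) (zeroʳ _)))
      D-row {k} {l} k<l {h ∷ hs} (ps ∷ pss) = begin
        (E h l + D hs l) * (E h k + D hs k)
          ≈⟨ expand (E h l) (D hs l) (E h k) (D hs k) ⟩
        (E h l * E h k + (E h l * D hs k + D hs l * E h k)) + D hs l * D hs k
          ≈⟨ +-cong (+-cong (E-row h k<l) mixed) (D-row k<l pss) ⟩
        (q½ • (E h k * E h l) + q½ • (E h k * D hs l + D hs k * E h l)) + q½ • (D hs k * D hs l)
          ≈⟨ +-cong (≈-sym (•-+ q½ _ _)) ≈-refl ⟩
        q½ • (E h k * E h l + (E h k * D hs l + D hs k * E h l)) + q½ • (D hs k * D hs l)
          ≈⟨ •-+ q½ _ _ ⟨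
        q½ • ((E h k * E h l + (E h k * D hs l + D hs k * E h l)) + D hs k * D hs l)
          ≈⟨ •-cong q½ (expand (E h k) (D hs k) (E h l) (D hs l)) ⟨
        q½ • ((E h k + D hs k) * (E h l + D hs l)) ∎
        where
        expand : ∀ a b s t → (a + b) * (s + t) ≈ (a * s + (a * t + b * s)) + b * t
        expand a b s t = begin
          (a + b) * (s + t)                   ≈⟨ distribʳ _ a b ⟩
          a * (s + t) + b * (s + t)           ≈⟨ +-cong (distribˡ a s t) (distribˡ b s t) ⟩
          (a * s + a * t) + (b * s + b * t)   ≈⟨ +-assoc _ _ _ ⟨
          (a * s + a * t) + b * s + b * t     ≈⟨ +-cong (+-assoc _ _ _) ≈-refl ⟩
          (a * s + (a * t + b * s)) + b * t   ∎
        both : ∀ k l → E h l * D hs k + D hs l * E h k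
          ≈ ∑[ hs ] (λ g → E h l * E g k + E g l * E h k)
        both k l = ≈-trans (+-cong (∑-*ˡ (E h l) hs _) (∑-*ʳ (E h k) hs _)) (≈-sym (∑-+ hs _ _))
        mixed : E h l * D hs k + D hs l * E h k ≈ q½ • (E h k * D hs l + D hs k * E h l)
        mixed = begin
          E h l * D hs k + D hs l * E h k
            ≈⟨ both k l ⟩
          ∑[ hs ] (λ g → E h l * E g k + E g l * E h k)
            ≈⟨ ∑-cong-All (All.map (λ (h<g , sc) → E-symmetric h<g k<l sc) ps) ⟩
          ∑[ hs ] (λ g → q½ • (E h k * E g l + E g k * E h l))
            ≈⟨ ∑-*ˡ (const q½) hs _ ⟨
          q½ • ∑[ hs ] (λ g → E h k * E g l + E g k * E h l)
            ≈⟨ •-cong q½ (both l k) ⟨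
          q½ • (E h k * D hs l + D hs k * E h l) ∎

      D-*-D : ∀ hs gs k l → D gs k * D hs l ≈ ∑[ hs ] (λ h → ∑[ gs ] (λ g → E g k * E h l))
      D-*-D hs gs k l = ≈-trans (∑-*-∑ gs hs _ _) (∑-swap gs hs _)

      Separated : List (Fin n) → List (Fin n) → Set
      Separated hs gs = All (λ h → All (λ g → h Fin.< g × Scales R.1# 1F h g) gs) hs

      D-commute : ∀ {k l} → k Fin.< l → ∀ {hs gs} → Separated hs gs →
                  D gs k * D hs l ≈ D hs l * D gs k
      D-commute {k} {l} k<l {hs} {gs} ps = begin
        D gs k * D hs l
          ≈⟨ D-*-D hs gs k l ⟩
        ∑[ hs ] (λ h → ∑[ gs ] (λ g → E g k * E h l))
          ≈⟨ ∑-cong-All (All.map (λ qs → ∑-cong-All (All.map (λ (h<g , sc) →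
               ≈-trans (E-commute h<g k<l sc) (1-• _)) qs)) ps) ⟩
        ∑[ hs ] (λ h → ∑[ gs ] (λ g → E h l * E g k))
          ≈⟨ ∑-*-∑ hs gs _ _ ⟨
        D hs l * D gs k ∎

      D-cross : ∀ {k l} → k Fin.< l → ∀ {hs gs} → Separated hs gs →
                D gs l * D hs k ≈ D hs k * D gs l + d • (D hs l * D gs k)
      D-cross {k} {l} k<l {hs} {gs} ps = begin
        D gs l * D hs k
          ≈⟨ D-*-D hs gs l k ⟩
        ∑[ hs ] (λ h → ∑[ gs ] (λ g → E g l * E h k))
          ≈⟨ ∑-cong-All (All.map (λ qs → ≈-trans (∑-cong-All (All.map (λ (h<g , sc) →
               ≈-trans (E-cross h<g k<l sc) (1-• _)) qs))
               (≈-trans (∑-+ gs _ _) (+-congˡ (≈-sym (∑-*ˡ (const d) gs _))))) ps) ⟩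
        ∑[ hs ] (λ h → ∑[ gs ] (λ g → E h k * E g l) + d • ∑[ gs ] (λ g → E h l * E g k))
          ≈⟨ ≈-trans (∑-+ hs _ _) (+-congˡ (≈-sym (∑-*ˡ (const d) hs _))) ⟩
        ∑[ hs ] (λ h → ∑[ gs ] (λ g → E h k * E g l))
          + d • ∑[ hs ] (λ h → ∑[ gs ] (λ g → E h l * E g k))
          ≈⟨ +-cong (∑-*-∑ hs gs _ _) (•-cong d (∑-*-∑ hs gs _ _)) ⟨
        D hs k * D gs l + d • (D hs l * D gs k) ∎

      D-portᴱ : ∀ hs k i → Commutes (D hs k) (portᴱ 0F i)
      D-portᴱ hs k i = ≈-sym (commutes-∑ hs λ h →
        commutes-* (port-port i h (λ ())) (≈-sym (port-shiftᴱ 0F i (B Js h k))))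

      B-*-B : ∀ i k j l → B (J ∷ Js) i k * B (J ∷ Js) j l
        ≈ (portᴱ 0F i * portᴱ 0F j) * (D (exits i) k * D (exits j) l)
      B-*-B i k j l = ≈-trans (*-cong (B-∷ i k) (B-∷ j l)) (*-interchange (D-portᴱ (exits i) k j))

      row′ : ∀ {i k l} → k Fin.< l →
        B (J ∷ Js) i l * B (J ∷ Js) i k ≈ q½ • (B (J ∷ Js) i k * B (J ∷ Js) i l)
      row′ {i} {k} {l} k<l = begin
        B (J ∷ Js) i l * B (J ∷ Js) i k
          ≈⟨ B-*-B i l i k ⟩
        (portᴱ 0F i * portᴱ 0F i) * (D (exits i) l * D (exits i) k)
          ≈⟨ *-congˡ (D-row k<l (exits-scales i)) ⟩
        (portᴱ 0F i * portᴱ 0F i) * (q½ • (D (exits i) k * D (exits i) l))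
          ≈⟨ •-*ʳ q½ _ _ ⟩
        q½ • ((portᴱ 0F i * portᴱ 0F i) * (D (exits i) k * D (exits i) l))
          ≈⟨ •-cong q½ (B-*-B i k i l) ⟨
        q½ • (B (J ∷ Js) i k * B (J ∷ Js) i l) ∎

      commute′ : ∀ {i j k l} → i Fin.< j → k Fin.< l →
        B (J ∷ Js) j k * B (J ∷ Js) i l ≈ B (J ∷ Js) i l * B (J ∷ Js) j k
      commute′ {i} {j} {k} {l} i<j k<l = ≈-trans (B-*-B j k i l)
        (≈-trans (cases (rowPair i<j)) (≈-sym (B-*-B i l j k)))
        where
        a = portᴱ 0F i * portᴱ 0F j
        cases : RowPair i j → (portᴱ 0F j * portᴱ 0F i) * (D (exits j) k * D (exits i) l)
          ≈ a * (D (exits i) l * D (exits j) k)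
        -- Both rows are multiples of the same D. The q½ from exchanging the entering letters is
        -- exactly the q½ that `D-row` needs to exchange the columns.
        cases (together {hs} ei ej ps sc) rewrite ei | ej = begin
          (portᴱ 0F j * portᴱ 0F i) * (D hs k * D hs l) ≈⟨ *-congʳ sc ⟩
          (q½ • a) * (D hs k * D hs l)                  ≈⟨ •-*ˡ q½ _ _ ⟩
          q½ • (a * (D hs k * D hs l))                  ≈⟨ •-*ʳ q½ _ _ ⟨
          a * (q½ • (D hs k * D hs l))                  ≈⟨ *-congˡ (D-row k<l ps) ⟨
          a * (D hs l * D hs k)                         ∎
        cases (apart ps sc) = *-cong (≈-trans sc (1-• a)) (D-commute k<l ps)

      cross′ : ∀ {i j k l} → i Fin.< j → k Fin.< l → B (J ∷ Js) j l * B (J ∷ Js) i k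
        ≈ B (J ∷ Js) i k * B (J ∷ Js) j l + d • (B (J ∷ Js) i l * B (J ∷ Js) j k)
      cross′ {i} {j} {k} {l} i<j k<l = ≈-trans (B-*-B j l i k)
        (≈-trans (cases (rowPair i<j)) (≈-sym (+-cong (B-*-B i k j l) (•-cong d (B-*-B i l j k)))))
        where
        a = portᴱ 0F i * portᴱ 0F j
        cases : RowPair i j → (portᴱ 0F j * portᴱ 0F i) * (D (exits j) l * D (exits i) k)
          ≈ a * (D (exits i) k * D (exits j) l) + d • (a * (D (exits i) l * D (exits j) k))
        -- Both sides are multiples of u: exchanging letters and columns gives q u on the left, and
        -- the right side is (1 + d q½) u.
        cases (together {hs} ei ej ps sc) rewrite ei | ej = begin
          (portᴱ 0F j * portᴱ 0F i) * (D hs l * D hs k) ≈⟨ *-congʳ sc ⟩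
          (q½ • a) * (D hs l * D hs k)                  ≈⟨ •-*ˡ q½ _ _ ⟩
          q½ • (a * (D hs l * D hs k))                  ≈⟨ •-cong q½ sorted ⟩
          q½ • q½ • u                                   ≈⟨ •-• q½ q½ u ⟩
          (q½ R.* q½) • u                               ≈⟨ •-congʳ u q≈1+q½d ⟩
          (R.1# R.+ q½ R.* d) • u                       ≈⟨ +-• R.1# _ u ⟩
          R.1# • u + (q½ R.* d) • u                     ≈⟨ +-cong (1-• u) (•-congʳ u (R.*-comm q½ d)) ⟩
          u + (d R.* q½) • u                            ≈⟨ +-congˡ (•-• d q½ u) ⟨
          u + d • q½ • u                                ≈⟨ +-congˡ (•-cong d sorted) ⟨
          u + d • (a * (D hs l * D hs k))               ∎
          where
          u = a * (D hs k * D hs l)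
          sorted : a * (D hs l * D hs k) ≈ q½ • u
          sorted = ≈-trans (*-congˡ (D-row k<l ps)) (•-*ʳ q½ _ _)
        cases (apart ps sc) = ≈-trans (*-cong (≈-trans sc (1-• a)) (D-cross k<l ps))
          (≈-trans (distribˡ a _ _) (+-congˡ (•-*ʳ d a _)))

      B-relations-∷ : QuantumRelations (Z (J ∷ Js)) (B (J ∷ Js))
      B-relations-∷ = record { X-row = row′ ; X-commute = commute′ ; X-cross = cross′ }

  module _ {n : ℕ} where
    open PresentedAlgebra R (Z {n} [])

    B-[]-off : ∀ {i j : Fin n} → i ≢ j → B [] i j ≡ const R.0#
    B-[]-off {i} {j} ne with i Fin.≟ j
    ... | yes e = contradiction e ne
    ... | no _  = refl

    δ : Fin n → Fin n → R.Carrier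
    δ i j = if does (i Fin.≟ j) then R.1# else R.0#

    B-[] : ∀ (i j : Fin n) → B [] i j ≈ const (δ i j)
    B-[] i j with i Fin.≟ j
    ... | yes refl = +-identityʳ _
    ... | no  _    = ≈-refl

    -- Without factors B is the identity matrix. Its entries are scalars and commute, and every
    -- product that carries a coefficient q½ or d contains an entry off the diagonal.
    B-relations-[] : QuantumRelations (Z {n} []) (B [])
    B-relations-[] = record
      { X-row = λ {i} {k} {l} k<l → ≈-trans (off i l i k λ { (refl , refl) → ℕ.n≮n _ k<l })
          (≈-sym (≈-trans (•-cong q½ (off i k i l λ { (refl , refl) → ℕ.n≮n _ k<l })) (zeroʳ _)))
      ; X-commute = λ {i} {j} {k} {l} _ _ → commutes j k i l
      ; X-cross = λ {i} {j} {k} {l} i<j k<l →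
          ≈-trans (commutes j l i k) (≈-trans (≈-sym (+-identityʳ _)) (+-congˡ (≈-sym
            (≈-trans (•-cong d (off i l j k λ { (refl , refl) → ℕ.<-asym i<j k<l })) (zeroʳ _))))) }
      where
      off : ∀ (i k j l : Fin n) → ¬ (i ≡ k × j ≡ l) → B [] i k * B [] j l ≈ const R.0#
      off i k j l ne with i Fin.≟ k
      ... | no _  = zeroˡ _
      ... | yes e = ≈-trans (*-congˡ (≡⇒≈ (B-[]-off (λ f → ne (e , f))))) (zeroʳ _)
      commutes : ∀ (i k j l : Fin n) → Commutes (B [] i k) (B [] j l)
      commutes i k j l = ≈-trans (*-congʳ (B-[] i k))
        (≈-trans (central _ _) (*-congˡ (≈-sym (B-[] i k))))

  B-relations : ∀ {n m} (Js : Vec (Interval n) m) → QuantumRelations (Z Js) (B Js)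
  B-relations []       = B-relations-[]
  B-relations (J ∷ Js) = FirstFactorRelations.B-relations-∷ J Js (B-relations Js)

  -- The coefficient of z_G and its factorisation along the first star.

  module Coefficient {n m} (Js : Vec (Interval n) m) where
    open Indeterminate

    -- The action defining [z] is private to Defs.  The copies below agree with it
    -- definitionally: ⟦ [z] Js ⟧ t is eval t squarefree [].
    Word : Set
    Word = List (Indeterminate Js)

    passes? : (x y : Indeterminate Js) → Dec (p y ≡ p x × k y ≡ k x × h y Fin.< h x)
    passes? x y = p y Fin.≟ p x ×-dec k y Fin.≟ k x ×-dec h y Fin.<? h x

    act : Indeterminate Js → (Word → R.Carrier) → Word → R.Carrier
    act x ψ W = (q½ ^ # (passes? x) W) R.* ψ (x ∷ W)

    squarefree? : ∀ W → Dec (All (λ x → # (x ≟ᶻ_) W ≡ 1) (indeterminates Js))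
    squarefree? W = All.all? (λ x → # (x ≟ᶻ_) W ℕ.≟ 1) (indeterminates Js)

    squarefree : Word → R.Carrier
    squarefree W = if does (squarefree? W) then R.1# else R.0#

    open LinearAlgebra.Action R (Z Js) Word _↭_ act using (eval) public

    eval-cong : ∀ t {ψ χ} → (∀ W → ψ W R.≈ χ W) → ∀ W → eval t ψ W R.≈ eval t χ W
    eval-cong (const c) e W = R.*-congˡ (e W)
    eval-cong (gen x)   e W = R.*-congˡ (e (x ∷ W))
    eval-cong (s + t)   e W = R.+-cong (eval-cong s e W) (eval-cong t e W)
    eval-cong (s * t)   e W = eval-cong t (eval-cong s e) W
    eval-cong (- t)     e W = R.-‿cong (eval-cong t e W)

    eval-* : ∀ t c ψ W → eval t (λ V → c R.* ψ V) W R.≈ c R.* eval t ψ W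
    eval-* (const e) c ψ W = x∙yz≈y∙xz e c _
      where open import Algebra.Properties.CommutativeSemigroup R.*-commutativeSemigroup
    eval-* (gen x)   c ψ W = x∙yz≈y∙xz _ c _
      where open import Algebra.Properties.CommutativeSemigroup R.*-commutativeSemigroup
    eval-* (s + t)   c ψ W =
      R.trans (R.+-cong (eval-* s c ψ W) (eval-* t c ψ W)) (R.sym (R.distribˡ c _ _))
    eval-* (s * t)   c ψ W =
      R.trans (eval-cong t (eval-* s c ψ) W) (eval-* t c (eval s ψ) W)
    eval-* (- t)     c ψ W = R.trans (R.-‿cong (eval-* t c ψ W)) (-‿distribʳ-* c _)
      where open import Algebra.Properties.Ring R.ring using (-‿distribʳ-*)

    -- The exponent of q½ in the product of the letters of X and the ordered monomial W.
    passings : Word → Word → ℕ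
    passings []      W = 0
    passings (x ∷ X) W = # (passes? x) (X ++ W) ℕ.+ passings X W

    eval-word : ∀ X ψ W → eval (∏ (map gen X)) ψ W R.≈ (q½ ^ passings X W) R.* ψ (X ++ W)
    eval-word []      ψ W = R.refl
    eval-word (x ∷ X) ψ W = begin
      eval (∏ (map gen X)) (act x ψ) W
        ≈⟨ eval-word X (act x ψ) W ⟩
      (q½ ^ passings X W) R.* ((q½ ^ # (passes? x) (X ++ W)) R.* ψ (x ∷ X ++ W))
        ≈⟨ R.*-assoc _ _ _ ⟨
      (q½ ^ passings X W) R.* (q½ ^ # (passes? x) (X ++ W)) R.* ψ (x ∷ X ++ W)
        ≈⟨ R.*-congʳ (R.trans (R.*-comm _ _)
             (R.sym (^-homo-* q½ (# (passes? x) (X ++ W)) (passings X W)))) ⟩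
      (q½ ^ passings (x ∷ X) W) R.* ψ (x ∷ X ++ W) ∎
      where open import Relation.Binary.Reasoning.Setoid R.setoid

  module Extraction {n m} (J : Interval n) (Js : Vec (Interval n) m) where
    open FirstFactor J Js
    open Indeterminate
    private
      module G  = Coefficient (J ∷ Js)
      module G′ = Coefficient Js

    passes-shift : ∀ x V → # (G.passes? (shift x)) (map shift V) ≡ # (G′.passes? x) V
    passes-shift x = #-map (G′.passes? x) (G.passes? (shift x)) shift λ _ → refl

    -- Shifting preserves which letters pass which, so on shifted words both actions produce the
    -- same powers of q½.
    eval-shift : ∀ t ψ V → G.eval (shiftᴱ t) ψ (map shift V) R.≈ G′.eval t (ψ ∘ map shift) V
    eval-shift (const c) ψ V = R.refl
    eval-shift (gen x)   ψ V = R.*-congʳ (R.reflexive (cong (q½ ^_) (passes-shift x V)))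
    eval-shift (s + t)   ψ V = R.+-cong (eval-shift s ψ V) (eval-shift t ψ V)
    eval-shift (s * t)   ψ V =
      R.trans (eval-shift t (G.eval (shiftᴱ s) ψ) V) (G′.eval-cong t (eval-shift s ψ) V)
    eval-shift (- t)     ψ V = R.-‿cong (eval-shift t ψ V)

    Follows : Fin n → Fin n → Set
    Follows i h = (Crosses i → Crosses h) × (¬ Crosses i → h ≡ i)

    -- The letters contributed by the first factor when source i leaves it at u i.
    letters : ∀ {l} → (Fin l → Fin n) → (Fin l → Fin n) → G.Word
    letters ι u = concat (tabulate λ i → port 0F (ι i) ++ port 1F (u i))

    port-All : ∀ {P : Indeterminate (J ∷ Js) → Set} k i →
               (∀ (l : Nondegenerate J) (i∈ : i ∈ᴵ J) → P (ζ i zero k {l} {i∈})) → All P (port k i)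
    port-All k i f with crosses? i
    ... | yes (l , i∈) = f l i∈ ∷ []
    ... | no _         = []

    letters-All : ∀ {P : Indeterminate (J ∷ Js) → Set} {l} (ι u : Fin l → Fin n) →
      (∀ i (c : Nondegenerate J) (i∈ : ι i ∈ᴵ J) → P (ζ (ι i) zero 0F {c} {i∈})) →
      (∀ i (c : Nondegenerate J) (i∈ : u i ∈ᴵ J) → P (ζ (u i) zero 1F {c} {i∈})) →
      All P (letters ι u)
    letters-All ι u f g = All.concat⁺ (All.tabulate⁺ λ i →
      All.++⁺ (port-All 0F (ι i) (f i)) (port-All 1F (u i) (g i)))

    shift-All : ∀ {P : Indeterminate (J ∷ Js) → Set} V → (∀ y → P (shift y)) → All P (map shift V)
    shift-All V f = All.map⁺ (All.universal f V)

    outside : ∀ {i j} → Crosses i → ¬ Crosses j → i Fin.< j → ∀ {h} → Crosses h → h Fin.< j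
    outside (l , i∈) ¬c i<j (_ , h∈) = ℕ.≤-<-trans (proj₂ h∈)
      (ℕ.≰⇒> λ j≤hi → ¬c (l , ℕ.≤-trans (proj₁ i∈) (ℕ.<⇒≤ i<j) , j≤hi))

    outside′ : ∀ {i j} → ¬ Crosses i → Crosses j → i Fin.< j → ∀ {h} → Crosses h → i Fin.< h
    outside′ ¬c (l , j∈) i<j (_ , h∈) = ℕ.<-≤-trans
      (ℕ.≰⇒> λ lo≤i → ¬c (l , lo≤i , ℕ.≤-trans (ℕ.<⇒≤ i<j) (proj₂ j∈))) (proj₁ h∈)

    -- A crossing row contributes its leaving letter, passed exactly when its exit is below h; its
    -- entering letter has another k. A straight row contributes no letter, and no inversion either,
    -- since it lies above the star and hence above h.
    passes-letters : ∀ {l} {i} (ι u : Fin l → Fin n) → (∀ j → Follows (ι j) (u j)) →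
      (∀ j → i Fin.< ι j) → ∀ {h} → Crosses i → ∀ (c : Nondegenerate J) (h∈ : h ∈ᴵ J) →
      # (G.passes? (ζ h zero 1F {c} {h∈})) (letters ι u) ≡ sum (λ j → 𝟙 (does (u j Fin.<? h)))
    passes-letters {i = i} ι u fol i<ι {h} ci c h∈ =
      trans (#-concat P? (λ j → port 0F (ι j) ++ port 1F (u j))) (sum-cong-≗ each)
      where
      P? = G.passes? (ζ h zero 1F {c} {h∈})
      each : ∀ j → # P? (port 0F (ι j) ++ port 1F (u j)) ≡ 𝟙 (does (u j Fin.<? h))
      each j = cases (crosses? (ι j))
        where
        cases : Dec (Crosses (ι j)) → # P? (port 0F (ι j) ++ port 1F (u j)) ≡ 𝟙 (does (u j Fin.<? h))
        cases (yes cj@(l , j∈)) with l′ , u∈ ← proj₁ (fol j) cj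
          rewrite port-yes 0F (ι j) l j∈ | port-yes 1F (u j) l′ u∈ =
            trans (#-∷ P? (ζ (u j) zero 1F {l′} {u∈}) []) (ℕ.+-identityʳ _)
        cases (no ¬cj) rewrite proj₂ (fol j) ¬cj | port-no 0F (ι j) ¬cj | port-no 1F (ι j) ¬cj =
          cong 𝟙 (sym (Dec.dec-false (ι j Fin.<? h) (ℕ.<⇒≯ (outside ci ¬cj (i<ι j) (c , h∈)))))

    -- Entering letters come in increasing order and pass nothing; a leaving letter passes those of
    -- later rows with a smaller exit. The increasing map `ι` lets the induction drop the first row.
    passings-letters : ∀ {l} (ι u : Fin l → Fin n) → (∀ {i j} → i Fin.< j → ι i Fin.< ι j) →
      (∀ j → Follows (ι j) (u j)) → ∀ V → G.passings (letters ι u) (map shift V) ≡ inversions u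
    passings-letters {zero}  ι u mono fol V = refl
    passings-letters {suc l} ι u mono fol V = trans (cases (crosses? (ι zero)))
      (cong (sum (λ j → 𝟙 (does (u (suc j) Fin.<? u zero))) ℕ.+_)
        (passings-letters (ι ∘ suc) (u ∘ suc) (λ i<j → mono (ℕ.s≤s i<j)) (fol ∘ suc) V))
      where
      Y = letters (ι ∘ suc) (u ∘ suc)
      S = map shift V
      cases : Dec (Crosses (ι zero)) → G.passings (letters ι u) S
        ≡ sum (λ j → 𝟙 (does (u (suc j) Fin.<? u zero))) ℕ.+ G.passings Y S
      cases (yes c₀@(c , i∈)) with c′ , u∈ ← proj₁ (fol zero) c₀
        rewrite port-yes 0F (ι zero) c i∈ | port-yes 1F (u zero) c′ u∈ = begin
          # (G.passes? a) (b ∷ Y ++ S) ℕ.+ (# (G.passes? b) (Y ++ S) ℕ.+ G.passings Y S)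
            ≡⟨ cong (ℕ._+ (# (G.passes? b) (Y ++ S) ℕ.+ G.passings Y S))
                 (#-none (G.passes? a) {b ∷ Y ++ S} ((λ { (_ , () , _) }) ∷ All.++⁺
                   (letters-All (ι ∘ suc) (u ∘ suc)
                     (λ j _ _ (_ , _ , l) → ℕ.<-asym l (mono {zero} {suc j} (ℕ.s≤s ℕ.z≤n)))
                     (λ { j _ _ (_ , () , _) }))
                   (shift-All V λ { y (() , _) }))) ⟩
          # (G.passes? b) (Y ++ S) ℕ.+ G.passings Y S
            ≡⟨ cong (ℕ._+ G.passings Y S) (trans (#-++ (G.passes? b) Y S) (trans (cong₂ ℕ._+_
                 (passes-letters (ι ∘ suc) (u ∘ suc) (fol ∘ suc) (λ j → mono {zero} {suc j} (ℕ.s≤s ℕ.z≤n)) c₀ c′ u∈)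
                 (#-none (G.passes? b) (shift-All V λ { y (() , _) })))
                 (ℕ.+-identityʳ _))) ⟩
          sum (λ j → 𝟙 (does (u (suc j) Fin.<? u zero))) ℕ.+ G.passings Y S ∎
        where
        open ≡-Reasoning
        a = ζ (ι zero) zero 0F {c} {i∈}
        b = ζ (u zero) zero 1F {c′} {u∈}
      -- The first row is straight and has no letters; all later rows exit above it, so it begins no
      -- inversion.
      cases (no ¬c₀) rewrite proj₂ (fol zero) ¬c₀ | port-no 0F (ι zero) ¬c₀ | port-no 1F (ι zero) ¬c₀ =
        cong (ℕ._+ G.passings Y S) (sym (sum-0 λ j →
          cong 𝟙 (Dec.dec-false (u (suc j) Fin.<? ι zero) (ℕ.<⇒≯ (above j (crosses? (ι (suc j))))))))
        where
        above : ∀ j → Dec (Crosses (ι (suc j))) → ι zero Fin.< u (suc j)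
        above j (yes cj) = outside′ ¬c₀ cj (mono {zero} {suc j} (ℕ.s≤s ℕ.z≤n)) (proj₁ (fol (suc j)) cj)
        above j (no ¬cj) = ≡.subst (ι zero Fin.<_) (sym (proj₂ (fol (suc j)) ¬cj)) (mono {zero} {suc j} (ℕ.s≤s ℕ.z≤n))

  module _ {n m} (J : Interval n) (Js : Vec (Interval n) m) where
    open FirstFactor J Js
    open Extraction J Js
    open Indeterminate
    private
      module G  = Coefficient (J ∷ Js)
      module G′ = Coefficient Js

    count-enter : ∀ u → (∀ i → Follows i (u i)) → ∀ h (c : Nondegenerate J) (h∈ : h ∈ᴵ J) →
      # (ζ h zero 0F {c} {h∈} ≟ᶻ_) (letters (λ i → i) u) ≡ 1
    count-enter u fol h c h∈ = trans (#-concat x? (λ i → port 0F i ++ port 1F (u i)))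
      (trans (sum-cong-≗ λ i → each i (crosses? i)) (sum-indicator h))
      where
      x? = ζ h zero 0F {c} {h∈} ≟ᶻ_
      each : ∀ i → Dec (Crosses i) → # x? (port 0F i ++ port 1F (u i)) ≡ 𝟙 (does (h Fin.≟ i))
      each i (yes ci@(l , i∈)) with l′ , u∈ ← proj₁ (fol i) ci
        rewrite port-yes 0F i l i∈ | port-yes 1F (u i) l′ u∈ = begin
          # x? (a ∷ b ∷ [])             ≡⟨ #-∷ x? a (b ∷ []) ⟩
          𝟙 (does (x? a)) ℕ.+ # x? (b ∷ [])
            ≡⟨ cong₂ ℕ._+_ (cong 𝟙 (Bool.∧-identityʳ _)) (#-none x? ((λ ()) ∷ [])) ⟩
          𝟙 (does (h Fin.≟ i)) ℕ.+ 0    ≡⟨ ℕ.+-identityʳ _ ⟩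
          𝟙 (does (h Fin.≟ i))          ∎
        where
        open ≡-Reasoning
        a = ζ i zero 0F {l} {i∈}
        b = ζ (u i) zero 1F {l′} {u∈}
      each i (no ¬ci) rewrite proj₂ (fol i) ¬ci | port-no 0F i ¬ci | port-no 1F i ¬ci =
        cong 𝟙 (sym (Dec.dec-false (h Fin.≟ i) λ { refl → ¬ci (c , h∈) }))

    count-leave : ∀ u → (∀ i → Follows i (u i)) → ∀ h (c : Nondegenerate J) (h∈ : h ∈ᴵ J) →
      # (ζ h zero 1F {c} {h∈} ≟ᶻ_) (letters (λ i → i) u) ≡ sum (λ i → 𝟙 (does (h Fin.≟ u i)))
    count-leave u fol h c h∈ = trans (#-concat x? (λ i → port 0F i ++ port 1F (u i)))
      (sum-cong-≗ λ i → each i (crosses? i))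
      where
      x? = ζ h zero 1F {c} {h∈} ≟ᶻ_
      each : ∀ i → Dec (Crosses i) → # x? (port 0F i ++ port 1F (u i)) ≡ 𝟙 (does (h Fin.≟ u i))
      each i (yes ci@(l , i∈)) with l′ , u∈ ← proj₁ (fol i) ci
        rewrite port-yes 0F i l i∈ | port-yes 1F (u i) l′ u∈ = begin
          # x? (a ∷ b ∷ [])             ≡⟨ #-∷ x? a (b ∷ []) ⟩
          𝟙 (does (x? a)) ℕ.+ # x? (b ∷ [])
            ≡⟨ cong₂ ℕ._+_ (cong 𝟙 (Dec.dec-false (x? a) λ ())) (#-∷ x? b []) ⟩
          𝟙 (does (x? b)) ℕ.+ 0         ≡⟨ ℕ.+-identityʳ _ ⟩
          𝟙 (does (x? b))               ≡⟨ cong 𝟙 (Bool.∧-identityʳ _) ⟩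
          𝟙 (does (h Fin.≟ u i))        ∎
        where
        open ≡-Reasoning
        a = ζ i zero 0F {l} {i∈}
        b = ζ (u i) zero 1F {l′} {u∈}
      each i (no ¬ci) rewrite proj₂ (fol i) ¬ci | port-no 0F i ¬ci | port-no 1F i ¬ci =
        cong 𝟙 (sym (Dec.dec-false (h Fin.≟ i) λ { refl → ¬ci (c , h∈) }))

    κ : (Fin n → Fin n) → R.Carrier
    κ u = if does (surjective? u) then q½ ^ inversions u else R.0#

    module _ (u : Fin n → Fin n) (fol : ∀ i → Follows i (u i)) (V : G′.Word) where
      word : G.Word
      word = letters (λ i → i) u ++ map shift V

      count-first : ∀ h k (c : Nondegenerate J) (h∈ : h ∈ᴵ J) → let x = ζ h zero k {c} {h∈} in
        # (x ≟ᶻ_) word ≡ # (x ≟ᶻ_) (letters (λ i → i) u)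
      count-first h k c h∈ = trans (#-++ x? (letters (λ i → i) u) (map shift V))
        (trans (cong (# x? (letters (λ i → i) u) ℕ.+_) (#-none x? (shift-All V λ { y () })))
          (ℕ.+-identityʳ _))
        where x? = ζ h zero k {c} {h∈} ≟ᶻ_

      count-rest : ∀ y → # (shift {J = J} y ≟ᶻ_) word ≡ # (y ≟ᶻ_) V
      count-rest y = trans (#-++ x? (letters (λ i → i) u) (map shift V))
        (cong₂ ℕ._+_ (#-none x? (letters-All (λ i → i) u (λ { _ _ _ () }) (λ { _ _ _ () })))
          (#-map (y ≟ᶻ_) x? shift (λ _ → refl) V))
        where x? = shift {J = J} y ≟ᶻ_

      -- An entering letter occurs once for any u, and a leaving letter as often as u takes its
      -- value, which is once for a bijection. What remains is the condition on V.
      squarefree-surjective : Surjective u → G.squarefree word ≡ G′.squarefree V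
      squarefree-surjective surj = cong (λ b → if b then R.1# else R.0#)
        (Dec.does-⇔ (mk⇔ to from) (G.squarefree? word) (G′.squarefree? V))
        where
        to : All (λ x → # (x ≟ᶻ_) word ≡ 1) (indeterminates (J ∷ Js)) →
             All (λ y → # (y ≟ᶻ_) V ≡ 1) (indeterminates Js)
        to all = All.universal (λ y → trans (sym (count-rest y))
          (All.lookup all (indeterminates-complete (J ∷ Js) (shift y)))) (indeterminates Js)
        leaves : ∀ h → sum (λ i → 𝟙 (does (h Fin.≟ u i))) ≡ 1
        leaves h with π , π≡ ← surjective⇒permutation u surj = begin
          sum (λ i → 𝟙 (does (h Fin.≟ u i)))
            ≡⟨ sum-cong-≗ (λ i → cong (λ j → 𝟙 (does (h Fin.≟ j))) (sym (π≡ i))) ⟩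
          sum (λ i → 𝟙 (does (h Fin.≟ π ⟨$⟩ʳ i)))
            ≡⟨ sum-permute (λ i → 𝟙 (does (h Fin.≟ i))) π ⟨
          sum (λ i → 𝟙 (does (h Fin.≟ i)))
            ≡⟨ sum-indicator h ⟩
          1 ∎
          where open ≡-Reasoning
        from : All (λ y → # (y ≟ᶻ_) V ≡ 1) (indeterminates Js) →
               All (λ x → # (x ≟ᶻ_) word ≡ 1) (indeterminates (J ∷ Js))
        from all = All.universal once (indeterminates (J ∷ Js))
          where
          once : ∀ x → # (x ≟ᶻ_) word ≡ 1
          -- The side conditions stored in `ζ` are irrelevant; `crosses? h` supplies relevant proofs
          -- of them.
          once (ζ h zero 0F {c} {h∈}) with crosses? h
          ... | yes (l , i) = trans (count-first h 0F l i) (count-enter u fol h l i)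
          ... | no ¬c = ⊥-elim (¬c (c , h∈))
          once (ζ h zero 1F {c} {h∈}) with crosses? h
          ... | yes (l , i) = trans (count-first h 1F l i) (trans (count-leave u fol h l i) (leaves h))
          ... | no ¬c = ⊥-elim (¬c (c , h∈))
          once (ζ h (suc p) k {c} {h∈}) = trans (count-rest (ζ h p k {c} {h∈}))
            (All.lookup all (indeterminates-complete Js (ζ h p k {c} {h∈})))

      -- A value missed by u belongs to the star, because straight rows hit their own index. Its
      -- leaving letter is then absent, while z_G contains it.
      squarefree-nonsurjective : ¬ Surjective u → G.squarefree word ≡ R.0#
      squarefree-nonsurjective ¬surj = cong (λ b → if b then R.1# else R.0#)
        (Dec.dec-false (G.squarefree? word) λ all → ¬surj λ h → hit all h (crosses? h))
        where
        hit : All (λ x → # (x ≟ᶻ_) word ≡ 1) (indeterminates (J ∷ Js)) →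
              ∀ h → Dec (Crosses h) → ∃[ i ] u i ≡ h
        hit all h (no ¬c) = h , proj₂ (fol h) ¬c
        hit all h (yes (l , h∈)) with Fin.any? (λ i → u i Fin.≟ h)
        ... | yes found = found
        ... | no none = contradiction
          (trans (sym (All.lookup all (indeterminates-complete (J ∷ Js) (ζ h zero 1F {l} {h∈}))))
            (trans (count-first h 1F l h∈) (trans (count-leave u fol h l h∈) (sum-0 λ i →
              cong 𝟙 (Dec.dec-false (h Fin.≟ u i) λ e → none (i , sym e))))))
          λ ()

      leading-coefficient : (q½ ^ G.passings (letters (λ i → i) u) (map shift V)) R.* G.squarefree word
        R.≈ κ u R.* G′.squarefree V
      leading-coefficient = cases (surjective? u)
        where
        cases : Dec (Surjective u) →
          (q½ ^ G.passings (letters (λ i → i) u) (map shift V)) R.* G.squarefree word R.≈ κ u R.* G′.squarefree V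
        cases (yes surj) = R.reflexive (cong₂ R._*_
          (trans (cong (q½ ^_) (passings-letters (λ i → i) u (λ l → l) fol V))
            (cong (λ b → if b then q½ ^ inversions u else R.0#) (sym (Dec.dec-true (surjective? u) surj))))
          (squarefree-surjective surj))
        cases (no ¬surj) = R.trans (R.trans
          (R.*-congˡ (R.reflexive (squarefree-nonsurjective ¬surj))) (R.zeroʳ _))
          (R.sym (R.trans (R.*-congʳ (R.reflexive (cong (λ b → if b then q½ ^ inversions u else R.0#)
            (Dec.dec-false (surjective? u) ¬surj)))) (R.zeroˡ _)))

  -- The recursion for M over the first factor.

  module ∑ᴿ = ListSum R.+-commutativeMonoid

  module _ (V : LeftModule R.ring 0ℓ 0ℓ) (θ : LinearForm V) where
    open LinearForm using (⟦_⟧; 0ᴹ-homo; +ᴹ-homo)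

    ⟦⟧-∑ : ∀ {A : Set} (xs : List A) F →
           ⟦ θ ⟧ (∑ᴹ V (map F xs)) R.≈ ∑ᴿ.∑[ xs ] (λ x → ⟦ θ ⟧ (F x))
    ⟦⟧-∑ []       F = 0ᴹ-homo θ
    ⟦⟧-∑ (x ∷ xs) F = R.trans (+ᴹ-homo θ (F x) _) (R.+-congˡ (⟦⟧-∑ xs F))

  M : ∀ {n m} (Js : Vec (Interval n) m) → (u w : Fin n → Fin n) → R.Carrier
  M Js u w = LinearForm.⟦ [z] Js ⟧ (∏ (tabulate λ i → B Js (u i) (w i)))

  M-cong : ∀ {n m} (Js : Vec (Interval n) m) {u v w x : Fin n → Fin n} →
           (∀ i → u i ≡ v i) → (∀ i → w i ≡ x i) → M Js u w R.≈ M Js v x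
  M-cong Js e f = LinearForm.⟦⟧-cong ([z] Js) (∏-cong λ i → ≡⇒≈ (cong₂ (B Js) (e i) (f i)))
    where open PresentedAlgebra R (Z Js)

  module _ {N m} (J : Interval (suc N)) (Js : Vec (Interval (suc N)) m) where
    open FirstFactor J Js
    open FirstFactorRelations J Js using (∈-interior; interior-sorted; port-shiftᴱ)
    open Extraction J Js
    open PresentedAlgebra R (Z (J ∷ Js))
    private
      module G  = Coefficient (J ∷ Js)
      module G′ = Coefficient Js
      n = suc N

    -- By `leading-coefficient` the letters of the first factor multiply the value at every later
    -- word V by the same scalar `κ J Js u`, which can therefore be pulled out of the evaluation of
    -- t.
    [z]-letters : ∀ u → (∀ i → Follows i (u i)) → ∀ t →
      LinearForm.⟦ [z] (J ∷ Js) ⟧ (∏ (map gen (letters (λ i → i) u)) * shiftᴱ t)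
        R.≈ κ J Js u R.* LinearForm.⟦ [z] Js ⟧ t
    [z]-letters u fol t = R.trans (eval-shift t (G.eval front G.squarefree) [])
      (R.trans (G′.eval-cong t (λ V → R.trans (G.eval-word (letters (λ i → i) u) G.squarefree (map shift V))
        (leading-coefficient J Js u fol V)) [])
        (G′.eval-* t (κ J Js u) G′.squarefree []))
      where front = ∏ (map gen (letters (λ i → i) u))

    ∏-letters : ∀ {l} (ι u : Fin l → Fin n) →
      ∏ (tabulate λ i → portᴱ 0F (ι i) * portᴱ 1F (u i)) ≈ ∏ (map gen (letters ι u))
    ∏-letters {zero}  ι u = ≈-refl
    ∏-letters {suc l} ι u = begin
      portᴱ 0F (ι zero) * portᴱ 1F (u zero) * ∏ (tabulate λ i → portᴱ 0F (ι (suc i)) * portᴱ 1F (u (suc i)))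
        ≈⟨ *-cong (≈-sym (∏-++ (map gen a) (map gen b))) (∏-letters (ι ∘ suc) (u ∘ suc)) ⟩
      ∏ (map gen a ++ map gen b) * ∏ (map gen (letters (ι ∘ suc) (u ∘ suc)))
        ≈⟨ ∏-++ (map gen a ++ map gen b) _ ⟨
      ∏ ((map gen a ++ map gen b) ++ map gen (letters (ι ∘ suc) (u ∘ suc)))
        ≡⟨ cong ∏ (trans (cong (_++ map gen (letters (ι ∘ suc) (u ∘ suc))) (sym (List.map-++ gen a b)))
             (sym (List.map-++ gen (a ++ b) (letters (ι ∘ suc) (u ∘ suc))))) ⟩
      ∏ (map gen (letters ι u)) ∎
      where
      a = port 0F (ι zero)
      b = port 1F (u zero)

    -- Each entry is expanded over its exits. Indeterminates of different factors commute, so all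
    -- letters of the first star can be gathered on the left, with their order among themselves
    -- kept.
    ∏-B : ∀ (w : Fin n → Fin n) → ∏ (tabulate λ i → B (J ∷ Js) i (w i))
      ≈ ∑[ choices exits ] (λ u →
          ∏ (map gen (letters (λ i → i) u)) * shiftᴱ (∏ (tabulate λ i → B Js (u i) (w i))))
    ∏-B w = begin
      ∏ (tabulate λ i → B (J ∷ Js) i (w i))
        ≈⟨ ∏-cong (λ i → ≈-trans (B-∷ i (w i)) (≈-trans (∑-*ˡ (portᴱ 0F i) (exits i) _)
             (∑-cong (exits i) λ h → ≈-sym (*-assoc _ _ _)))) ⟩
      ∏ (tabulate λ i → ∑[ exits i ] (λ h → portᴱ 0F i * portᴱ 1F h * shiftᴱ (B Js h (w i))))
        ≈⟨ ∏-∑ exits (λ i h → portᴱ 0F i * portᴱ 1F h * shiftᴱ (B Js h (w i))) ⟩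
      ∑[ choices exits ] (λ u →
        ∏ (tabulate λ i → portᴱ 0F i * portᴱ 1F (u i) * shiftᴱ (B Js (u i) (w i))))
        ≈⟨ ∑-cong (choices exits) (λ u → ≈-trans
             (∏-* (λ i → portᴱ 0F i * portᴱ 1F (u i)) (λ i → shiftᴱ (B Js (u i) (w i)))
               (λ i j → commutes-* (port-shiftᴱ 0F j (B Js (u i) (w i))) (port-shiftᴱ 1F (u j) (B Js (u i) (w i)))))
             (*-cong (∏-letters (λ i → i) u)
               (≡⇒≈ (sym (mapᴱ-∏ shift (λ i → B Js (u i) (w i))))))) ⟩
      ∑[ choices exits ] (λ u →
        ∏ (map gen (letters (λ i → i) u)) * shiftᴱ (∏ (tabulate λ i → B Js (u i) (w i)))) ∎

    exits-follow : ∀ i → All (Follows i) (exits i)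
    exits-follow i = cases (crosses? i)
      where
      cases : Dec (Crosses i) → All (Follows i) (exits i)
      cases (yes c) = ≡.subst (All (Follows i)) (sym (exits-yes i c))
        (All.map (λ h∈ → (λ _ → proj₁ c , h∈) , contradiction c) ∈-interior)
      cases (no ¬c) = ≡.subst (All (Follows i)) (sym (exits-no i ¬c))
        (((λ c → contradiction c ¬c) , λ _ → refl) ∷ [])

    follow-exits : ∀ i h → Follows i h → h ∈ exits i
    follow-exits i h (f , g) = cases (crosses? i)
      where
      cases : Dec (Crosses i) → h ∈ exits i
      cases (yes c) = ≡.subst (h ∈_) (sym (exits-yes i c)) (∈-filter⁺ (_∈ᴵ? J) (∈-allFin h) (proj₂ (f c)))
      cases (no ¬c) = ≡.subst (h ∈_) (sym (exits-no i ¬c)) (here (g ¬c))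

    exits-unique : ∀ i → AllPairs _≢_ (exits i)
    exits-unique i = cases (crosses? i)
      where
      cases : Dec (Crosses i) → AllPairs _≢_ (exits i)
      cases (yes c) = ≡.subst (AllPairs _≢_) (sym (exits-yes i c)) (AllPairs.map Fin.<⇒≢ interior-sorted)
      cases (no ¬c) = ≡.subst (AllPairs _≢_) (sym (exits-no i ¬c)) ([] ∷ [])

    ∈𝔖⇒follows : ∀ f → f ∈𝔖 J → ∀ i → Follows i (f ⟨$⟩ʳ i)
    ∈𝔖⇒follows f f∈ i = (λ (l , i∈) → l , stays i∈) , fixed
      where
      stays : ∀ {i} → i ∈ᴵ J → f ⟨$⟩ʳ i ∈ᴵ J
      stays {i} i∈ with (f ⟨$⟩ʳ i) ∈ᴵ? J
      ... | yes fi∈ = fi∈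
      ... | no fi∉  = contradiction (≡.subst (_∈ᴵ J) (sym (perm-injective f (∈𝔖⇒fixes J f f∈ _ fi∉))) i∈) fi∉
      fixed : ¬ Crosses i → f ⟨$⟩ʳ i ≡ i
      fixed ¬c with i ∈ᴵ? J
      ... | no i∉  = ∈𝔖⇒fixes J f f∈ i i∉
      -- Here J is degenerate, so it consists of i alone, and `f` maps it to itself.
      ... | yes i∈ = Fin.toℕ-injective (ℕ.≤-antisym (low (stays i∈) i∈) (low i∈ (stays i∈)))
        where
        low : ∀ {a b} → a ∈ᴵ J → b ∈ᴵ J → toℕ a ℕ.≤ toℕ b
        low (_ , a≤) (≤b , _) = ℕ.≤-trans a≤ (ℕ.≤-trans (ℕ.≮⇒≥ λ l → ¬c (l , i∈)) ≤b)

    pointwise : Setoid 0ℓ 0ℓ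
    pointwise = record
      { Carrier = Fin n → Fin n
      ; _≈_ = λ u v → ∀ i → u i ≡ v i
      ; isEquivalence = record
        { refl = λ _ → refl ; sym = λ e i → sym (e i) ; trans = λ e f i → trans (e i) (f i) } }

    𝔖 : List (Permutation′ n)
    𝔖 = filter (_∈𝔖? J) (permutations n)

    surjective-cong : ∀ {u v : Fin n → Fin n} → (∀ i → u i ≡ v i) → Surjective u → Surjective v
    surjective-cong e surj h with i , ui≡h ← surj h = i , trans (sym (e i)) ui≡h

    κ-cong : ∀ {u v : Fin n → Fin n} → (∀ i → u i ≡ v i) → κ J Js u ≡ κ J Js v
    κ-cong {u} {v} e = cong₂ (λ b l → if b then q½ ^ l else R.0#)
      (Dec.does-⇔ (mk⇔ (surjective-cong e) (surjective-cong λ i → sym (e i))) (surjective? u) (surjective? v))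
      (inversions-cong e)

    κ-permutation : ∀ f → κ J Js (f ⟨$⟩ʳ_) ≡ q½ ^ ℓ f
    κ-permutation f = cong (λ b → if b then q½ ^ ℓ f else R.0#)
      (Dec.dec-true (surjective? (f ⟨$⟩ʳ_)) λ h → f Perm.⟨$⟩ˡ h , Perm.inverseʳ f)

    -- `κ` removes the choices that are not bijective. The bijective ones fix every point outside J,
    -- so they are the elements of the subgroup of J; on these `κ` is q½ to the power ℓ.
    ∑-choices : ∀ w → ∑ᴿ.∑[ choices exits ] (λ u → κ J Js u R.* M Js u w)
      R.≈ ∑ᴿ.∑[ 𝔖 ] (λ f → (q½ ^ ℓ f) R.* M Js (f ⟨$⟩ʳ_) w)
    ∑-choices w = R.trans (R.sym (∑ᴿ.∑-filter surjective? (All.universal vanish (choices exits))))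
      (R.trans (∑ᴿ.∑-reindex pointwise F (λ {u} {v} e →
          R.*-cong (R.reflexive (κ-cong e)) (M-cong Js {w = w} e λ _ → refl))
          (AllPairs.filter⁺ surjective? (choices-unique exits exits-unique))
          (AllPairs.map⁺ (AllPairs.filter⁺ (_∈𝔖? J) (permutations-unique n)))
          (All.zipWith (λ {u} (surj , fol) → permuted u surj fol)
            (All.all-filter surjective? (choices exits) ,
             All.filter⁺ surjective? (choices-All exits exits-follow)))
          (All.map⁺ (All.map (λ {f} f∈ → chosen f f∈) (All.all-filter (_∈𝔖? J) (permutations n)))))
        (R.trans (R.reflexive (∑ᴿ.∑-map _⟨$⟩ʳ_ 𝔖 F))
          (∑ᴿ.∑-cong 𝔖 λ f → R.*-congʳ (R.reflexive (κ-permutation f)))))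
      where
      F : (Fin n → Fin n) → R.Carrier
      F u = κ J Js u R.* M Js u w
      vanish : ∀ u → ¬ Surjective u → F u R.≈ R.0#
      vanish u ¬surj = R.trans (R.*-congʳ (R.reflexive
        (cong (λ b → if b then q½ ^ inversions u else R.0#) (Dec.dec-false (surjective? u) ¬surj)))) (R.zeroˡ _)
      permuted : ∀ u → Surjective u → (∀ i → Follows i (u i)) →
                 Any (λ v → ∀ i → u i ≡ v i) (map _⟨$⟩ʳ_ 𝔖)
      permuted u surj fol with π , π≡ ← surjective⇒permutation u surj =
        Any.map⁺ (Any.map (λ e i → trans (sym (π≡ i)) (e i))
          (Membership.∈-filter⁺ (permutationSetoid n) (_∈𝔖? J)
            (λ {f} {g} → ∈𝔖-resp f g) {v = π}
            (permutations-complete π)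
            (fixes⇒∈𝔖 J π λ i i∉ → trans (π≡ i) (proj₂ (fol i) (i∉ ∘ proj₂)))))
        where
        ∈𝔖-resp : ∀ f g → f Perm.≈ g → f ∈𝔖 J → g ∈𝔖 J
        ∈𝔖-resp f g e (v , vs , f≈) = v , vs , λ i → trans (sym (e i)) (f≈ i)
      chosen : ∀ f → f ∈𝔖 J →
               Any (λ v → ∀ i → f ⟨$⟩ʳ i ≡ v i) (filter surjective? (choices exits))
      chosen f f∈ = Membership.∈-filter⁺ pointwise surjective? surjective-cong
        (choices-complete exits (f ⟨$⟩ʳ_) λ i → follow-exits i _ (∈𝔖⇒follows f f∈ i))
        λ h → f Perm.⟨$⟩ˡ h , Perm.inverseʳ f

    M-∷ : ∀ w → M (J ∷ Js) (λ i → i) w R.≈ ∑ᴿ.∑[ 𝔖 ] (λ f → (q½ ^ ℓ f) R.* M Js (f ⟨$⟩ʳ_) w)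
    M-∷ w = R.trans (LinearForm.⟦⟧-cong ([z] (J ∷ Js)) (∏-B w))
      (R.trans (⟦⟧-∑ leftModule ([z] (J ∷ Js)) (choices exits) λ u →
          ∏ (map gen (letters (λ i → i) u)) * shiftᴱ (∏ (tabulate λ i → B Js (u i) (w i))))
      (R.trans (∑ᴿ.∑-cong-All (All.map (λ {u} fol →
          [z]-letters u fol (∏ (tabulate λ i → B Js (u i) (w i)))) (choices-All exits exits-follow)))
        (∑-choices w)))

  -- The skein relation for M.

  open import Algebra.Solver.Ring.NaturalCoefficients.Default R.commutativeSemiring
    using (solve; _:+_; _:*_; _:=_)

  module _ {N m} (Js : Vec (Interval (suc N)) m) (i : Fin N) (v : Fin (suc N) → Fin (suc N))
           (v-asc : v (inject₁ i) Fin.< v (suc i)) where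
    open PresentedAlgebra R (Z Js)
    open QuantumRelations (B-relations Js)

    M-linear : ∀ c {F G H : Fin (suc N) → Expr (Indeterminate Js)} →
      ∏ (tabulate F) ≈ ∏ (tabulate G) + c • ∏ (tabulate H) →
      LinearForm.⟦ [z] Js ⟧ (∏ (tabulate F)) R.≈ LinearForm.⟦ [z] Js ⟧ (∏ (tabulate G))
        R.+ c R.* LinearForm.⟦ [z] Js ⟧ (∏ (tabulate H))
    M-linear c {F} {G} {H} p = R.trans (LinearForm.⟦⟧-cong ([z] Js) p)
      (R.trans (LinearForm.+ᴹ-homo ([z] Js) (∏ (tabulate G)) (c • ∏ (tabulate H)))
        (R.+-congˡ (LinearForm.*ₗ-homo ([z] Js) c (∏ (tabulate H)))))

    module _ (w : Permutation′ (suc N)) where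
      Bʳ Bᶜ B₀ : Fin (suc N) → Expr (Indeterminate Js)
      Bʳ j = B Js (v (s i ⟨$⟩ʳ j)) (w ⟨$⟩ʳ j)
      Bᶜ j = B Js (v j) (w ⟨$⟩ʳ (s i ⟨$⟩ʳ j))
      B₀ j = B Js (v j) (w ⟨$⟩ʳ j)

      elsewhere : ∀ j → j ≢ inject₁ i → j ≢ suc i → Bʳ j ≡ Bᶜ j × Bʳ j ≡ B₀ j
      elsewhere j ne nf rewrite s-fixes i j ne nf = refl , refl

      -- The summand with coefficient 0 gives ascents and descents a common shape, so that `X-skein`
      -- can treat all w in one sum.
      M-ascent : Ascends i w → M Js (λ j → v (s i ⟨$⟩ʳ j)) (w ⟨$⟩ʳ_)
        R.≈ M Js v ((s i Perm.∘ₚ w) ⟨$⟩ʳ_) R.+ R.0# R.* M Js v (w ⟨$⟩ʳ_)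
      M-ascent asc = M-linear R.0# {Bʳ} {Bᶜ} {B₀} (∏-adjacent i R.0# Bʳ Bᶜ B₀ elsewhere (begin
        Bʳ (inject₁ i) * Bʳ (suc i)
          ≡⟨ cong₂ (λ a b → B Js (v a) (w ⟨$⟩ʳ inject₁ i) * B Js (v b) (w ⟨$⟩ʳ suc i))
               (s-left i) (s-right i) ⟩
        B Js (v (suc i)) (w ⟨$⟩ʳ inject₁ i) * B Js (v (inject₁ i)) (w ⟨$⟩ʳ suc i)
          ≈⟨ X-commute v-asc asc ⟩
        B Js (v (inject₁ i)) (w ⟨$⟩ʳ suc i) * B Js (v (suc i)) (w ⟨$⟩ʳ inject₁ i)
          ≡⟨ cong₂ (λ a b → B Js (v (inject₁ i)) (w ⟨$⟩ʳ a) * B Js (v (suc i)) (w ⟨$⟩ʳ b))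
               (s-left i) (s-right i) ⟨
        Bᶜ (inject₁ i) * Bᶜ (suc i)
          ≈⟨ ≈-trans (+-congˡ (0-• _)) (+-identityʳ _) ⟨
        Bᶜ (inject₁ i) * Bᶜ (suc i) + R.0# • (B₀ (inject₁ i) * B₀ (suc i)) ∎))

      M-descent : w ⟨$⟩ʳ suc i Fin.< w ⟨$⟩ʳ inject₁ i → M Js (λ j → v (s i ⟨$⟩ʳ j)) (w ⟨$⟩ʳ_)
        R.≈ M Js v ((s i Perm.∘ₚ w) ⟨$⟩ʳ_) R.+ d R.* M Js v (w ⟨$⟩ʳ_)
      M-descent desc = M-linear d {Bʳ} {Bᶜ} {B₀} (∏-adjacent i d Bʳ Bᶜ B₀ elsewhere (begin
        Bʳ (inject₁ i) * Bʳ (suc i)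
          ≡⟨ cong₂ (λ a b → B Js (v a) (w ⟨$⟩ʳ inject₁ i) * B Js (v b) (w ⟨$⟩ʳ suc i))
               (s-left i) (s-right i) ⟩
        B Js (v (suc i)) (w ⟨$⟩ʳ inject₁ i) * B Js (v (inject₁ i)) (w ⟨$⟩ʳ suc i)
          ≈⟨ X-cross v-asc desc ⟩
        B Js (v (inject₁ i)) (w ⟨$⟩ʳ suc i) * B Js (v (suc i)) (w ⟨$⟩ʳ inject₁ i)
          + d • (B₀ (inject₁ i) * B₀ (suc i))
          ≡⟨ cong₂ (λ a b → B Js (v (inject₁ i)) (w ⟨$⟩ʳ a) * B Js (v (suc i)) (w ⟨$⟩ʳ b)
                       + d • (B₀ (inject₁ i) * B₀ (suc i)))
               (s-left i) (s-right i) ⟨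
        Bᶜ (inject₁ i) * Bᶜ (suc i) + d • (B₀ (inject₁ i) * B₀ (suc i)) ∎))

  -- The elements X_u of the Hecke algebra.

  module HeckeAlgebra (N : ℕ) where
    open Hecke N using (T; C̃; quadratic; braid; commute)
    open PresentedAlgebra R (Hecke.H N)

    ≃⇒≈ : ∀ {u v} → u ≃ v → ∏ (map gen u) ≈ ∏ (map gen v)
    ≃⇒≈ ≃-refl        = ≈-refl
    ≃⇒≈ (≃-sym p)     = ≈-sym (≃⇒≈ p)
    ≃⇒≈ (≃-trans p q) = ≈-trans (≃⇒≈ p) (≃⇒≈ q)
    ≃⇒≈ (++-cong {u} {u′} {v} {v′} p q) = begin
      ∏ (map gen (u ++ v))          ≡⟨ cong ∏ (List.map-++ gen u v) ⟩
      ∏ (map gen u ++ map gen v)    ≈⟨ ∏-++ (map gen u) (map gen v) ⟩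
      ∏ (map gen u) * ∏ (map gen v) ≈⟨ *-cong (≃⇒≈ p) (≃⇒≈ q) ⟩
      ∏ (map gen u′) * ∏ (map gen v′) ≈⟨ ∏-++ (map gen u′) (map gen v′) ⟨
      ∏ (map gen u′ ++ map gen v′)  ≡⟨ cong ∏ (List.map-++ gen u′ v′) ⟨
      ∏ (map gen (u′ ++ v′))        ∎
    ≃⇒≈ (braid i j e) = begin
      gen i * (gen j * (gen i * const R.1#)) ≈⟨ three i j i ⟩
      gen i * gen j * gen i                  ≈⟨ rel (braid i j e) ⟩
      gen j * gen i * gen j                  ≈⟨ three j i j ⟨
      gen j * (gen i * (gen j * const R.1#)) ∎
      where
      three : ∀ i j k → gen i * (gen j * (gen k * const R.1#)) ≈ gen i * gen j * gen k
      three i j k = ≈-trans (*-congˡ (*-congˡ (*-identityʳ _))) (≈-sym (*-assoc _ _ _))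
    ≃⇒≈ (commute i j l) = ≈-trans (*-congˡ (*-identityʳ _))
      (≈-trans (rel (commute i j l)) (≈-sym (*-congˡ (*-identityʳ _))))

    T-cong : ∀ v w → v Perm.≈ w → T v ≡ T w
    T-cong v w e = cong (λ u → ∏ (map gen u)) (reducedWord-cong v w e)

    T-ascent : ∀ i w → Ascends i w → gen i * T w ≈ T (s i Perm.∘ₚ w)
    T-ascent i w asc = ≃⇒≈ (reducedWord-ascent i w asc)

    T-descent : ∀ i w → Ascends i (s i Perm.∘ₚ w) →
                gen i * T w ≈ q • T (s i Perm.∘ₚ w) + (q R.- R.1#) • T w
    T-descent i w asc = begin
      gen i * T w                   ≈⟨ *-congˡ (≈-sym Tw) ⟩
      gen i * (gen i * T sw)        ≈⟨ *-assoc _ _ _ ⟨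
      gen i * gen i * T sw          ≈⟨ *-congʳ (rel (quadratic i)) ⟩
      ((q R.- R.1#) • gen i + q • const R.1#) * T sw
        ≈⟨ distribʳ _ _ _ ⟩
      ((q R.- R.1#) • gen i) * T sw + (q • const R.1#) * T sw
        ≈⟨ +-cong (≈-trans (•-*ˡ _ _ _) (•-cong _ Tw))
             (≈-trans (•-*ˡ _ _ _) (•-cong q (*-identityˡ _))) ⟩
      (q R.- R.1#) • T w + q • T sw ≈⟨ +-comm _ _ ⟩
      q • T sw + (q R.- R.1#) • T w ∎
      where
      sw = s i Perm.∘ₚ w
      Tw : gen i * T sw ≈ T w
      Tw = ≈-trans (T-ascent i sw asc) (≡⇒≈ (T-cong (s i Perm.∘ₚ sw) w (s-s i w)))

    q-1≈q½d : q R.- R.1# R.≈ q½ R.* d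
    q-1≈q½d = R.trans (R.+-congʳ (R.trans q≈1+q½d (R.+-comm _ _)))
      (R.trans (R.+-assoc _ _ _) (R.trans (R.+-congˡ (R.-‿inverseʳ R.1#)) (R.+-identityʳ _)))

    module _ {m} (Js : Vec (Interval (suc N)) m) where

      X : (Fin (suc N) → Fin (suc N)) → Expr (Fin N)
      X u = ∑[ permutations (suc N) ] (λ w → ((q⁻½ ^ ℓ w) R.* M Js u (w ⟨$⟩ʳ_)) • T w)

      X-cong : ∀ {u v} → (∀ i → u i ≡ v i) → X u ≈ X v
      X-cong e = ∑-cong (permutations (suc N)) λ w →
        •-congʳ (T w) (R.*-congˡ (M-cong Js {w = w ⟨$⟩ʳ_} e λ _ → refl))

      ∑-s : ∀ i F → (∀ {v w} → v Perm.≈ w → F v ≈ F w) →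
            ∑[ permutations (suc N) ] F ≈ ∑[ permutations (suc N) ] (λ w → F (s i Perm.∘ₚ w))
      ∑-s i F F-cong = ≈-trans
        (∑-reindex (permutationSetoid (suc N)) F F-cong (permutations-unique (suc N))
          (AllPairs.map⁺ (AllPairs.map (λ {v} {w} ne e → ne λ j →
            trans (sym (s-s i v j)) (trans (e (s i ⟨$⟩ʳ j)) (s-s i w j))) (permutations-unique (suc N))))
          (All.universal (λ w → Any.map⁺ (Any.map
            (λ {x} e j → trans (sym (s-s i w j)) (e (s i ⟨$⟩ʳ j)))
            (permutations-complete (s i Perm.∘ₚ w)))) (permutations (suc N)))
          (All.universal permutations-complete (map (s i Perm.∘ₚ_) (permutations (suc N)))))
        (≡⇒≈ (∑-map (s i Perm.∘ₚ_) (permutations (suc N)) F))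

      X-skein : ∀ i v → v (inject₁ i) Fin.< v (suc i) → gen i * X v ≈ q½ • X (λ j → v (s i ⟨$⟩ʳ j))
      X-skein i v v-asc = begin
        gen i * X v
          ≈⟨ ∑-*ˡ (gen i) perms _ ⟩
        ∑[ perms ] (λ w → gen i * (c w • T w))
          ≈⟨ ∑-cong perms (λ w → ≈-trans (•-*ʳ (c w) (gen i) (T w)) (step w (direction i w))) ⟩
        ∑[ perms ] (λ w → F (s i Perm.∘ₚ w) + (q½ R.* ((q⁻½ ^ ℓ w) R.* (e w R.* M Js v (w ⟨$⟩ʳ_)))) • T w)
          ≈⟨ ∑-+ perms _ _ ⟩
        ∑[ perms ] (λ w → F (s i Perm.∘ₚ w))
          + ∑[ perms ] (λ w → (q½ R.* ((q⁻½ ^ ℓ w) R.* (e w R.* M Js v (w ⟨$⟩ʳ_)))) • T w)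
          -- Only the T_{sw} part is reindexed along w ↦ sw; afterwards both sums collect the
          -- coefficient of the same T_w.
          ≈⟨ +-cong (≈-sym (∑-s i F F-cong)) ≈-refl ⟩
        ∑[ perms ] F
          + ∑[ perms ] (λ w → (q½ R.* ((q⁻½ ^ ℓ w) R.* (e w R.* M Js v (w ⟨$⟩ʳ_)))) • T w)
          ≈⟨ ∑-+ perms _ _ ⟨
        ∑[ perms ] (λ w → F w + (q½ R.* ((q⁻½ ^ ℓ w) R.* (e w R.* M Js v (w ⟨$⟩ʳ_)))) • T w)
          ≈⟨ ∑-cong perms (λ w → ≈-trans (≈-sym (+-• _ _ (T w)))
               (≈-trans (•-congʳ (T w) (collect w)) (≈-sym (•-• q½ _ (T w))))) ⟩
        ∑[ perms ] (λ w → q½ • ((q⁻½ ^ ℓ w) R.* M Js vs (w ⟨$⟩ʳ_)) • T w)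
          ≈⟨ ∑-*ˡ (const q½) perms _ ⟨
        q½ • X vs ∎
        where
        perms = permutations (suc N)
        vs : Fin (suc N) → Fin (suc N)
        vs j = v (s i ⟨$⟩ʳ j)
        c e : Permutation′ (suc N) → R.Carrier
        c w = (q⁻½ ^ ℓ w) R.* M Js v (w ⟨$⟩ʳ_)
        e w = if does (w ⟨$⟩ʳ suc i Fin.<? w ⟨$⟩ʳ inject₁ i) then d else R.0#

        e-ascent : ∀ w → Ascends i w → e w ≡ R.0#
        e-ascent w asc = cong (λ b → if b then d else R.0#)
          (Dec.dec-false (w ⟨$⟩ʳ suc i Fin.<? w ⟨$⟩ʳ inject₁ i) (ℕ.<⇒≯ asc))

        e-descent : ∀ w → w ⟨$⟩ʳ suc i Fin.< w ⟨$⟩ʳ inject₁ i → e w ≡ d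
        e-descent w desc = cong (λ b → if b then d else R.0#)
          (Dec.dec-true (w ⟨$⟩ʳ suc i Fin.<? w ⟨$⟩ʳ inject₁ i) desc)

        F : Permutation′ (suc N) → Expr (Fin N)
        F w = (q½ R.* ((q⁻½ ^ ℓ w) R.* M Js v ((s i Perm.∘ₚ w) ⟨$⟩ʳ_))) • T w

        F-cong : ∀ {w x} → w Perm.≈ x → F w ≈ F x
        F-cong {w} {x} p = *-cong
          (const-cong (R.*-congˡ (R.*-cong (R.reflexive (cong (q⁻½ ^_) (ℓ-cong w x p)))
            (M-cong Js {v} {v} (λ _ → refl) λ j → p (s i ⟨$⟩ʳ j)))))
          (≡⇒≈ (T-cong w x p))

        collect : ∀ w →
          q½ R.* ((q⁻½ ^ ℓ w) R.* M Js v ((s i Perm.∘ₚ w) ⟨$⟩ʳ_))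
            R.+ q½ R.* ((q⁻½ ^ ℓ w) R.* (e w R.* M Js v (w ⟨$⟩ʳ_)))
          R.≈ q½ R.* ((q⁻½ ^ ℓ w) R.* M Js vs (w ⟨$⟩ʳ_))
        collect w = R.trans (R.sym (R.trans (R.*-congˡ (R.distribˡ _ _ _)) (R.distribˡ q½ _ _)))
          (R.*-congˡ (R.*-congˡ (R.sym (skein (direction i w)))))
          where
          skein : Direction i w → M Js vs (w ⟨$⟩ʳ_)
            R.≈ M Js v ((s i Perm.∘ₚ w) ⟨$⟩ʳ_) R.+ e w R.* M Js v (w ⟨$⟩ʳ_)
          skein (ascent asc)     rewrite e-ascent w asc   = M-ascent Js i v v-asc w asc
          skein (descent desc _) rewrite e-descent w desc = M-descent Js i v v-asc w desc

        Fs : ∀ w → F (s i Perm.∘ₚ w)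
          ≈ (q½ R.* ((q⁻½ ^ ℓ (s i Perm.∘ₚ w)) R.* M Js v (w ⟨$⟩ʳ_))) • T (s i Perm.∘ₚ w)
        Fs w = •-congʳ _ (R.*-congˡ (R.*-congˡ (M-cong Js {v} {v} (λ _ → refl) (s-s i w))))

        step : ∀ w → Direction i w → c w • (gen i * T w)
          ≈ F (s i Perm.∘ₚ w) + (q½ R.* ((q⁻½ ^ ℓ w) R.* (e w R.* M Js v (w ⟨$⟩ʳ_)))) • T w
        step w (ascent asc) = begin
          c w • (gen i * T w)
            ≈⟨ *-cong (const-cong (R.sym (R.trans (R.*-congˡ (R.*-congʳ (R.reflexive
                 (cong (q⁻½ ^_) (ℓ-ascent i w asc)))))
                 (R.trans (solve 4 (λ a b p x → a :* ((b :* p) :* x) := (a :* b) :* (p :* x))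
                   R.refl q½ q⁻½ (q⁻½ ^ ℓ w) (M Js v (w ⟨$⟩ʳ_)))
                 (R.trans (R.*-congʳ q½*q⁻½≈1) (R.*-identityˡ _))))))
               (T-ascent i w asc) ⟩
          (q½ R.* ((q⁻½ ^ ℓ (s i Perm.∘ₚ w)) R.* M Js v (w ⟨$⟩ʳ_))) • T (s i Perm.∘ₚ w)
            ≈⟨ Fs w ⟨
          F (s i Perm.∘ₚ w)
            ≈⟨ +-identityʳ _ ⟨
          F (s i Perm.∘ₚ w) + const R.0#
            ≈⟨ +-congˡ (≈-trans (•-congʳ (T w) vanish) (0-• (T w))) ⟨
          F (s i Perm.∘ₚ w) + (q½ R.* ((q⁻½ ^ ℓ w) R.* (e w R.* M Js v (w ⟨$⟩ʳ_)))) • T w ∎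
          where
          vanish : q½ R.* ((q⁻½ ^ ℓ w) R.* (e w R.* M Js v (w ⟨$⟩ʳ_))) R.≈ R.0#
          vanish rewrite e-ascent w asc = R.trans (R.*-congˡ (R.trans (R.*-congˡ (R.zeroˡ _)) (R.zeroʳ _)))
            (R.zeroʳ _)
        step w (descent desc asc) = begin
          c w • (gen i * T w)
            ≈⟨ •-cong (c w) (T-descent i w asc) ⟩
          c w • (q • T (s i Perm.∘ₚ w) + (q R.- R.1#) • T w)
            ≈⟨ ≈-trans (•-+ (c w) _ _) (+-cong (•-• (c w) q _) (•-• (c w) _ (T w))) ⟩
          (c w R.* q) • T (s i Perm.∘ₚ w) + (c w R.* (q R.- R.1#)) • T w
            ≈⟨ +-cong (≈-trans (•-congʳ _ first) (≈-sym (Fs w))) (•-congʳ (T w) second) ⟩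
          F (s i Perm.∘ₚ w) + (q½ R.* ((q⁻½ ^ ℓ w) R.* (e w R.* M Js v (w ⟨$⟩ʳ_)))) • T w ∎
          where
          x = M Js v (w ⟨$⟩ʳ_)
          first : c w R.* q R.≈ q½ R.* ((q⁻½ ^ ℓ (s i Perm.∘ₚ w)) R.* x)
          first = R.trans (R.*-congʳ (R.*-congʳ (R.reflexive (cong (q⁻½ ^_) (ℓ-descent i w asc)))))
            (R.trans (solve 4 (λ a b p x → ((b :* p) :* x) :* (a :* a) := (a :* b) :* (a :* (p :* x)))
              R.refl q½ q⁻½ (q⁻½ ^ ℓ (s i Perm.∘ₚ w)) x)
            (R.trans (R.*-congʳ q½*q⁻½≈1) (R.*-identityˡ _)))
          second : c w R.* (q R.- R.1#) R.≈ q½ R.* ((q⁻½ ^ ℓ w) R.* (e w R.* x))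
          second rewrite e-descent w desc = R.trans (R.*-congˡ q-1≈q½d)
            (solve 4 (λ a d p x → (p :* x) :* (a :* d) := a :* (p :* (d :* x))) R.refl q½ d (q⁻½ ^ ℓ w) x)

      -- Reducedness makes every left multiplication an ascent of the rows reached so far, so
      -- `X-skein` applies at each letter and contributes one q½.
      word-X : ∀ u → Reduced u → ∏ (map gen u) * X (λ i → i) ≈ (q½ ^ length u) • X (evalWord u ⟨$⟩ʳ_)
      word-X []      red = ≈-refl
      word-X (i ∷ u) red = begin
        gen i * ∏ (map gen u) * X (λ i → i)
          ≈⟨ *-assoc _ _ _ ⟩
        gen i * (∏ (map gen u) * X (λ i → i))
          ≈⟨ *-congˡ (word-X u (reduced-tail i u red)) ⟩
        gen i * ((q½ ^ length u) • X (evalWord u ⟨$⟩ʳ_))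
          ≈⟨ •-*ʳ _ _ _ ⟩
        (q½ ^ length u) • (gen i * X (evalWord u ⟨$⟩ʳ_))
          ≈⟨ •-cong _ (X-skein i (evalWord u ⟨$⟩ʳ_) (reduced-ascends i u red)) ⟩
        (q½ ^ length u) • q½ • X (evalWord (i ∷ u) ⟨$⟩ʳ_)
          ≈⟨ •-• _ q½ _ ⟩
        ((q½ ^ length u) R.* q½) • X (evalWord (i ∷ u) ⟨$⟩ʳ_)
          ≈⟨ •-congʳ _ (R.*-comm _ q½) ⟩
        (q½ ^ length (i ∷ u)) • X (evalWord (i ∷ u) ⟨$⟩ʳ_) ∎

      T-X : ∀ f → T f * X (λ i → i) ≈ (q½ ^ ℓ f) • X (f ⟨$⟩ʳ_)
      T-X f = ≈-trans (word-X (reducedWord f) (reducedWord-reduced f))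
        (*-cong (≡⇒≈ (cong (λ l → const (q½ ^ l)) (reducedWord-length f)))
          (X-cong (reducedWord-eval f)))

    •-∑ : ∀ {A : Set} (xs : List A) F t → ∑ᴿ.∑[ xs ] F • t ≈ ∑[ xs ] (λ x → F x • t)
    •-∑ []       F t = 0-• t
    •-∑ (x ∷ xs) F t = ≈-trans (+-• _ _ t) (+-congˡ (•-∑ xs F t))

    ∑ᴿ-*ˡ : ∀ {A : Set} c (xs : List A) F → c R.* ∑ᴿ.∑[ xs ] F R.≈ ∑ᴿ.∑[ xs ] (λ x → c R.* F x)
    ∑ᴿ-*ˡ c []       F = R.zeroʳ c
    ∑ᴿ-*ˡ c (x ∷ xs) F = R.trans (R.distribˡ c _ _) (R.+-congˡ (∑ᴿ-*ˡ c xs F))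

    X-∷ : ∀ {m} J (Js : Vec (Interval (suc N)) m) →
          X (J ∷ Js) (λ i → i) ≈ C̃ J * X Js (λ i → i)
    X-∷ J Js = begin
      X (J ∷ Js) (λ i → i)
        ≈⟨ ∑-cong perms (λ w → ≈-trans (•-congʳ (T w)
             (R.trans (R.*-congˡ (M-∷ J Js (w ⟨$⟩ʳ_))) (∑ᴿ-*ˡ (q⁻½ ^ ℓ w) 𝔖J _))) (•-∑ 𝔖J _ (T w))) ⟩
      ∑[ perms ] (λ w → ∑[ 𝔖J ] (λ f → ((q⁻½ ^ ℓ w) R.* ((q½ ^ ℓ f) R.* M Js (f ⟨$⟩ʳ_) (w ⟨$⟩ʳ_))) • T w))
        ≈⟨ ∑-swap perms 𝔖J _ ⟩
      ∑[ 𝔖J ] (λ f → ∑[ perms ] (λ w → ((q⁻½ ^ ℓ w) R.* ((q½ ^ ℓ f) R.* M Js (f ⟨$⟩ʳ_) (w ⟨$⟩ʳ_))) • T w))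
        ≈⟨ ∑-cong 𝔖J (λ f → ≈-trans (∑-cong perms λ w → ≈-trans
             (•-congʳ (T w) (x∙yz≈y∙xz _ _ _)) (≈-sym (•-• _ _ (T w))))
             (≈-sym (∑-*ˡ (const (q½ ^ ℓ f)) perms _))) ⟩
      ∑[ 𝔖J ] (λ f → (q½ ^ ℓ f) • X Js (f ⟨$⟩ʳ_))
        ≈⟨ ∑-cong 𝔖J (T-X Js) ⟨
      ∑[ 𝔖J ] (λ f → T f * X Js (λ i → i))
        ≈⟨ ∑-*ʳ (X Js (λ i → i)) 𝔖J T ⟨
      C̃ J * X Js (λ i → i) ∎
      where
      open import Algebra.Properties.CommutativeSemigroup R.*-commutativeSemigroup using (x∙yz≈y∙xz)
      perms = permutations (suc N)
      𝔖J = filter (_∈𝔖? J) perms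

    module _ where
      private module Z₀ = PresentedAlgebra R (Z {suc N} [])

      ∏-0 : ∀ {n} {F : Fin n → Expr (Indeterminate {suc N} [])} i → F i Z₀.≈ const R.0# →
            ∏ (tabulate F) Z₀.≈ const R.0#
      ∏-0 zero    p = Z₀.≈-trans (Z₀.*-congʳ p) (Z₀.zeroˡ _)
      ∏-0 (suc i) p = Z₀.≈-trans (Z₀.*-congˡ (∏-0 i p)) (Z₀.zeroʳ _)

      ∏-1 : ∀ {n} {F : Fin n → Expr (Indeterminate {suc N} [])} → (∀ i → F i Z₀.≈ const R.1#) →
            ∏ (tabulate F) Z₀.≈ const R.1#
      ∏-1 {zero}  p = Z₀.≈-refl
      ∏-1 {suc n} p = Z₀.≈-trans (Z₀.*-cong (p zero) (∏-1 (p ∘ suc))) (Z₀.*-identityˡ _)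

      M-[]-off : ∀ (w : Fin (suc N) → Fin (suc N)) i → i ≢ w i → M [] (λ i → i) w R.≈ R.0#
      M-[]-off w i ne = R.trans
        (LinearForm.⟦⟧-cong ([z] {suc N} []) (∏-0 {F = λ j → B [] j (w j)} i (Z₀.≡⇒≈ (B-[]-off ne))))
        (LinearForm.0ᴹ-homo ([z] {suc N} []))

      -- The empty network has no indeterminates, so z_G is the empty monomial and its coefficient
      -- in 1 is 1.
      M-[]-id : M {suc N} [] (λ i → i) (λ i → i) R.≈ R.1#
      M-[]-id = R.trans (LinearForm.⟦⟧-cong ([z] {suc N} []) (∏-1 {F = λ i → B [] i i} λ i → Z₀.≈-trans (B-[] i i)
          (Z₀.≡⇒≈ (cong (λ b → const (if b then R.1# else R.0#)) (Dec.dec-true (i Fin.≟ i) refl)))))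
        (R.trans (R.*-identityˡ _) (R.reflexive (cong (λ b → if b then R.1# else R.0#)
          (Dec.dec-true (Coefficient.squarefree? {suc N} [] [])
            (All.universal (λ { (ζ _ () _) }) (indeterminates {suc N} []))))))

    -- B is the identity matrix, so every w other than e meets a zero entry.
    X-[] : X [] (λ i → i) ≈ const R.1#
    X-[] = begin
      ∑[ perms ] F
        ≈⟨ ∑-filter id? (All.universal vanish perms) ⟨
      ∑[ filter id? perms ] F
        ≈⟨ ∑-reindex (permutationSetoid (suc N)) F F-cong
             (AllPairs.filter⁺ id? (permutations-unique (suc N))) ([] ∷ [])
             (All.map (λ e → here e) (All.all-filter id? perms))
             (Membership.∈-filter⁺ (permutationSetoid (suc N)) id? (λ e f i → trans (sym (e i)) (f i))
               {v = Perm.id} (permutations-complete Perm.id) (λ _ → refl) ∷ []) ⟩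
      F Perm.id + const R.0#
        ≈⟨ +-identityʳ _ ⟩
      ((q⁻½ ^ ℓ (Perm.id {suc N})) R.* M {suc N} [] (λ i → i) (λ i → i)) • T Perm.id
        ≈⟨ *-cong (const-cong (R.*-cong (R.reflexive (cong (q⁻½ ^_) ℓ-id)) M-[]-id))
             (≡⇒≈ (cong (λ u → ∏ (map gen u)) T-id)) ⟩
      (R.1# R.* R.1#) • const R.1#
        ≈⟨ ≈-trans (*-identityʳ _) (const-cong (R.*-identityˡ R.1#)) ⟩
      const R.1# ∎
      where
      perms = permutations (suc N)
      F : Permutation′ (suc N) → Expr (Fin N)
      F w = ((q⁻½ ^ ℓ w) R.* M [] (λ i → i) (w ⟨$⟩ʳ_)) • T w
      id? : ∀ (w : Permutation′ (suc N)) → Dec (w Perm.≈ Perm.id)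
      id? w = Fin.all? λ i → w ⟨$⟩ʳ i Fin.≟ i
      F-cong : ∀ {v w} → v Perm.≈ w → F v ≈ F w
      F-cong {v} {w} e = *-cong (const-cong (R.*-cong (R.reflexive (cong (q⁻½ ^_) (ℓ-cong v w e)))
        (M-cong {suc N} [] {λ i → i} {λ i → i} (λ _ → refl) e))) (≡⇒≈ (T-cong v w e))
      vanish : ∀ w → ¬ w Perm.≈ Perm.id → F w ≈ const R.0#
      vanish w ne with i , wi≢ ← Fin.¬∀⟶∃¬ (suc N) _ (λ i → w ⟨$⟩ʳ i Fin.≟ i) ne =
        ≈-trans (•-congʳ (T w) (R.trans (R.*-congˡ (M-[]-off (w ⟨$⟩ʳ_) i (wi≢ ∘ sym))) (R.zeroʳ _)))
          (0-• (T w))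
      ℓ-id : ℓ (Perm.id {suc N}) ≡ 0
      ℓ-id = ℕ.n≤0⇒n≡0 (ℓ-evalWord {N} [])
      T-id : reducedWord (Perm.id {suc N}) ≡ []
      T-id with reducedWord (Perm.id {suc N}) | trans (reducedWord-length (Perm.id {suc N})) ℓ-id
      ... | [] | _ = refl

    ∏-C̃ : ∀ {m} (Js : Vec (Interval (suc N)) m) → ∏ (map C̃ (toList Js)) ≈ X Js (λ i → i)
    ∏-C̃ []       = ≈-sym X-[]
    ∏-C̃ (J ∷ Js) = ≈-trans (*-congˡ (∏-C̃ Js)) (≈-sym (X-∷ J Js))

    θ-∏-C̃ : ∀ {m} (θ : LinearForm (Algebra.leftModule (Hecke.H N))) (Js : Vec (Interval (suc N)) m) →
      LinearForm.⟦ θ ⟧ (∏ (map C̃ (toList Js))) R.≈ LinearForm.⟦ σB Js ⟧ (Imm θ)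
    θ-∏-C̃ θ Js = R.trans (LinearForm.⟦⟧-cong θ (∏-C̃ Js))
      (R.trans (⟦⟧-∑ leftModule θ perms (λ w → ((q⁻½ ^ ℓ w) R.* M Js (λ i → i) (w ⟨$⟩ʳ_)) • T w))
      (R.trans (∑ᴿ.∑-cong perms each)
        (R.sym (⟦⟧-∑ 𝒜[n,n] (σB Js) perms
          (λ w → LeftModule._*ₗ_ 𝒜[n,n] ((q⁻½ ^ ℓ w) R.* LinearForm.⟦ θ ⟧ (T w)) (x^e w))))))
      where
      open QuantumMatrix (suc N) using (𝒜[n,n]; x^e_)
      perms = permutations (suc N)
      each : ∀ w → LinearForm.⟦ θ ⟧ (((q⁻½ ^ ℓ w) R.* M Js (λ i → i) (w ⟨$⟩ʳ_)) • T w)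
        R.≈ LinearForm.⟦ σB Js ⟧ (LeftModule._*ₗ_ 𝒜[n,n] ((q⁻½ ^ ℓ w) R.* LinearForm.⟦ θ ⟧ (T w)) (x^e w))
      each w = R.trans (LinearForm.*ₗ-homo θ _ (T w))
        (R.trans (solve 3 (λ a b c → (a :* b) :* c := (a :* c) :* b) R.refl
            (q⁻½ ^ ℓ w) (M Js (λ i → i) (w ⟨$⟩ʳ_)) (LinearForm.⟦ θ ⟧ (T w)))
        (R.trans (R.*-congˡ (R.sym (R.trans (σB-x^e Js w) (R.reflexive
            (cong (λ ts → LinearForm.⟦ [z] Js ⟧ (∏ ts)) (List.map-tabulate (λ i → i) λ i → B Js i (w ⟨$⟩ʳ i)))))))
          (R.sym (LinearForm.*ₗ-homo (σB Js) _ (x^e w)))))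

-- Specialisation to Laurent polynomials in the square root of q.

open import Defs

theorem5p2 : ∀ {N m : ℕ} (θ : LinearForm (Algebra.leftModule (Hecke.H N))) (Js : Vec (Interval (suc N)) m) →
    ⟦ θ ⟧ (∏ (map (Hecke.C̃ N) (toList Js))) ≈ ⟦ σB Js ⟧ (Imm θ)
theorem5p2 {N} θ Js = StarNetworkImmanants.HeckeAlgebra.θ-∏-C̃ ℤ[q±½] q½ q⁻½
  -- The product of `q½` and `q⁻½` computes to the one-term list that represents 1.
  (CommutativeRing.refl ℤ[q±½]) N θ Js
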